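{- Let $c$ be a positive integer. (a) The lattice $\mathbb{Z}^2$, and likewise $\mathbb{Z}^6$, has a multiplier of norm $c$ if and only if $c=r^2+s^2$ for some $r,s\in\mathbb{Z}$, i.e. if and only if every prime $\equiv 3\pmod 4$ appears to an even power in $c$. (b) The root lattice $A_2$, and likewise $E_6$, has a multiplier of norm $c$ if and only if $c=r^2-rs+s^2$ for some $r,s\in\mathbb{Z}$, i.e. if and only if every prime $\equiv 2\pmod 3$ appears to an even power in $c$. (c) The root lattice $A_4$ has a multiplier of norm $c$ if and only if $c=r^2+rs-s^2$ for some $r,s\in\mathbb{Z}$, i.e. if and only if every prime $\equiv\pm 2\pmod 5$ appears to an even power in $c$.
   Context: A similarity of norm $c$ is a linear map $\sigma:\mathbb{R}^n\to\mathbb{R}^n$ with $\sigma u\cdot\sigma v=c\,u\cdot v$ for all $u,v$. A multiplier of norm $c$ for a lattice $\Lambda$ is a similarity $\sigma$ of norm $c$ with $\sigma(\Lambda)\subseteq\Lambda$. $A_2,A_4,E_6$ are the standard root lattices. -}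

module Defs where

open import Data.Nat as ℕ using (ℕ; zero; suc; _%_; _^_)
open import Data.Nat.Divisibility using (_∣_)
open import Data.Nat.Primality using (Prime)
open import Data.Integer as ℤ using (ℤ; +_; 0ℤ; 1ℤ; -1ℤ; _+_; _-_; _*_)
open import Data.Fin using (Fin; zero; suc)
open import Data.Vec using (Vec; []; _∷_; lookup)
open import Data.Product using (∃; ∃-syntax; _×_)
open import Data.Sum using (_⊎_)
open import Relation.Binary.PropositionalEquality using (_≡_)
open import Relation.Nullary using (¬_)

Σℤ : (n : ℕ) → (Fin n → ℤ) → ℤ
Σℤ zero    f = 0ℤ
Σℤ (suc n) f = f zero + Σℤ n (λ i → f (suc i))

-- A (full-rank) lattice in its ambient Euclidean space, given by the integer
-- Gram matrix of a basis b₁,…,bₙ:  G i j = bᵢ · bⱼ.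
Gram : ℕ → Set
Gram n = Fin n → Fin n → ℤ

fromRows : {n : ℕ} → Vec (Vec ℤ n) n → Gram n
fromRows rows i j = lookup (lookup rows i) j

-- Inner product σ(bᵢ)·σ(bⱼ) when σ(bⱼ) = Σₖ M k j bₖ (M = integer matrix of σ
-- in the lattice basis; integrality is exactly σ(Λ) ⊆ Λ).
imageGram : {n : ℕ} → Gram n → (Fin n → Fin n → ℤ) → Gram n
imageGram {n} G M i j = Σℤ n (λ k → Σℤ n (λ l → M k i * G k l * M l j))

-- σ (a linear map with σ(Λ) ⊆ Λ, given by its integer matrix M) is a
-- multiplier of norm c:  σu·σv = c (u·v) for all u,v (checked on the basis).
IsMultiplier : {n : ℕ} → Gram n → ℕ → (Fin n → Fin n → ℤ) → Set
IsMultiplier G c M = ∀ i j → imageGram G M i j ≡ (+ c) * G i j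

HasMultiplier : {n : ℕ} → Gram n → ℕ → Set
HasMultiplier G c = ∃[ M ] IsMultiplier G c M

2ℤ : ℤ
2ℤ = + 2

ℤⁿ : (n : ℕ) → Gram n
ℤⁿ n i j with Data.Fin._≟_ i j
... | Relation.Nullary.yes _ = 1ℤ
... | Relation.Nullary.no _  = 0ℤ
  where open import Data.Fin

A₂ : Gram 2
A₂ = fromRows
  ( (2ℤ ∷ -1ℤ ∷ []) ∷
    (-1ℤ ∷ 2ℤ ∷ []) ∷ [])

A₄ : Gram 4
A₄ = fromRows
  ( (2ℤ  ∷ -1ℤ ∷ 0ℤ  ∷ 0ℤ  ∷ []) ∷
    (-1ℤ ∷ 2ℤ  ∷ -1ℤ ∷ 0ℤ  ∷ []) ∷
    (0ℤ  ∷ -1ℤ ∷ 2ℤ  ∷ -1ℤ ∷ []) ∷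
    (0ℤ  ∷ 0ℤ  ∷ -1ℤ ∷ 2ℤ  ∷ []) ∷ [])

-- E₆: simple roots 1-2-3-4-5 in a chain, root 6 attached to root 3.
E₆ : Gram 6
E₆ = fromRows
  ( (2ℤ  ∷ -1ℤ ∷ 0ℤ  ∷ 0ℤ  ∷ 0ℤ  ∷ 0ℤ  ∷ []) ∷
    (-1ℤ ∷ 2ℤ  ∷ -1ℤ ∷ 0ℤ  ∷ 0ℤ  ∷ 0ℤ  ∷ []) ∷
    (0ℤ  ∷ -1ℤ ∷ 2ℤ  ∷ -1ℤ ∷ 0ℤ  ∷ -1ℤ ∷ []) ∷
    (0ℤ  ∷ 0ℤ  ∷ -1ℤ ∷ 2ℤ  ∷ -1ℤ ∷ 0ℤ  ∷ []) ∷
    (0ℤ  ∷ 0ℤ  ∷ 0ℤ  ∷ -1ℤ ∷ 2ℤ  ∷ 0ℤ  ∷ []) ∷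
    (0ℤ  ∷ 0ℤ  ∷ -1ℤ ∷ 0ℤ  ∷ 0ℤ  ∷ 2ℤ  ∷ []) ∷ [])

SumOfTwoSquares : ℕ → Set
SumOfTwoSquares c = ∃[ r ] ∃[ s ] (+ c ≡ r * r + s * s)

IsR²-RS+S² : ℕ → Set
IsR²-RS+S² c = ∃[ r ] ∃[ s ] (+ c ≡ r * r - r * s + s * s)

IsR²+RS-S² : ℕ → Set
IsR²+RS-S² c = ∃[ r ] ∃[ s ] (+ c ≡ r * r + r * s - s * s)

EvenPower : ℕ → ℕ → Set
EvenPower p c = ∀ k → p ^ k ∣ c → ¬ (p ^ suc k ∣ c) → ∃[ m ] (k ≡ 2 ℕ.* m)

PrimesEvenPower : (ℕ → Set) → ℕ → Set
PrimesEvenPower P c = ∀ p → Prime p → P p → EvenPower p c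

Is3mod4 Is2mod3 Is±2mod5 : ℕ → Set
Is3mod4 p = p % 4 ≡ 3
Is2mod3 p = p % 3 ≡ 2
Is±2mod5 p = (p % 5 ≡ 2) ⊎ (p % 5 ≡ 3)

{-# OPTIONS --safe #-}
-- Let N be the norm form of ℤ[i], ℤ[ω] or ℤ[φ], φ the golden ratio; θ denotes the generator.
--
-- If a divides N(t + θ), then reducing t modulo a and descending on |a| factors t + θ into two elements, one of norm ± a.
-- So an inert prime dividing N(r + s θ) divides r and s, because no norm lies in its residue class, and a prime p is a
-- norm up to sign as soon as N(t + θ) has a root t modulo p. For the split primes a root exists because a map of order
-- 4, 3 or 5 over 𝔽ₚ, namely x ↦ (1 + x)/(1 - x), x ↦ -1/(1 + x) or (x , y) ↦ (y , (1 + y)/x), acts on a set whose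
-- cardinality is not divisible by the order, so not freely, and a point with a shorter orbit gives such a root.
--
-- Necessity for ℤ⁶, E₆ and A₄ is Witt cancellation in the elementary form of Bruck and Ryser. As c is a sum of four
-- squares, 4⟨1⟩ and c·4⟨1⟩ are isometric over ℚ, and over ℚ one has ℤ⁶ ≅ 4⟨1⟩ ⊥ ⟨1,1⟩, E₆ ≅ 4⟨2⟩ ⊥ 2A₂ and
-- A₄ ⊥ ⟨5⟩ ≅ 5⟨1⟩. Cancelling the four squares leaves an equation N(r + s θ) = c m² with m ≠ 0.
--
-- For A₄ a multiplier of split prime norm p comes from a sublattice of index p² on which the form vanishes modulo p:
-- dividing the form by p makes it an even quaternary form of determinant 5, and lattice reduction shows that A₄ is the
-- only one. The same reduction in determinant 1 proves that primes are sums of four squares.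

module Submission where

open import Defs
open import Data.Empty using (⊥; ⊥-elim)
import Data.Fin as Fin
open import Data.Fin using (Fin; zero; suc; toℕ; fromℕ<; fromℕ; inject₁; splitAt; join)
open import Data.Fin.Properties using (any?; toℕ-fromℕ<; all?; pigeonhole; join-splitAt; toℕ<n; toℕ-injective; fromℕ<-injective)
import Data.Integer as ℤ
open import Data.Integer using (ℤ; +_; -[1+_]; _+_; _-_; _*_; -_; ∣_∣; 0ℤ; 1ℤ; -1ℤ; _%ℕ_; _/ℕ_)
import Data.Integer.DivMod as ℤ
import Data.Integer.Divisibility.Signed as Signed
open import Data.Integer.Divisibility.Signed using (divides; ∣ᵤ⇒∣; ∣⇒∣ᵤ) renaming (_∣_ to _∣ᶻ_; _∣?_ to _∣ᶻ?_)
import Data.Integer.Properties as ℤ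
open import Data.Integer.Solver using (module +-*-Solver)
open import Data.List using (List; []; _∷_; length; filter; applyUpTo; cartesianProduct; map)
import Data.List.Membership.DecPropositional as DecMembership
open import Data.List.Membership.Propositional using (_∈_; _∉_)
open import Data.List.Membership.Propositional.Properties using (∈-applyUpTo⁺; ∈-applyUpTo⁻; ∈-filter⁺; ∈-filter⁻; ∈-++⁺ˡ; ∈-++⁺ʳ; ∈-++⁻; ∈-map⁺; ∈-map⁻; ∈-cartesianProduct⁺; ∈-cartesianProduct⁻)
open import Data.List.Membership.Propositional.Properties.WithK using (unique∧set⇒bag)
open import Data.List.Properties using (length-++; length-applyUpTo; length-map)
open import Data.List.Relation.Binary.BagAndSetEquality using (∼bag⇒↭)
open import Data.List.Relation.Binary.Disjoint.Propositional using (Disjoint)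
open import Data.List.Relation.Binary.Permutation.Propositional.Properties using (↭-length)
open import Data.List.Relation.Unary.All using (All; []; _∷_)
open import Data.List.Relation.Unary.Any using (here)
open import Data.List.Relation.Unary.Unique.Propositional using (Unique)
import Data.List.Relation.Unary.Unique.Propositional.Properties as Unique
open import Data.Nat as ℕ using (ℕ; zero; suc; _>_)
import Data.Nat.Coprimality as Coprimality
import Data.Nat.DivMod as ℕ
import Data.Nat.Divisibility as ℕ
import Data.Nat.GCD as GCD
open import Data.Nat.GeneralisedArithmetic using (fold; fold-+)
open import Data.Nat.Induction using (<-wellFounded)
open import Data.Nat.ListAction using (product)
open import Data.Nat.Primality using (Prime; prime⇒nonZero; prime⇒nonTrivial; euclidsLemma; prime⇒irreducible; prime[2]; prime?)
open import Data.Nat.Primality.Factorisation using (PrimeFactorisation; factorise)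
import Data.Nat.Properties as ℕ
open import Data.Nat.Solver using () renaming (module +-*-Solver to NS)
open import Data.Product using (∃-syntax; _×_; _,_; proj₁; proj₂)
open import Data.Product.Properties using (≡-dec)
open import Data.Sum using (_⊎_; inj₁; inj₂)
open import Data.Vec using (Vec; []; _∷_; lookup)
open import Function using (case_of_; it)
open import Function.Bundles using (mk⇔; _⇔_; module Equivalence)
open import Induction.WellFounded using (Acc; acc)
open import Relation.Binary.Definitions using (DecidableEquality)
open import Relation.Binary.PropositionalEquality
open import Relation.Nullary using (¬_; yes; no; contradiction; Dec)
open import Relation.Nullary.Decidable using (map′; True; toWitness; ¬?; _⊎-dec_; False; toWitnessFalse; from-yes)
open +-*-Solver using (Polynomial; solve; _:+_; _:*_; _:-_; :-_; _:=_; con)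

-- Determinants give no necessary condition: comparing them yields only that `c⁶` or `c⁴` is a
-- square. The obstruction is a finer rational invariant of the forms, and cancelling squares
-- extracts it by explicit elimination, without a classification of forms over ℚ. On ℤ², ℤ⁶, A₂ and
-- E₆ the ring ℤ[i] or ℤ[ω] acts with conjugation as adjoint, so an element of norm `c` is itself a
-- multiplier of norm `c`. On A₄ the ring ℤ[φ] acts by self-adjoint maps: multiplication by
-- `r + s φ` does not scale inner products by its norm, and a representation of `c` yields no
-- multiplier directly. There the parity condition on the exponents is the starting point, and a
-- multiplier is composed from those of prime norm and from scalars. The splitting laws are needed
-- for the moduli 4, 3 and 5 only, where counting the orbits of a map whose order is the modulus
-- replaces reciprocity. Signs matter only for ℤ[φ], whose norm is indefinite: inertness must
-- exclude `p` and `-p` together.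

:0 :1 :2 :3 :4 :5 : ∀ {n} → Polynomial n
:0 = con 0ℤ
:1 = con 1ℤ
:2 = con (+ 2)
:3 = con (+ 3)
:4 = con (+ 4)
:5 = con (+ 5)

-- Consequences of integer equations, and division with least remainder

*-vanish : ∀ k {l r : ℤ} → l ≡ r → k * (l - r) ≡ 0ℤ
*-vanish k {l} refl = trans (cong (k *_) (ℤ.i≡j⇒i-j≡0 {l} refl)) (ℤ.*-zeroʳ k)

-- The ring solver proves identities but takes no hypotheses. An equation is therefore deduced by
-- writing its difference as a combination of the differences in the hypotheses; the explicit
-- integers are the coefficients of this certificate.
by₁ : ∀ {x y l r : ℤ} k → l ≡ r → x - y ≡ k * (l - r) → x ≡ y
by₁ {x} {y} k h e = ℤ.i-j≡0⇒i≡j x y (trans e (*-vanish k h))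

by₂ : ∀ {x y l r l′ r′ : ℤ} k k′ → l ≡ r → l′ ≡ r′ → x - y ≡ k * (l - r) + k′ * (l′ - r′) → x ≡ y
by₂ {x} {y} k k′ h h′ e = ℤ.i-j≡0⇒i≡j x y (trans e (cong₂ _+_ (*-vanish k h) (*-vanish k′ h′)))

by₃ : ∀ {x y l r l′ r′ l″ r″ : ℤ} k k′ k″ → l ≡ r → l′ ≡ r′ → l″ ≡ r″ →
      x - y ≡ k * (l - r) + k′ * (l′ - r′) + k″ * (l″ - r″) → x ≡ y
by₃ {x} {y} k k′ k″ h h′ h″ e =
  ℤ.i-j≡0⇒i≡j x y (trans e (cong₂ _+_ (cong₂ _+_ (*-vanish k h) (*-vanish k′ h′)) (*-vanish k″ h″)))

∣E∣≡1⇒square≡1 : ∀ e → ∣ e ∣ ≡ 1 → e * e ≡ 1ℤ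
∣E∣≡1⇒square≡1 (+ 1)    refl = refl
∣E∣≡1⇒square≡1 -[1+ 0 ] refl = refl

round : ∀ e (a : ℤ) .{{_ : ℤ.NonZero a}} → ∃[ m ] 2 ℕ.* ∣ e - m * a ∣ ℕ.≤ ∣ a ∣
round e a@(ℤ.+[1+ k ]) with 2 ℕ.* (e %ℕ suc k) ℕ.≤? suc k
... | yes h = e /ℕ suc k , subst (λ z → 2 ℕ.* ∣ z ∣ ℕ.≤ suc k) eq h
  where
  eq : + (e %ℕ suc k) ≡ e - (e /ℕ suc k) * a
  eq = by₁ -1ℤ (ℤ.a≡a%ℕn+[a/ℕn]*n e (suc k))
    (solve 3 (λ r e q → r :- (e :- q) := con -1ℤ :* (e :- (r :+ q))) refl (+ (e %ℕ suc k)) e ((e /ℕ suc k) * a))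
... | no h = e /ℕ suc k + 1ℤ , subst (λ z → 2 ℕ.* z ℕ.≤ suc k) (sym eq′) bound
  where
  r = e %ℕ suc k
  q = e /ℕ suc k
  eq : e - (q + 1ℤ) * a ≡ + r - a
  eq = by₁ 1ℤ (ℤ.a≡a%ℕn+[a/ℕn]*n e (suc k))
    (solve 4 (λ r e q a → e :- (q :+ :1) :* a :- (r :- a) := :1 :* (e :- (r :+ q :* a))) refl (+ r) e q a)
  eq′ : ∣ e - (q + 1ℤ) * a ∣ ≡ suc k ℕ.∸ r
  eq′ = trans (cong ∣_∣ (trans eq (ℤ.m-n≡m⊖n r (suc k)))) (ℤ.∣⊖∣-< (ℤ.n%ℕd<d e (suc k)))
  bound : 2 ℕ.* (suc k ℕ.∸ r) ℕ.≤ suc k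
  bound = begin
    2 ℕ.* (suc k ℕ.∸ r)           ≡⟨ ℕ.*-distribˡ-∸ 2 (suc k) r ⟩
    2 ℕ.* suc k ℕ.∸ 2 ℕ.* r       ≤⟨ ℕ.∸-monoʳ-≤ (2 ℕ.* suc k) (ℕ.<⇒≤ (ℕ.≰⇒> h)) ⟩
    2 ℕ.* suc k ℕ.∸ suc k         ≡⟨ cong (ℕ._∸ suc k) (cong (suc k ℕ.+_) (ℕ.+-identityʳ (suc k))) ⟩
    suc k ℕ.+ suc k ℕ.∸ suc k     ≡⟨ ℕ.m+n∸n≡m (suc k) (suc k) ⟩
    suc k                         ∎
    where open ℕ.≤-Reasoning
round e a@(-[1+ k ]) with round e ℤ.+[1+ k ]
... | m , h = - m , subst (λ z → 2 ℕ.* ∣ z ∣ ℕ.≤ suc k)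
                      (solve 3 (λ e m a → e :- m :* :- a := e :- (:- m) :* a) refl e m a) h

-- Factorisation in ℤ[θ]

-- The norm of r + s θ in ℤ[θ], where θ² = v + u θ.
N : ℤ → ℤ → ℤ → ℤ → ℤ
N u v r s = r * r + u * r * s - v * s * s

:N : ∀ {n} → Polynomial n → Polynomial n → Polynomial n → Polynomial n → Polynomial n
:N u v r s = r :* r :+ u :* r :* s :- v :* s :* s

-- The two bounds keep `∣ N (t + θ) ∣` below `t² + ∣ t ∣ + 1`, which drives the descent; `N≢0`, the
-- irrationality of `θ`, keeps the cofactor away from zero.
record Small (u v : ℤ) : Set where
  field
    ∣u∣≤1 : ∣ u ∣ ℕ.≤ 1
    ∣v∣≤1 : ∣ v ∣ ℕ.≤ 1
    N≢0   : ∀ t → N u v t 1ℤ ≢ 0ℤ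

-- A factorisation t + θ = (r + s θ)(r′ + s′ θ) with N (r + s θ) = ± a.
record Factors (u v t a : ℤ) : Set where
  field
    r s r′ s′ e : ℤ
    real  : r * r′ + v * s * s′ ≡ t
    theta : r * s′ + s * r′ + u * s * s′ ≡ 1ℤ
    unit  : e * e ≡ 1ℤ
    norm  : N u v r s ≡ e * a

-- With `x` the absolute value of `t` rounded modulo `A`, this makes the cofactor strictly smaller
-- than `A`. The inequality fails at `A = 1`, `x = 0`, so units are the base case of the descent.
x²+x+1<A² : ∀ x A → 2 ℕ.* x ℕ.≤ A → 2 ℕ.≤ A → x ℕ.* x ℕ.+ x ℕ.+ 1 ℕ.< A ℕ.* A
x²+x+1<A² zero    A h 2≤A = ℕ.<-≤-trans (ℕ.s≤s (ℕ.s≤s ℕ.z≤n)) (ℕ.*-mono-≤ 2≤A 2≤A)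
x²+x+1<A² x@(suc k) A h 2≤A = ℕ.<-≤-trans x²+x+1<4x² (ℕ.*-mono-≤ h h)
  where
  x²+x+1<4x² : x ℕ.* x ℕ.+ x ℕ.+ 1 ℕ.< 2 ℕ.* x ℕ.* (2 ℕ.* x)
  x²+x+1<4x² = begin-strict
    x ℕ.* x ℕ.+ x ℕ.+ 1              ≤⟨ ℕ.+-mono-≤ (ℕ.+-monoʳ-≤ (x ℕ.* x) x≤x²) (ℕ.≤-trans (ℕ.s≤s ℕ.z≤n) x≤x²) ⟩
    x ℕ.* x ℕ.+ x ℕ.* x ℕ.+ x ℕ.* x  <⟨ ℕ.m<m+n _ (ℕ.s≤s ℕ.z≤n) ⟩
    x ℕ.* x ℕ.+ x ℕ.* x ℕ.+ x ℕ.* x ℕ.+ x ℕ.* x ≡⟨ NS.solve 1 (λ x → x NS.:* x NS.:+ x NS.:* x NS.:+ x NS.:* x NS.:+ x NS.:* x NS.:= NS.con 2 NS.:* x NS.:* (NS.con 2 NS.:* x)) refl x ⟩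
    2 ℕ.* x ℕ.* (2 ℕ.* x)            ∎
    where
    open ℕ.≤-Reasoning
    x≤x² : x ℕ.≤ x ℕ.* x
    x≤x² = ℕ.m≤m*n x x

∣N∣-bound : ∀ u v t → ∣ u ∣ ℕ.≤ 1 → ∣ v ∣ ℕ.≤ 1 → ∣ N u v t 1ℤ ∣ ℕ.≤ ∣ t ∣ ℕ.* ∣ t ∣ ℕ.+ ∣ t ∣ ℕ.+ 1
∣N∣-bound u v t hu hv = begin
  ∣ N u v t 1ℤ ∣                                ≤⟨ ℤ.∣i-j∣≤∣i∣+∣j∣ (t * t + u * t * 1ℤ) (v * 1ℤ * 1ℤ) ⟩
  ∣ t * t + u * t * 1ℤ ∣ ℕ.+ ∣ v * 1ℤ * 1ℤ ∣    ≤⟨ ℕ.+-mono-≤ (ℤ.∣i+j∣≤∣i∣+∣j∣ (t * t) (u * t * 1ℤ)) ∣v∣≤ ⟩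
  ∣ t * t ∣ ℕ.+ ∣ u * t * 1ℤ ∣ ℕ.+ 1            ≤⟨ ℕ.+-monoˡ-≤ 1 (ℕ.+-mono-≤ (ℕ.≤-reflexive (ℤ.∣i*j∣≡∣i∣*∣j∣ t t)) ∣ut∣≤) ⟩
  ∣ t ∣ ℕ.* ∣ t ∣ ℕ.+ ∣ t ∣ ℕ.+ 1               ∎
  where
  open ℕ.≤-Reasoning
  ∣v∣≤ : ∣ v * 1ℤ * 1ℤ ∣ ℕ.≤ 1
  ∣v∣≤ = subst (λ z → ∣ z ∣ ℕ.≤ 1) (solve 1 (λ v → v := v :* :1 :* :1) refl v) hv
  ∣ut∣≤ : ∣ u * t * 1ℤ ∣ ℕ.≤ ∣ t ∣
  ∣ut∣≤ = begin
    ∣ u * t * 1ℤ ∣    ≡⟨ cong ∣_∣ (ℤ.*-identityʳ (u * t)) ⟩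
    ∣ u * t ∣         ≡⟨ ℤ.∣i*j∣≡∣i∣*∣j∣ u t ⟩
    ∣ u ∣ ℕ.* ∣ t ∣   ≤⟨ ℕ.*-monoˡ-≤ ∣ t ∣ hu ⟩
    1 ℕ.* ∣ t ∣       ≡⟨ ℕ.*-identityˡ ∣ t ∣ ⟩
    ∣ t ∣             ∎

module _ {u v : ℤ} (small : Small u v) where
  open Small small

  private
    factor-acc : ∀ a .{{_ : ℤ.NonZero a}} t b → N u v t 1ℤ ≡ a * b → Acc ℕ._<_ ∣ a ∣ → Factors u v t a
    factor-acc a t b h (acc rec) with ∣ a ∣ ℕ.≤? 1
    ... | yes ∣a∣≤1 = record
      { r = 1ℤ ; s = 0ℤ ; r′ = t ; s′ = 1ℤ ; e = a
      ; real = solve 2 (λ t v → :1 :* t :+ v :* :0 :* :1 := t) refl t v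
      ; theta = solve 2 (λ t u → :1 :* :1 :+ :0 :* t :+ u :* :0 :* :1 := :1) refl t u
      ; unit = a²≡1
      ; norm = trans (solve 2 (λ u v → :N u v :1 :0 := :1) refl u v) (sym a²≡1)
      }
      where
      a²≡1 : a * a ≡ 1ℤ
      a²≡1 = ∣E∣≡1⇒square≡1 a (ℕ.≤-antisym ∣a∣≤1 (ℕ.n≢0⇒n>0 (ℕ.≢-nonZero⁻¹ ∣ a ∣)))
    ... | no ∣a∣≰1 with round t a
    ... | k , half = record
      -- The recursive factor `r′ + s′ θ` has norm `e a`, so `k a` equals `k e` times it times its
      -- conjugate `(r′ + u s′) - s′ θ`. Adding `k e` times the conjugate to the other factor turns
      -- the factorisation of `t₀ + θ` into one of `t + θ`.
      { r = F.r′ ; s = F.s′ ; r′ = F.r + k * e * (F.r′ + u * F.s′) ; s′ = F.s - k * e * F.s′ ; e = e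
      ; real = by₃ 1ℤ (k * e) (k * a) F.real norm′ F.unit
          (solve 10 (λ r s r′ s′ e k u v a t →
             r′ :* (r :+ k :* e :* (r′ :+ u :* s′)) :+ v :* s′ :* (s :- k :* e :* s′) :- t
             := :1 :* (r :* r′ :+ v :* s :* s′ :- (t :- k :* a)) :+ k :* e :* (:N u v r′ s′ :- e :* a) :+ k :* a :* (e :* e :- :1))
             refl F.r F.s F.r′ F.s′ e k u v a t)
      ; theta = by₁ 1ℤ F.theta
          (solve 8 (λ r s r′ s′ e k u v →
             r′ :* (s :- k :* e :* s′) :+ s′ :* (r :+ k :* e :* (r′ :+ u :* s′)) :+ u :* s′ :* (s :- k :* e :* s′) :- :1
             := :1 :* (r :* s′ :+ s :* r′ :+ u :* s :* s′ :- :1))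
             refl F.r F.s F.r′ F.s′ e k u v)
      ; unit = F.unit
      ; norm = norm′
      }
      where
      t₀ = t - k * a
      b₀ = b - + 2 * k * t + k * k * a - u * k
      N≡ : N u v t₀ 1ℤ ≡ a * b₀
      N≡ = by₁ 1ℤ h (solve 6 (λ u v t k a b → :N u v (t :- k :* a) :1 :- a :* (b :- :2 :* k :* t :+ k :* k :* a :- u :* k)
                              := :1 :* (:N u v t :1 :- a :* b)) refl u v t k a b)
      b₀≢0 : b₀ ≢ 0ℤ
      b₀≢0 b₀≡0 = N≢0 t₀ (trans N≡ (trans (cong (a *_) b₀≡0) (ℤ.*-zeroʳ a)))
      ∣b₀∣<∣a∣ : ∣ b₀ ∣ ℕ.< ∣ a ∣
      ∣b₀∣<∣a∣ = ℕ.*-cancelˡ-< (∣ a ∣) _ _ (begin-strict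
        ∣ a ∣ ℕ.* ∣ b₀ ∣                     ≡⟨ trans (cong ∣_∣ N≡) (ℤ.∣i*j∣≡∣i∣*∣j∣ a b₀) ⟨
        ∣ N u v t₀ 1ℤ ∣                      ≤⟨ ∣N∣-bound u v t₀ ∣u∣≤1 ∣v∣≤1 ⟩
        ∣ t₀ ∣ ℕ.* ∣ t₀ ∣ ℕ.+ ∣ t₀ ∣ ℕ.+ 1   <⟨ x²+x+1<A² ∣ t₀ ∣ ∣ a ∣ half (ℕ.≰⇒> ∣a∣≰1) ⟩
        ∣ a ∣ ℕ.* ∣ a ∣                      ∎)
        where open ℕ.≤-Reasoning
      instance
        b₀-nonZero : ℤ.NonZero b₀
        b₀-nonZero = ℤ.≢-nonZero b₀≢0
      module F = Factors (factor-acc b₀ t₀ a (trans N≡ (ℤ.*-comm a b₀)) (rec ∣b₀∣<∣a∣))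
      e = F.e
      norm-product : N u v F.r F.s * N u v F.r′ F.s′ ≡ N u v t₀ 1ℤ
      norm-product = trans
        (solve 6 (λ r s r′ s′ u v → :N u v r s :* :N u v r′ s′ := :N u v (r :* r′ :+ v :* s :* s′) (r :* s′ :+ s :* r′ :+ u :* s :* s′)) refl F.r F.s F.r′ F.s′ u v)
        (cong₂ (N u v) F.real F.theta)
      norm′ : N u v F.r′ F.s′ ≡ e * a
      norm′ = ℤ.*-cancelʳ-≡ _ _ b₀ (by₃ (- (n′ * b₀)) (- (e * n′)) e F.unit F.norm (trans norm-product N≡)
        (solve 5 (λ e n n′ a b₀ → n′ :* b₀ :- e :* a :* b₀ :=
           (:- (n′ :* b₀)) :* (e :* e :- :1) :+ (:- (e :* n′)) :* (n :- e :* b₀) :+ e :* (n :* n′ :- a :* b₀))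
           refl e (N u v F.r F.s) n′ a b₀))
        where n′ = N u v F.r′ F.s′

  factor : ∀ a .{{_ : ℤ.NonZero a}} t b → N u v t 1ℤ ≡ a * b → Factors u v t a
  factor a t b h = factor-acc a t b h (<-wellFounded ∣ a ∣)

-- Congruences and inert primes

module Mod (n : ℕ) where
  infix 4 _≈_
  -- Wrapped in a record so that `a` and `b` can be recovered by unification; their difference does
  -- not determine them.
  record _≈_ (a b : ℤ) : Set where
    constructor congruent
    field n∣a-b : + n ∣ᶻ a - b
  open _≈_ public

  ≡⇒≈ : ∀ {a b} → a ≡ b → a ≈ b
  ≡⇒≈ {a} refl = congruent (divides 0ℤ (ℤ.+-inverseʳ a))

  ≈-by₁ : ∀ {x y l r} k → l ≈ r → x - y ≡ k * (l - r) → x ≈ y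
  ≈-by₁ k h e = congruent (subst (+ n ∣ᶻ_) (sym e) (Signed.∣n⇒∣m*n k (n∣a-b h)))

  ≈-by₂ : ∀ {x y l r l′ r′} k k′ → l ≈ r → l′ ≈ r′ → x - y ≡ k * (l - r) + k′ * (l′ - r′) → x ≈ y
  ≈-by₂ k k′ h h′ e = congruent (subst (+ n ∣ᶻ_) (sym e)
    (Signed.∣m∣n⇒∣m+n (Signed.∣n⇒∣m*n k (n∣a-b h)) (Signed.∣n⇒∣m*n k′ (n∣a-b h′))))

  ≈-by₄ : ∀ {x y l r l′ r′ l″ r″ l‴ r‴} k k′ k″ k‴ → l ≈ r → l′ ≈ r′ → l″ ≈ r″ → l‴ ≈ r‴ →
          x - y ≡ k * (l - r) + k′ * (l′ - r′) + k″ * (l″ - r″) + k‴ * (l‴ - r‴) → x ≈ y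
  ≈-by₄ k k′ k″ k‴ h h′ h″ h‴ e = congruent (subst (+ n ∣ᶻ_) (sym e) (Signed.∣m∣n⇒∣m+n (Signed.∣m∣n⇒∣m+n
    (Signed.∣m∣n⇒∣m+n (Signed.∣n⇒∣m*n k (n∣a-b h)) (Signed.∣n⇒∣m*n k′ (n∣a-b h′))) (Signed.∣n⇒∣m*n k″ (n∣a-b h″))) (Signed.∣n⇒∣m*n k‴ (n∣a-b h‴))))

  ≈-sym : ∀ {a b} → a ≈ b → b ≈ a
  ≈-sym {a} {b} h = ≈-by₁ -1ℤ h (solve 2 (λ a b → b :- a := con -1ℤ :* (a :- b)) refl a b)

  ≈-trans : ∀ {a b c} → a ≈ b → b ≈ c → a ≈ c
  ≈-trans {a} {b} {c} h h′ = ≈-by₂ 1ℤ 1ℤ h h′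
    (solve 3 (λ a b c → a :- c := :1 :* (a :- b) :+ :1 :* (b :- c)) refl a b c)

  ≈0⇒∣ : ∀ {a} → a ≈ 0ℤ → + n ∣ᶻ a
  ≈0⇒∣ {a} h = subst (+ n ∣ᶻ_) (ℤ.+-identityʳ a) (n∣a-b h)

  ∣⇒≈0 : ∀ {a} → + n ∣ᶻ a → a ≈ 0ℤ
  ∣⇒≈0 {a} h = congruent (subst (+ n ∣ᶻ_) (sym (ℤ.+-identityʳ a)) h)

  infix 4 _≈?_
  _≈?_ : ∀ a b → Dec (a ≈ b)
  a ≈? b = map′ congruent n∣a-b (+ n ∣ᶻ? (a - b))

  %ℕ-≈ : .{{_ : ℕ.NonZero n}} → ∀ a → + (a %ℕ n) ≈ a
  %ℕ-≈ a = congruent (divides (- (a /ℕ n)) (by₁ -1ℤ (ℤ.a≡a%ℕn+[a/ℕn]*n a n)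
    (solve 4 (λ a r q n → r :- a :- (:- q) :* n := con -1ℤ :* (a :- (r :+ q :* n))) refl a (+ (a %ℕ n)) (a /ℕ n) (+ n))))

  <∧≈⇒≡ : ∀ {a b} → a ℕ.< n → b ℕ.< n → + a ≈ + b → a ≡ b
  <∧≈⇒≡ {a} {b} a<n b<n a≈b = ℤ.+-injective (ℤ.i-j≡0⇒i≡j (+ a) (+ b) (ℤ.∣i∣≡0⇒i≡0 (∣∣≡0 (∣⇒∣ᵤ (n∣a-b a≈b)))))
    where
    bound : ∣ + a - + b ∣ ℕ.< n
    bound = ℕ.≤-<-trans (subst (λ z → ∣ z ∣ ℕ.≤ a ℕ.⊔ b) (sym (ℤ.m-n≡m⊖n a b)) (ℤ.∣m⊝n∣≤m⊔n a b)) (ℕ.⊔-lub a<n b<n)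
    ∣∣≡0 : n ℕ.∣ ∣ + a - + b ∣ → ∣ + a - + b ∣ ≡ 0
    ∣∣≡0 d with ∣ + a - + b ∣ | bound
    ... | zero  | _  = refl
    ... | suc k | lt = contradiction d (ℕ.>⇒∤ lt)

module ModPrime {p : ℕ} (prime : Prime p) where
  open Mod p public
  instance
    p-nonZero : ℕ.NonZero p
    p-nonZero = prime⇒nonZero prime

  euclid : ∀ x y → x * y ≈ 0ℤ → x ≈ 0ℤ ⊎ y ≈ 0ℤ
  euclid x y h with euclidsLemma ∣ x ∣ ∣ y ∣ prime (subst (p ℕ.∣_) (ℤ.∣i*j∣≡∣i∣*∣j∣ x y) (∣⇒∣ᵤ (≈0⇒∣ h)))
  ... | inj₁ d = inj₁ (∣⇒≈0 (∣ᵤ⇒∣ d))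
  ... | inj₂ d = inj₂ (∣⇒≈0 (∣ᵤ⇒∣ d))

  *-≉0 : ∀ {x y} → ¬ x ≈ 0ℤ → ¬ y ≈ 0ℤ → ¬ x * y ≈ 0ℤ
  *-≉0 {x} {y} x≉0 y≉0 h with euclid x y h
  ... | inj₁ d = x≉0 d
  ... | inj₂ d = y≉0 d

  *-cancel-≈ : ∀ x {y z} → ¬ x ≈ 0ℤ → x * y ≈ x * z → y ≈ z
  *-cancel-≈ x {y} {z} x≉0 h = case euclid x (y - z) x[y-z]≈0 of λ where
      (inj₁ d) → contradiction d x≉0
      (inj₂ d) → congruent (≈0⇒∣ d)
    where
    x[y-z]≈0 : x * (y - z) ≈ 0ℤ
    x[y-z]≈0 = ≈-by₁ 1ℤ h (solve 3 (λ x y z → x :* (y :- z) :- :0 := :1 :* (x :* y :- x :* z)) refl x y z)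

  1≉0 : ¬ 1ℤ ≈ 0ℤ
  1≉0 h = ℕ.nonTrivial⇒≢1 {{prime⇒nonTrivial prime}} (ℕ.∣1⇒≡1 (∣⇒∣ᵤ (≈0⇒∣ h)))

  inverse : ∀ s → ¬ s ≈ 0ℤ → ∃[ s⁻ ] s * s⁻ ≈ 1ℤ
  inverse s s≉0 = bézout (Coprimality.coprime-Bézout coprime)
    where
    coprime : Coprimality.Coprime p (s %ℕ p)
    coprime = Coprimality.prime⇒coprime prime
      {{ℕ.≢-nonZero λ r≡0 → s≉0 (≈-trans (≈-sym (%ℕ-≈ s)) (≡⇒≈ (cong +_ r≡0)))}} (ℤ.n%ℕd<d s p)
    p≈0 : + p ≈ 0ℤ
    p≈0 = ∣⇒≈0 Signed.∣-refl
    lemma⁺ : ∀ r s y x p → 1ℤ + y * r ≡ x * p → s * (- y) - 1ℤ ≡ y * (r - s) + (- x) * (p - 0ℤ)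
    lemma⁺ r s y x p h = by₁ -1ℤ h (solve 5 (λ r s y x p → s :* (:- y) :- :1 :- (y :* (r :- s) :+ (:- x) :* (p :- :0)) :=
      con -1ℤ :* (:1 :+ y :* r :- x :* p)) refl r s y x p)
    lemma⁻ : ∀ r s y x p → 1ℤ + x * p ≡ y * r → s * y - 1ℤ ≡ (- y) * (r - s) + x * (p - 0ℤ)
    lemma⁻ r s y x p h = by₁ -1ℤ h (solve 5 (λ r s y x p → s :* y :- :1 :- ((:- y) :* (r :- s) :+ x :* (p :- :0)) :=
      con -1ℤ :* (:1 :+ x :* p :- y :* r)) refl r s y x p)
    bézout : GCD.Bézout.Identity 1 p (s %ℕ p) → ∃[ s⁻ ] s * s⁻ ≈ 1ℤ
    bézout (GCD.Bézout.+- x y eq) = - + y , ≈-by₂ (+ y) (- + x) (%ℕ-≈ s) p≈0 (lemma⁺ (+ (s %ℕ p)) s (+ y) (+ x) (+ p)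
      (trans (cong (λ z → 1ℤ + z) (sym (ℤ.pos-* y _))) (trans (cong +_ eq) (ℤ.pos-* x p))))
    bézout (GCD.Bézout.-+ x y eq) = + y , ≈-by₂ (- + y) (+ x) (%ℕ-≈ s) p≈0 (lemma⁻ (+ (s %ℕ p)) s (+ y) (+ x) (+ p)
      (trans (cong (λ z → 1ℤ + z) (sym (ℤ.pos-* x p))) (trans (cong +_ eq) (ℤ.pos-* y _))))

module Inert {u v : ℤ} (small : Small u v) {p : ℕ} (prime : Prime p)
             (not-norm : ∀ r s e → e * e ≡ 1ℤ → N u v r s ≢ e * + p) where
  open ModPrime prime

  -- If `s` is invertible modulo `p`, then `r s⁻ + θ` has norm divisible by `p`, and factoring it
  -- produces an element of norm `± p`, against `not-norm`.
  ∣N⇒∣s : ∀ r s → N u v r s ≈ 0ℤ → s ≈ 0ℤ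
  ∣N⇒∣s r s h = case s ≈? 0ℤ of λ where
      (yes s≈0) → s≈0
      (no  s≉0) → let s⁻ , ss⁻≈1 = inverse s s≉0 in ⊥-elim (absurd s⁻ ss⁻≈1)
    where
    module _ (s⁻ : ℤ) (ss⁻≈1 : s * s⁻ ≈ 1ℤ) where
      N≈0 : N u v (r * s⁻) 1ℤ ≈ 0ℤ
      N≈0 = ≈-by₂ (s⁻ * s⁻) (- (u * r * s⁻) + v * (s * s⁻ + 1ℤ)) h ss⁻≈1
        (solve 5 (λ r s s⁻ u v → :N u v (r :* s⁻) :1 :- :0
          := s⁻ :* s⁻ :* (:N u v r s :- :0) :+ (:- (u :* r :* s⁻) :+ v :* (s :* s⁻ :+ :1)) :* (s :* s⁻ :- :1)) refl r s s⁻ u v)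
      p∣N : + p ∣ᶻ N u v (r * s⁻) 1ℤ
      p∣N = ≈0⇒∣ N≈0
      module F = Factors (factor small (+ p) (r * s⁻) (Signed.quotient p∣N)
        (trans (Signed._∣_.equality p∣N) (ℤ.*-comm (Signed.quotient p∣N) (+ p))))
      absurd : ⊥
      absurd = not-norm F.r F.s F.e F.unit F.norm

  ∣N⇒∣r : ∀ r s → N u v r s ≈ 0ℤ → r ≈ 0ℤ
  ∣N⇒∣r r s h = case euclid r r r²≈0 of λ where
      (inj₁ d) → d
      (inj₂ d) → d
    where
    r²≈0 : r * r ≈ 0ℤ
    r²≈0 = ≈-by₂ 1ℤ (v * s - u * r) h (∣N⇒∣s r s h)
      (solve 4 (λ r s u v → r :* r :- :0 := :1 :* (:N u v r s :- :0) :+ (v :* s :- u :* r) :* (s :- :0)) refl r s u v)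

  private
    scale : ∀ r s r₁ s₁ → r ≡ r₁ * + p → s ≡ s₁ * + p → N u v r s ≡ + p * (+ p * N u v r₁ s₁)
    scale r s r₁ s₁ refl refl = solve 5 (λ u v r s p → :N u v (r :* p) (s :* p) := p :* (p :* :N u v r s)) refl u v r₁ s₁ (+ p)

    pos-*₃ : ∀ c m → + (c ℕ.* m ℕ.* m) ≡ + c * + m * + m
    pos-*₃ c m = trans (ℤ.pos-* (c ℕ.* m) m) (cong (_* + m) (ℤ.pos-* c m))

    instance
      p-nonTrivial : ℕ.NonTrivial p
      p-nonTrivial = prime⇒nonTrivial prime

    cancel-p : ∀ {x y} → + p * x ≡ + p * y → x ≡ y
    cancel-p {x} {y} = ℤ.*-cancelˡ-≡ (+ p) x y

    descend : ∀ r s → N u v r s ≈ 0ℤ → ∃[ r₁ ] ∃[ s₁ ] N u v r s ≡ + p * (+ p * N u v r₁ s₁)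
    descend r s h = Signed.quotient p∣r , Signed.quotient p∣s , scale r s (Signed.quotient p∣r) (Signed.quotient p∣s) (Signed._∣_.equality p∣r) (Signed._∣_.equality p∣s)
      where
      p∣r = ≈0⇒∣ (∣N⇒∣r r s h)
      p∣s = ≈0⇒∣ (∣N⇒∣s r s h)

    p∣cm² : ∀ c m n → + p * n ≡ + c * + m * + m → p ℕ.∣ c ℕ.* m ℕ.* m
    p∣cm² c m n h = ∣⇒∣ᵤ (divides n (trans (pos-*₃ c m) (trans (sym h) (ℤ.*-comm (+ p) n))))

    euclid₃ : ∀ c m → ¬ p ℕ.∣ m → p ℕ.∣ c ℕ.* m ℕ.* m → p ℕ.∣ c
    euclid₃ c m p∤m d = case euclidsLemma (c ℕ.* m) m prime d of λ where
      (inj₂ d₁) → contradiction d₁ p∤m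
      (inj₁ d₁) → case euclidsLemma c m prime d₁ of λ where
        (inj₁ d₂) → d₂
        (inj₂ d₂) → contradiction d₂ p∤m

    even-∤ : ∀ c → ¬ p ℕ.∣ c → EvenPower p c
    even-∤ c p∤c zero    _ _ = 0 , refl
    even-∤ c p∤c (suc k) d _ = contradiction (ℕ.∣-trans (ℕ.m∣m*n (p ℕ.^ k)) d) p∤c

    shift : ∀ k → p ℕ.^ suc (suc k) ≡ p ℕ.^ k ℕ.* p ℕ.* p
    shift k = NS.solve 2 (λ p q → p NS.:* (p NS.:* q) NS.:= q NS.:* p NS.:* p) refl p (p ℕ.^ k)

    even-*p² : ∀ c → EvenPower p c → EvenPower p (c ℕ.* p ℕ.* p)
    even-*p² c even zero       _ p∤ = contradiction (subst (ℕ._∣ c ℕ.* p ℕ.* p) (sym (ℕ.*-identityʳ p)) (ℕ.n∣m*n (c ℕ.* p))) p∤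
    even-*p² c even (suc zero) _ p²∤ = contradiction
      (subst (ℕ._∣ c ℕ.* p ℕ.* p) (cong (p ℕ.*_) (sym (ℕ.*-identityʳ p))) (ℕ.*-monoˡ-∣ p (ℕ.n∣m*n c))) p²∤
    even-*p² c even (suc (suc k)) d d′ = suc (proj₁ half) , trans (cong (λ z → suc (suc z)) (proj₂ half)) (cong suc (sym (ℕ.+-suc (proj₁ half) _)))
      where
      half : ∃[ j ] k ≡ 2 ℕ.* j
      half = even k (ℕ.*-cancelʳ-∣ p (ℕ.*-cancelʳ-∣ p (subst (ℕ._∣ c ℕ.* p ℕ.* p) (shift k) d)))
               (λ e → d′ (subst (ℕ._∣ c ℕ.* p ℕ.* p) (sym (shift (suc k))) (ℕ.*-monoˡ-∣ p (ℕ.*-monoˡ-∣ p e))))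

    -- Descent on `c m`. If `p` divides `c`, it divides `r` and `s`, and `p²` can be taken out of
    -- the norm. On the other side this square comes out of `m²` when `p` divides `m`, and otherwise
    -- out of `c`, whose exponent at `p` then drops by 2.
    even-acc : ∀ c m .{{_ : ℕ.NonZero c}} .{{_ : ℕ.NonZero m}} r s → N u v r s ≡ + c * + m * + m →
               Acc ℕ._<_ (c ℕ.* m) → EvenPower p c
    even-acc c m r s h (acc rec) = cases (p ℕ.∣? c) (p ℕ.∣? m)
      where
      module _ (p∣c : p ℕ.∣ c) where
        p∣N : N u v r s ≈ 0ℤ
        p∣N = ∣⇒≈0 (subst (+ p ∣ᶻ_) (sym h) (Signed.∣m⇒∣m*n {m = + c * + m} (+ m) (Signed.∣m⇒∣m*n {m = + c} (+ m) (∣ᵤ⇒∣ p∣c))))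
        r₁ = proj₁ (descend r s p∣N)
        s₁ = proj₁ (proj₂ (descend r s p∣N))
        N₁ = N u v r₁ s₁
        p²N≡ : + p * (+ p * N₁) ≡ + c * + m * + m
        p²N≡ = trans (sym (proj₂ (proj₂ (descend r s p∣N)))) h

        p∣m-case : ∀ m₁ → m ≡ m₁ ℕ.* p → EvenPower p c
        p∣m-case m₁ m≡ = even-acc c m₁ r₁ s₁
          (cancel-p (cancel-p (trans p²N≡ (trans (cong (λ z → + c * z * z) (trans (cong +_ m≡) (ℤ.pos-* m₁ p)))
            (solve 3 (λ c m p → c :* (m :* p) :* (m :* p) := p :* (p :* (c :* m :* m))) refl (+ c) (+ m₁) (+ p))))))
          (rec (ℕ.*-monoʳ-< c (subst (m₁ ℕ.<_) (sym m≡) (ℕ.m<m*n m₁ p (ℕ.nonTrivial⇒n>1 p)))))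
          where instance
            m₁-nonZero : ℕ.NonZero m₁
            m₁-nonZero = ℕ.m*n≢0⇒m≢0 m₁ {{subst ℕ.NonZero m≡ (ℕ.≢-nonZero (ℕ.≢-nonZero⁻¹ m))}}

        module _ (c₁ : ℕ) (c≡ : c ≡ c₁ ℕ.* p) where
          pN≡ : + p * N₁ ≡ + c₁ * + m * + m
          pN≡ = cancel-p (trans p²N≡ (trans (cong (λ z → z * + m * + m) (trans (cong +_ c≡) (ℤ.pos-* c₁ p)))
            (solve 3 (λ c m p → c :* p :* m :* m := p :* (c :* m :* m)) refl (+ c₁) (+ m) (+ p))))

          p∤m-case : ∀ c₂ → c₁ ≡ c₂ ℕ.* p → EvenPower p c
          p∤m-case c₂ c₁≡ = subst (EvenPower p) (sym c≡c₂p²) (even-*p² c₂ (even-acc c₂ m r₁ s₁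
            (cancel-p (trans pN≡ (trans (cong (λ z → z * + m * + m) (trans (cong +_ c₁≡) (ℤ.pos-* c₂ p)))
              (solve 3 (λ c m p → c :* p :* m :* m := p :* (c :* m :* m)) refl (+ c₂) (+ m) (+ p)))))
            (rec (ℕ.*-monoˡ-< m (subst (c₂ ℕ.<_) (sym c≡c₂p²) (ℕ.<-≤-trans (ℕ.m<m*n c₂ p (ℕ.nonTrivial⇒n>1 p)) (ℕ.m≤m*n (c₂ ℕ.* p) p)))))))
            where
            c≡c₂p² : c ≡ c₂ ℕ.* p ℕ.* p
            c≡c₂p² = trans c≡ (cong (ℕ._* p) c₁≡)
            instance
              c₂-nonZero : ℕ.NonZero c₂
              c₂-nonZero = ℕ.m*n≢0⇒m≢0 c₂ {{ℕ.m*n≢0⇒m≢0 (c₂ ℕ.* p) {{subst ℕ.NonZero c≡c₂p² (ℕ.≢-nonZero (ℕ.≢-nonZero⁻¹ c))}}}}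

      cases : Dec (p ℕ.∣ c) → Dec (p ℕ.∣ m) → EvenPower p c
      cases (no p∤c) _ = even-∤ c p∤c
      cases (yes p∣c) (yes (ℕ.divides m₁ m≡)) = p∣m-case p∣c m₁ m≡
      cases (yes p∣c@(ℕ.divides c₁ c≡)) (no p∤m) = case euclid₃ c₁ m p∤m (p∣cm² c₁ m _ (pN≡ p∣c c₁ c≡)) of λ where
        (ℕ.divides c₂ c₁≡) → p∤m-case p∣c c₁ c≡ c₂ c₁≡

  norm⇒even : ∀ c m .{{_ : ℕ.NonZero c}} .{{_ : ℕ.NonZero m}} r s → N u v r s ≡ + c * + m * + m → EvenPower p c
  norm⇒even c m r s h = even-acc c m r s h (<-wellFounded (c ℕ.* m))

-- Free cyclic actions

-- Duplicate-free lists with the same members are permutations of one another.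
length-split : ∀ {A : Set} {us vs xs : List A} → Unique us → Unique vs → Disjoint us vs → Unique xs →
               (∀ {z} → z ∈ us ⊎ z ∈ vs → z ∈ xs) → (∀ {z} → z ∈ xs → z ∈ us ⊎ z ∈ vs) →
               length us ℕ.+ length vs ≡ length xs
length-split {us = us} {vs} u-us u-vs disjoint u-xs to from = trans (sym (length-++ us))
  (↭-length (∼bag⇒↭ (unique∧set⇒bag (Unique.++⁺ u-us u-vs disjoint) u-xs
    (mk⇔ (λ z∈ → to (∈-++⁻ us z∈)) λ z∈ → case from z∈ of λ where
      (inj₁ h) → ∈-++⁺ˡ h
      (inj₂ h) → ∈-++⁺ʳ us h))))

module Orbits {A : Set} (_≟_ : DecidableEquality A) (f : A → A) (n : ℕ) where
  open DecMembership _≟_ using (_∈?_)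

  record FreeAction (xs : List A) : Set where
    field
      unique : Unique xs
      closed : ∀ {x} → x ∈ xs → f x ∈ xs
      period : ∀ {x} → x ∈ xs → fold x f (suc n) ≡ x
      free   : ∀ {x i} → x ∈ xs → 0 ℕ.< i → i ℕ.< suc n → fold x f i ≢ x

  private
    orbit : A → List A
    orbit x = applyUpTo (fold x f) (suc n)

    module _ {x xs} (act : FreeAction xs) (x∈xs : x ∈ xs) where
      open FreeAction act

      orbit-unique : Unique (orbit x)
      orbit-unique = Unique.applyUpTo⁺₁ (fold x f) (suc n) distinct
        where
        distinct : ∀ {i j} → i ℕ.< j → j ℕ.< suc n → fold x f i ≢ fold x f j
        -- Applying `f` another `suc n ∸ i` times to both sides of `eq` brings the left side back to
        -- `x` and the right side to the iterate of exponent `j ∸ i`, which freeness forbids.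
        distinct {i} {j} i<j j<n eq = free x∈xs (ℕ.m<n⇒0<n∸m i<j) (ℕ.≤-<-trans (ℕ.m∸n≤m j i) j<n) (begin
          fold x f (j ℕ.∸ i)                          ≡⟨ cong (λ z → fold z f (j ℕ.∸ i)) (period x∈xs) ⟨
          fold (fold x f (suc n)) f (j ℕ.∸ i)         ≡⟨ fold-+ x f (j ℕ.∸ i) ⟨
          fold x f (j ℕ.∸ i ℕ.+ suc n)                ≡⟨ cong (fold x f) arith ⟩
          fold x f (suc n ℕ.∸ i ℕ.+ j)                ≡⟨ fold-+ x f (suc n ℕ.∸ i) ⟩
          fold (fold x f j) f (suc n ℕ.∸ i)           ≡⟨ cong (λ z → fold z f (suc n ℕ.∸ i)) eq ⟨
          fold (fold x f i) f (suc n ℕ.∸ i)           ≡⟨ fold-+ x f (suc n ℕ.∸ i) ⟨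
          fold x f (suc n ℕ.∸ i ℕ.+ i)                ≡⟨ cong (fold x f) (ℕ.m∸n+n≡m i≤n) ⟩
          fold x f (suc n)                            ≡⟨ period x∈xs ⟩
          x                                           ∎)
          where
          open ≡-Reasoning
          i≤n : i ℕ.≤ suc n
          i≤n = ℕ.<⇒≤ (ℕ.<-trans i<j j<n)
          arith : j ℕ.∸ i ℕ.+ suc n ≡ suc n ℕ.∸ i ℕ.+ j
          arith = begin
            j ℕ.∸ i ℕ.+ suc n                        ≡⟨ cong (j ℕ.∸ i ℕ.+_) (ℕ.m∸n+n≡m i≤n) ⟨
            j ℕ.∸ i ℕ.+ (suc n ℕ.∸ i ℕ.+ i)          ≡⟨ NS.solve 3 (λ a b c → a NS.:+ (b NS.:+ c) NS.:= b NS.:+ (a NS.:+ c)) refl (j ℕ.∸ i) (suc n ℕ.∸ i) i ⟩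
            suc n ℕ.∸ i ℕ.+ (j ℕ.∸ i ℕ.+ i)          ≡⟨ cong (suc n ℕ.∸ i ℕ.+_) (ℕ.m∸n+n≡m (ℕ.<⇒≤ i<j)) ⟩
            suc n ℕ.∸ i ℕ.+ j                        ∎

      orbit-closed : ∀ {z} → z ∈ orbit x → f z ∈ orbit x
      orbit-closed z∈ with ∈-applyUpTo⁻ (fold x f) z∈
      ... | i , i<n , refl with suc i ℕ.<? suc n
      ...   | yes si<n = ∈-applyUpTo⁺ (fold x f) si<n
      ...   | no  si≮n = subst (λ k → fold x f k ∈ orbit x) (sym (ℕ.≤-antisym i<n (ℕ.≮⇒≥ si≮n)))
                           (subst (_∈ orbit x) (sym (period x∈xs)) (∈-applyUpTo⁺ (fold x f) {i = 0} (ℕ.s≤s ℕ.z≤n)))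

      orbit⊆ : ∀ {z} → z ∈ orbit x → z ∈ xs
      orbit⊆ z∈ with ∈-applyUpTo⁻ (fold x f) z∈
      ... | i , _ , refl = go i
        where
        go : ∀ i → fold x f i ∈ xs
        go zero    = x∈xs
        go (suc i) = closed (go i)

      ∉orbit? : ∀ z → Dec (z ∉ orbit x)
      ∉orbit? z = ¬? (z ∈? orbit x)

      rest : List A
      rest = filter ∉orbit? xs

      -- Applying `f` to `f z` another `n` times returns to `z`. This is why the complement of an
      -- orbit is closed under `f`.
      f∈orbit⇒∈orbit : ∀ {z} → z ∈ xs → f z ∈ orbit x → z ∈ orbit x
      f∈orbit⇒∈orbit {z} z∈xs fz∈ = subst (_∈ orbit x) (period z∈xs)
        (subst (_∈ orbit x) (trans (sym (fold-+ z f n {1})) (cong (fold z f) (ℕ.+-comm n 1))) (go n))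
        where
        go : ∀ i → fold (f z) f i ∈ orbit x
        go zero    = fz∈
        go (suc i) = orbit-closed (go i)

      rest-free : FreeAction rest
      rest-free = record
        { unique = Unique.filter⁺ ∉orbit? unique
        ; closed = λ z∈ → case ∈-filter⁻ ∉orbit? z∈ of λ where
            (z∈xs , z∉) → ∈-filter⁺ ∉orbit? (closed z∈xs) (λ fz∈ → z∉ (f∈orbit⇒∈orbit z∈xs fz∈))
        ; period = λ z∈ → period (proj₁ (∈-filter⁻ ∉orbit? z∈))
        ; free   = λ z∈ → free (proj₁ (∈-filter⁻ ∉orbit? z∈))
        }

      length-rest : suc n ℕ.+ length rest ≡ length xs
      length-rest = trans (cong (ℕ._+ length rest) (sym (length-applyUpTo (fold x f) (suc n))))
        (length-split orbit-unique (FreeAction.unique rest-free) (λ where (z∈o , z∈r) → proj₂ (∈-filter⁻ ∉orbit? {xs = xs} z∈r) z∈o) unique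
          (λ where
            (inj₁ z∈) → orbit⊆ z∈
            (inj₂ z∈) → proj₁ (∈-filter⁻ ∉orbit? z∈))
          (λ {z} z∈xs → case z ∈? orbit x of λ where
            (yes z∈) → inj₁ z∈
            (no z∉)  → inj₂ (∈-filter⁺ ∉orbit? z∈xs z∉)))

    -- Removing the orbit of the first element shortens the list by `suc n` and leaves a free
    -- action.
    divides-acc : ∀ {xs} → FreeAction xs → Acc ℕ._<_ (length xs) → suc n ℕ.∣ length xs
    divides-acc {[]} act _ = suc n ℕ.∣0
    divides-acc {x ∷ xs} act (acc rec) = subst (suc n ℕ.∣_) (length-rest act (here refl))
      (ℕ.∣m∣n⇒∣m+n ℕ.∣-refl (divides-acc (rest-free act (here refl))
        (rec (subst (length (rest act (here refl)) ℕ.<_) (length-rest act (here refl)) (ℕ.m<n+m _ (ℕ.s≤s ℕ.z≤n))))))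

  free⇒∣length : ∀ {xs} → FreeAction xs → suc n ℕ.∣ length xs
  free⇒∣length act = divides-acc act (<-wellFounded _)

-- Roots modulo p

module Roots {p : ℕ} (prime : Prime p) where
  open ModPrime prime

  Root : ℤ → ℤ → Set
  Root u v = ∃[ t ] N u v t 1ℤ ≈ 0ℤ

  -- `N (- x + θ)` is the value at `x` of the minimal polynomial `x² - u x - v` of `θ`. With this
  -- sign the fixed points of the maps below are literally roots.
  root-or-none : ∀ u v → Root u v ⊎ (∀ x → x ℕ.< p → ¬ N u v (- + x) 1ℤ ≈ 0ℤ)
  root-or-none u v = case any? (λ (i : Fin p) → N u v (- + toℕ i) 1ℤ ≈? 0ℤ) of λ where
    (yes (i , h)) → inj₁ (- + toℕ i , h)
    (no none)     → inj₂ λ x x<p h → none (fromℕ< x<p , subst (λ z → N u v (- + z) 1ℤ ≈ 0ℤ) (sym (toℕ-fromℕ< x<p)) h)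

  residue : ∀ a → ∃[ x ] x ℕ.< p × + x ≈ a
  residue a = a %ℕ p , ℤ.n%ℕd<d a p , %ℕ-≈ a

  abstract
    -- Junk value 0 when a ≈ 0.
    quotient : ℤ → ℤ → ℕ
    quotient b a = case a ≈? 0ℤ of λ where
      (yes _)   → 0
      (no a≉0)  → (b * proj₁ (inverse a a≉0)) %ℕ p

    quotient< : ∀ b a → quotient b a ℕ.< p
    quotient< b a with a ≈? 0ℤ
    ... | yes _ = ℕ.>-nonZero⁻¹ p
    ... | no a≉0 = ℤ.n%ℕd<d (b * proj₁ (inverse a a≉0)) p

    *-quotient : ∀ b a → ¬ a ≈ 0ℤ → a * + quotient b a ≈ b
    *-quotient b a a≉0 with a ≈? 0ℤ
    ... | yes a≈0 = contradiction a≈0 a≉0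
    ... | no a≉0′ = lemma (+ ((b * proj₁ (inverse a a≉0′)) %ℕ p)) (proj₁ (inverse a a≉0′)) (%ℕ-≈ (b * proj₁ (inverse a a≉0′))) (proj₂ (inverse a a≉0′))
      where
      lemma : ∀ q a⁻ → q ≈ b * a⁻ → a * a⁻ ≈ 1ℤ → a * q ≈ b
      lemma q a⁻ h h′ = ≈-by₂ a b h h′ (solve 4 (λ a b q a⁻ → a :* q :- b := a :* (q :- b :* a⁻) :+ b :* (a :* a⁻ :- :1)) refl a b q a⁻)

  -- The residues x with x ∉ {0, …, m} and x ≢ -1.
  residues : ℕ → List ℕ
  residues m = applyUpTo (ℕ._+_ (suc m)) (p ℕ.∸ suc (suc m))

  residues-unique : ∀ m → Unique (residues m)
  residues-unique m = Unique.applyUpTo⁺₁ _ _ (λ i<j _ e → ℕ.<⇒≢ i<j (ℕ.+-cancelˡ-≡ (suc m) _ _ e))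

  ∈-residues⁻ : ∀ {m x} → x ∈ residues m → m ℕ.< x × suc x ℕ.< p
  ∈-residues⁻ {m} x∈ = case ∈-applyUpTo⁻ (ℕ._+_ (suc m)) x∈ of λ where
    (i , i< , refl) → ℕ.m≤m+n (suc m) i , subst (ℕ._≤ p) (cong suc (ℕ.+-comm i (suc (suc m))))
      (ℕ.m≤o∸n⇒m+n≤o (suc i) (ℕ.<⇒≤ (ℕ.m∸n≢0⇒n<m (λ e → contradiction (subst (i ℕ.<_) e i<) (λ ())))) i<)

  ∈-residues⁺ : ∀ {m x} → m ℕ.< x → suc x ℕ.< p → x ∈ residues m
  ∈-residues⁺ {m} {x} m<x sx<p = subst (_∈ residues m) (ℕ.m+[n∸m]≡n m<x)
    (∈-applyUpTo⁺ (ℕ._+_ (suc m)) (ℕ.m+n≤o⇒m≤o∸n (suc (x ℕ.∸ suc m)) (subst (ℕ._≤ p) (sym eq) sx<p)))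
    where
    eq : suc (x ℕ.∸ suc m) ℕ.+ suc (suc m) ≡ suc (suc x)
    eq = cong suc (trans (ℕ.+-suc (x ℕ.∸ suc m) (suc m)) (cong suc (ℕ.m∸n+n≡m m<x)))

  length-residues : ∀ m → length (residues m) ≡ p ℕ.∸ suc (suc m)
  length-residues m = length-applyUpTo _ _

  ≉0⇒0< : ∀ {x} → ¬ + x ≈ 0ℤ → 0 ℕ.< x
  ≉0⇒0< {zero}  h = contradiction (≡⇒≈ refl) h
  ≉0⇒0< {suc x} h = ℕ.s≤s ℕ.z≤n

  0<⇒≉0 : ∀ {x} → 0 ℕ.< x → x ℕ.< p → ¬ + x ≈ 0ℤ
  0<⇒≉0 0<x x<p h = ℕ.<⇒≢ 0<x (sym (<∧≈⇒≡ x<p (ℕ.>-nonZero⁻¹ p) h))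

  1+≉0⇒suc< : ∀ {x} → x ℕ.< p → ¬ 1ℤ + + x ≈ 0ℤ → suc x ℕ.< p
  1+≉0⇒suc< x<p h = ℕ.≤∧≢⇒< x<p (λ { refl → h (∣⇒≈0 Signed.∣-refl) })

  suc<⇒1+≉0 : ∀ {x} → suc x ℕ.< p → ¬ 1ℤ + + x ≈ 0ℤ
  suc<⇒1+≉0 sx<p = 0<⇒≉0 (ℕ.s≤s ℕ.z≤n) sx<p

  module _ {A : Set} (f : A → A) where
    power-fixed : ∀ i k x → fold x f i ≡ x → fold x f (k ℕ.* i) ≡ x
    power-fixed i zero    x h = refl
    power-fixed i (suc k) x h = trans (fold-+ x f i) (trans (cong (λ z → fold z f i) (power-fixed i k x h)) h)

  module Order3 (no-root : ∀ x → x ℕ.< p → ¬ N -1ℤ -1ℤ (- + x) 1ℤ ≈ 0ℤ) where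
    -- On the projective line this map has the cycle `0 ↦ -1 ↦ ∞ ↦ 0`, so it permutes the other
    -- `p - 2` points. Its fixed points are the solutions of `x² + x + 1 = 0`.
    f : ℕ → ℕ
    f x = quotient -1ℤ (1ℤ + + x)

    record Dom (x : ℕ) : Set where
      field
        x<p   : x ℕ.< p
        x≉0   : ¬ + x ≈ 0ℤ
        1+x≉0 : ¬ 1ℤ + + x ≈ 0ℤ

    f-spec : ∀ {x} → Dom x → (1ℤ + + x) * + f x ≈ -1ℤ
    f-spec {x} d = *-quotient -1ℤ (1ℤ + + x) (Dom.1+x≉0 d)

    dom : ∀ {x} → x ∈ residues 0 → Dom x
    dom x∈ = case ∈-residues⁻ x∈ of λ where
      (0<x , sx<p) → record { x<p = ℕ.<-trans (ℕ.n<1+n _) sx<p ; x≉0 = 0<⇒≉0 0<x (ℕ.<-trans (ℕ.n<1+n _) sx<p) ; 1+x≉0 = suc<⇒1+≉0 sx<p }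

    dom⁻ : ∀ {x} → Dom x → x ∈ residues 0
    dom⁻ d = ∈-residues⁺ (≉0⇒0< (Dom.x≉0 d)) (1+≉0⇒suc< (Dom.x<p d) (Dom.1+x≉0 d))

    f-dom : ∀ {x} → Dom x → Dom (f x)
    f-dom {x} d = record
      { x<p = quotient< -1ℤ (1ℤ + + x)
      ; x≉0 = λ y≈0 → 1≉0 (≈-by₂ 1ℤ (- (1ℤ + + x)) (f-spec d) y≈0
          (solve 2 (λ x y → :1 :- :0 := :1 :* ((:1 :+ x) :* y :- con -1ℤ) :+ (:- (:1 :+ x)) :* (y :- :0)) refl (+ x) (+ f x)))
      ; 1+x≉0 = λ 1+y≈0 → Dom.x≉0 d (≈-by₂ -1ℤ (1ℤ + + x) (f-spec d) 1+y≈0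
          (solve 2 (λ x y → x :- :0 := con -1ℤ :* ((:1 :+ x) :* y :- con -1ℤ) :+ (:1 :+ x) :* (:1 :+ y :- :0)) refl (+ x) (+ f x)))
      }

    f³ : ∀ {x} → Dom x → f (f (f x)) ≡ x
    f³ {x} d = <∧≈⇒≡ (Dom.x<p dw) (Dom.x<p d) (*-cancel-≈ (1ℤ + Z) (Dom.1+x≉0 dz) (≈-trans (f-spec dz) (≈-sym x-spec)))
      where
      dy = f-dom d
      dz = f-dom dy
      dw = f-dom dz
      X Y Z : ℤ
      X = + x
      Y = + f x
      Z = + f (f x)
      x-spec : (1ℤ + Z) * X ≈ -1ℤ
      x-spec = ≈-by₂ (1ℤ + X) (- Z) (f-spec dy) (f-spec d)
        (solve 3 (λ x y z → (:1 :+ z) :* x :- con -1ℤ :=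
           (:1 :+ x) :* ((:1 :+ y) :* z :- con -1ℤ) :+ (:- z) :* ((:1 :+ x) :* y :- con -1ℤ)) refl X Y Z)

    not-fixed : ∀ {x} → Dom x → f x ≢ x
    not-fixed {x} d fx≡x = no-root x (Dom.x<p d) (≈-by₁ 1ℤ (subst (λ y → (1ℤ + + x) * + y ≈ -1ℤ) fx≡x (f-spec d))
      (solve 1 (λ x → :N (con -1ℤ) (con -1ℤ) (:- x) :1 :- :0 := :1 :* ((:1 :+ x) :* x :- con -1ℤ)) refl (+ x)))

    free : ∀ {x} i → Dom x → 0 ℕ.< i → i ℕ.< 3 → fold x f i ≢ x
    free 1 d _ _ h = not-fixed d h
    free {x} 2 d _ _ h = not-fixed d (trans (cong f (sym h)) (f³ d))
    free (suc (suc (suc _))) d _ (ℕ.s≤s (ℕ.s≤s (ℕ.s≤s ())))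

    3∣p∸2 : 3 ℕ.∣ p ℕ.∸ 2
    3∣p∸2 = subst (3 ℕ.∣_) (length-residues 0) (Orbits.free⇒∣length ℕ._≟_ f 2 record
      { unique = residues-unique 0
      ; closed = λ x∈ → dom⁻ (f-dom (dom x∈))
      ; period = λ x∈ → f³ (dom x∈)
      ; free = λ {_} {i} x∈ → free i (dom x∈)
      })

  module Order4 (2≉0 : ¬ + 2 ≈ 0ℤ) (no-root : ∀ x → x ℕ.< p → ¬ N 0ℤ -1ℤ (- + x) 1ℤ ≈ 0ℤ) where
    -- Removing the cycle `0 ↦ 1 ↦ ∞ ↦ -1 ↦ 0` leaves `p - 3` points of the projective line. The
    -- square of the map is `x ↦ -1/x`, so a point on a short orbit is a square root of -1.
    f : ℕ → ℕ
    f x = quotient (1ℤ + + x) (1ℤ - + x)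

    record Dom (x : ℕ) : Set where
      field
        x<p   : x ℕ.< p
        x≉0   : ¬ + x ≈ 0ℤ
        1-x≉0 : ¬ 1ℤ - + x ≈ 0ℤ
        1+x≉0 : ¬ 1ℤ + + x ≈ 0ℤ

    f-spec : ∀ {x} → Dom x → (1ℤ - + x) * + f x ≈ 1ℤ + + x
    f-spec {x} d = *-quotient (1ℤ + + x) (1ℤ - + x) (Dom.1-x≉0 d)

    dom : ∀ {x} → x ∈ residues 1 → Dom x
    dom {x} x∈ = case ∈-residues⁻ x∈ of λ where
      (1<x , sx<p) → let x<p = ℕ.<-trans (ℕ.n<1+n x) sx<p in record
        { x<p = x<p
        ; x≉0 = 0<⇒≉0 (ℕ.<-trans (ℕ.n<1+n 0) 1<x) x<p
        ; 1-x≉0 = λ h → ℕ.<⇒≢ 1<x (<∧≈⇒≡ (ℕ.<-trans 1<x x<p) x<p (congruent (≈0⇒∣ h)))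
        ; 1+x≉0 = suc<⇒1+≉0 sx<p
        }

    dom⁻ : ∀ {x} → Dom x → x ∈ residues 1
    dom⁻ {x} d = ∈-residues⁺ (ℕ.≤∧≢⇒< (≉0⇒0< (Dom.x≉0 d)) (λ { refl → Dom.1-x≉0 d (≡⇒≈ refl) })) (1+≉0⇒suc< (Dom.x<p d) (Dom.1+x≉0 d))

    f-dom : ∀ {x} → Dom x → Dom (f x)
    f-dom {x} d = record
      { x<p = quotient< (1ℤ + + x) (1ℤ - + x)
      ; x≉0 = λ y≈0 → Dom.1+x≉0 d (≈-by₂ -1ℤ (1ℤ - + x) (f-spec d) y≈0
          (solve 2 (λ x y → :1 :+ x :- :0 := con -1ℤ :* ((:1 :- x) :* y :- (:1 :+ x)) :+ (:1 :- x) :* (y :- :0)) refl (+ x) (+ f x)))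
      ; 1-x≉0 = λ 1-y≈0 → *-≉0 2≉0 (Dom.x≉0 d) (≈-by₂ -1ℤ (- (1ℤ - + x)) (f-spec d) 1-y≈0
          (solve 2 (λ x y → :2 :* x :- :0 := con -1ℤ :* ((:1 :- x) :* y :- (:1 :+ x)) :+ (:- (:1 :- x)) :* (:1 :- y :- :0)) refl (+ x) (+ f x)))
      ; 1+x≉0 = λ 1+y≈0 → 2≉0 (≈-by₂ -1ℤ (1ℤ - + x) (f-spec d) 1+y≈0
          (solve 2 (λ x y → :2 :- :0 := con -1ℤ :* ((:1 :- x) :* y :- (:1 :+ x)) :+ (:1 :- x) :* (:1 :+ y :- :0)) refl (+ x) (+ f x)))
      }

    f²-spec : ∀ {x} → Dom x → + x * + f (f x) ≈ -1ℤ
    f²-spec {x} d = *-cancel-≈ (+ 2) 2≉0 (≈-by₂ (- (1ℤ - + x)) (- (1ℤ + + f (f x))) (f-spec (f-dom d)) (f-spec d)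
      (solve 3 (λ x y z → :2 :* (x :* z) :- :2 :* con -1ℤ :=
        (:- (:1 :- x)) :* ((:1 :- y) :* z :- (:1 :+ y)) :+ (:- (:1 :+ z)) :* ((:1 :- x) :* y :- (:1 :+ x))) refl (+ x) (+ f x) (+ f (f x))))

    f⁴ : ∀ {x} → Dom x → fold x f 4 ≡ x
    f⁴ {x} d = <∧≈⇒≡ (Dom.x<p (f-dom (f-dom dz))) (Dom.x<p d)
      (*-cancel-≈ (+ f (f x)) (Dom.x≉0 dz) (≈-trans (f²-spec dz) (≈-sym (≈-trans (≡⇒≈ (ℤ.*-comm (+ f (f x)) (+ x))) (f²-spec d)))))
      where dz = f-dom (f-dom d)

    not-f²-fixed : ∀ {x} → Dom x → f (f x) ≢ x
    not-f²-fixed {x} d eq = no-root x (Dom.x<p d) (≈-by₁ 1ℤ (subst (λ z → + x * + z ≈ -1ℤ) eq (f²-spec d))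
      (solve 1 (λ x → :N :0 (con -1ℤ) (:- x) :1 :- :0 := :1 :* (x :* x :- con -1ℤ)) refl (+ x)))

    free : ∀ {x} i → Dom x → 0 ℕ.< i → i ℕ.< 4 → fold x f i ≢ x
    free 1 d _ _ h = not-f²-fixed d (trans (cong f h) h)
    free 2 d _ _ h = not-f²-fixed d h
    free 3 d _ _ h = free 1 d (ℕ.s≤s ℕ.z≤n) (ℕ.s≤s (ℕ.s≤s ℕ.z≤n)) (trans (cong f (sym h)) (f⁴ d))
    free (suc (suc (suc (suc _)))) d _ (ℕ.s≤s (ℕ.s≤s (ℕ.s≤s (ℕ.s≤s ()))))

    4∣p∸3 : 4 ℕ.∣ p ℕ.∸ 3
    4∣p∸3 = subst (4 ℕ.∣_) (length-residues 1) (Orbits.free⇒∣length ℕ._≟_ f 3 record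
      { unique = residues-unique 1
      ; closed = λ x∈ → dom⁻ (f-dom (dom x∈))
      ; period = λ x∈ → f⁴ (dom x∈)
      ; free = λ {_} {i} x∈ → free i (dom x∈)
      })

  -- Gauss's pentagramma mirificum: the recurrence a c = 1 + b has period five. Its fixed points are
  -- the roots of x² = x + 1, and it acts on a set of (p - 2)(p - 3) pairs.
  module Order5 (no-root : ∀ x → x ℕ.< p → ¬ N 1ℤ 1ℤ (- + x) 1ℤ ≈ 0ℤ) where
    f : ℕ × ℕ → ℕ × ℕ
    f (x , y) = y , quotient (1ℤ + + y) (+ x)

    -- The largest domain on which no division fails. For the next term `z = (1 + y)/x` one has
    -- `1 + z = (1 + x + y)/x` and `1 + y + z = (1 + x)(1 + y)/x`, so the conditions reproduce
    -- themselves.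
    record Dom (v : ℕ × ℕ) : Set where
      x = proj₁ v
      y = proj₂ v
      field
        x<p     : x ℕ.< p
        y<p     : y ℕ.< p
        x≉0     : ¬ + x ≈ 0ℤ
        y≉0     : ¬ + y ≈ 0ℤ
        1+x≉0   : ¬ 1ℤ + + x ≈ 0ℤ
        1+y≉0   : ¬ 1ℤ + + y ≈ 0ℤ
        1+x+y≉0 : ¬ 1ℤ + + x + + y ≈ 0ℤ

    f-spec : ∀ {v} → Dom v → + proj₁ v * + proj₂ (f v) ≈ 1ℤ + + proj₂ v
    f-spec {x , y} d = *-quotient (1ℤ + + y) (+ x) (Dom.x≉0 d)

    f-dom : ∀ {v} → Dom v → Dom (f v)
    f-dom {x , y} d = record
      { x<p = D.y<p
      ; y<p = quotient< (1ℤ + + y) (+ x)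
      ; x≉0 = D.y≉0
      ; y≉0 = λ z≈0 → D.1+y≉0 (≈-by₂ -1ℤ (+ x) (f-spec d) z≈0
          (solve 3 (λ x y z → :1 :+ y :- :0 := con -1ℤ :* (x :* z :- (:1 :+ y)) :+ x :* (z :- :0)) refl (+ x) (+ y) Z))
      ; 1+x≉0 = D.1+y≉0
      ; 1+y≉0 = λ 1+z≈0 → D.1+x+y≉0 (≈-by₂ -1ℤ (+ x) (f-spec d) 1+z≈0
          (solve 3 (λ x y z → :1 :+ x :+ y :- :0 := con -1ℤ :* (x :* z :- (:1 :+ y)) :+ x :* (:1 :+ z :- :0)) refl (+ x) (+ y) Z))
      ; 1+x+y≉0 = λ h → *-≉0 D.1+x≉0 D.1+y≉0 (≈-by₂ -1ℤ (+ x) (f-spec d) h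
          (solve 3 (λ x y z → (:1 :+ x) :* (:1 :+ y) :- :0 := con -1ℤ :* (x :* z :- (:1 :+ y)) :+ x :* (:1 :+ y :+ z :- :0)) refl (+ x) (+ y) Z))
      }
      where
      module D = Dom d
      Z = + proj₂ (f (x , y))

    -- With denominators cleared, `c (1 + c) (g - a)` is a combination of the four recurrence
    -- relations, and `c (1 + c)` may be cancelled modulo `p`.
    pentagon : ∀ a b c d e g → ¬ c ≈ 0ℤ → ¬ 1ℤ + c ≈ 0ℤ →
               a * c ≈ 1ℤ + b → b * d ≈ 1ℤ + c → c * e ≈ 1ℤ + d → d * g ≈ 1ℤ + e → g ≈ a
    pentagon a b c d e g c≉0 1+c≉0 h₁ h₂ h₃ h₄ = *-cancel-≈ (c * (1ℤ + c)) (*-≉0 c≉0 1+c≉0)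
      (≈-by₄ (- (1ℤ + c)) (1ℤ - c * g) b (c * b) h₁ h₂ h₃ h₄
        (solve 6 (λ a b c d e g → c :* (:1 :+ c) :* g :- c :* (:1 :+ c) :* a :=
          (:- (:1 :+ c)) :* (a :* c :- (:1 :+ b)) :+ (:1 :- c :* g) :* (b :* d :- (:1 :+ c))
          :+ b :* (c :* e :- (:1 :+ d)) :+ c :* b :* (d :* g :- (:1 :+ e))) refl a b c d e g))

    f⁵ : ∀ {v} → Dom v → fold v f 5 ≡ v
    f⁵ {v} d₀ = cong₂ _,_
      (<∧≈⇒≡ (Dom.x<p d₅) (Dom.x<p d₀) (pentagon (X 0) (X 1) (X 2) (X 3) (X 4) (X 5) (Dom.x≉0 d₂) (Dom.1+x≉0 d₂) (f-spec d₀) (f-spec d₁) (f-spec d₂) (f-spec d₃)))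
      (<∧≈⇒≡ (Dom.y<p d₅) (Dom.y<p d₀) (pentagon (X 1) (X 2) (X 3) (X 4) (X 5) (X 6) (Dom.x≉0 d₃) (Dom.1+x≉0 d₃) (f-spec d₁) (f-spec d₂) (f-spec d₃) (f-spec d₄)))
      where
      X : ℕ → ℤ
      X i = + proj₁ (fold v f i)
      d₁ = f-dom d₀
      d₂ = f-dom d₁
      d₃ = f-dom d₂
      d₄ = f-dom d₃
      d₅ = f-dom d₄

    not-fixed : ∀ {v} → Dom v → f v ≢ v
    not-fixed {x , y} d fv≡v = no-root x (Dom.x<p d) (root y≡x z≡y (f-spec d))
      where
      y≡x : y ≡ x
      y≡x = cong proj₁ fv≡v
      z≡y : proj₂ (f (x , y)) ≡ y
      z≡y = cong proj₂ fv≡v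
      root : ∀ {y z} → y ≡ x → z ≡ y → + x * + z ≈ 1ℤ + + y → N 1ℤ 1ℤ (- + x) 1ℤ ≈ 0ℤ
      root refl refl h = ≈-by₁ 1ℤ h
        (solve 1 (λ x → :N :1 :1 (:- x) :1 :- :0 := :1 :* (x :* x :- (:1 :+ x))) refl (+ x))

    free : ∀ {v} i → Dom v → 0 ℕ.< i → i ℕ.< 5 → fold v f i ≢ v
    free     1 d _ _ h = not-fixed d h
    -- As `6 = 2 · 3 = 5 + 1`, a pair fixed by the second or third iterate is fixed by the sixth,
    -- which is `f` itself.
    free {v} 2 d _ _ h = not-fixed d (trans (cong f (sym (f⁵ d))) (power-fixed f 2 3 v h))
    free {v} 3 d _ _ h = not-fixed d (trans (cong f (sym (f⁵ d))) (power-fixed f 3 2 v h))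
    free     4 d _ _ h = not-fixed d (trans (cong f (sym h)) (f⁵ d))
    free (suc (suc (suc (suc (suc _))))) d _ (ℕ.s≤s (ℕ.s≤s (ℕ.s≤s (ℕ.s≤s (ℕ.s≤s ())))))

    off-line? : ∀ v → Dec (¬ 1ℤ + + proj₁ v + + proj₂ v ≈ 0ℤ)
    off-line? v = ¬? (1ℤ + + proj₁ v + + proj₂ v ≈? 0ℤ)

    square : List (ℕ × ℕ)
    square = cartesianProduct (residues 0) (residues 0)

    points : List (ℕ × ℕ)
    points = filter off-line? square

    -- `p ∸ suc x` represents `-1 - x`, so these are the `p - 2` pairs of the square at which
    -- `1 + x + y` vanishes.
    line : List (ℕ × ℕ)
    line = map (λ x → x , p ℕ.∸ suc x) (residues 0)

    square-unique : Unique square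
    square-unique = Unique.cartesianProduct⁺ (residues-unique 0) (residues-unique 0)

    dom : ∀ {v} → v ∈ points → Dom v
    dom {x , y} v∈ with ∈-filter⁻ off-line? {xs = square} v∈
    ... | v∈□ , off with ∈-cartesianProduct⁻ (residues 0) (residues 0) v∈□
    ... | x∈ , y∈ with ∈-residues⁻ x∈ | ∈-residues⁻ y∈
    ... | 0<x , sx<p | 0<y , sy<p = record
      { x<p = ℕ.<-trans (ℕ.n<1+n x) sx<p ; y<p = ℕ.<-trans (ℕ.n<1+n y) sy<p
      ; x≉0 = 0<⇒≉0 0<x (ℕ.<-trans (ℕ.n<1+n x) sx<p) ; y≉0 = 0<⇒≉0 0<y (ℕ.<-trans (ℕ.n<1+n y) sy<p)
      ; 1+x≉0 = suc<⇒1+≉0 sx<p ; 1+y≉0 = suc<⇒1+≉0 sy<p ; 1+x+y≉0 = off }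

    dom⁻ : ∀ {v} → Dom v → v ∈ points
    dom⁻ {x , y} d = ∈-filter⁺ off-line? (∈-cartesianProduct⁺
      (∈-residues⁺ (≉0⇒0< (Dom.x≉0 d)) (1+≉0⇒suc< (Dom.x<p d) (Dom.1+x≉0 d)))
      (∈-residues⁺ (≉0⇒0< (Dom.y≉0 d)) (1+≉0⇒suc< (Dom.y<p d) (Dom.1+y≉0 d)))) (Dom.1+x+y≉0 d)

    5∣points : 5 ℕ.∣ length points
    5∣points = Orbits.free⇒∣length (≡-dec ℕ._≟_ ℕ._≟_) f 4 record
      { unique = Unique.filter⁺ off-line? square-unique
      ; closed = λ x∈ → dom⁻ (f-dom (dom x∈))
      ; period = λ x∈ → f⁵ (dom x∈)
      ; free = λ {_} {i} x∈ → free i (dom x∈)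
      }

    opposite : ∀ {x} → suc x ℕ.≤ p → 1ℤ + + x + + (p ℕ.∸ suc x) ≈ 0ℤ
    opposite {x} sx≤p = ∣⇒≈0 (subst (+ p ∣ᶻ_) (cong +_ (sym (ℕ.m+[n∸m]≡n sx≤p))) Signed.∣-refl)

    ∈-line⁻ : ∀ {v} → v ∈ line → v ∈ square × 1ℤ + + proj₁ v + + proj₂ v ≈ 0ℤ
    ∈-line⁻ v∈ with ∈-map⁻ (λ x → x , p ℕ.∸ suc x) v∈
    ... | x , x∈ , refl with ∈-residues⁻ x∈
    ... | 0<x , sx<p = ∈-cartesianProduct⁺ x∈ (∈-residues⁺ (ℕ.m<n⇒0<n∸m sx<p)
          (subst (ℕ._< p) (ℕ.+-∸-assoc 1 (ℕ.<⇒≤ sx<p)) (ℕ.∸-monoʳ-< 0<x (ℕ.<⇒≤ (ℕ.<-trans (ℕ.n<1+n x) sx<p))))) ,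
        opposite (ℕ.<⇒≤ sx<p)

    ∈-line⁺ : ∀ {v} → v ∈ square → 1ℤ + + proj₁ v + + proj₂ v ≈ 0ℤ → v ∈ line
    ∈-line⁺ {x , y} v∈ h with ∈-cartesianProduct⁻ (residues 0) (residues 0) v∈
    ... | x∈ , y∈ with ∈-residues⁻ x∈ | ∈-residues⁻ y∈
    ... | 0<x , sx<p | 0<y , sy<p = subst (λ z → (x , z) ∈ line) (sym y≡) (∈-map⁺ (λ x → x , p ℕ.∸ suc x) x∈)
      where
      y≡ : y ≡ p ℕ.∸ suc x
      y≡ = <∧≈⇒≡ (ℕ.<-trans (ℕ.n<1+n y) sy<p) (ℕ.∸-monoʳ-< {o = 0} (ℕ.s≤s ℕ.z≤n) (ℕ.<⇒≤ sx<p))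
        (≈-by₂ 1ℤ -1ℤ h (opposite (ℕ.<⇒≤ sx<p)) (solve 3 (λ x y z → y :- z := :1 :* (:1 :+ x :+ y :- :0) :+ con -1ℤ :* (:1 :+ x :+ z :- :0)) refl (+ x) (+ y) (+ (p ℕ.∸ suc x))))

    count : (p ℕ.∸ 2) ℕ.+ length points ≡ (p ℕ.∸ 2) ℕ.* (p ℕ.∸ 2)
    count = begin
      p ℕ.∸ 2 ℕ.+ length points                     ≡⟨ cong (ℕ._+ length points) (trans (length-map _ (residues 0)) (length-residues 0)) ⟨
      length line ℕ.+ length points                 ≡⟨ length-split (Unique.map⁺ (cong proj₁) (residues-unique 0)) (Unique.filter⁺ off-line? square-unique)
                                                         (λ where (v∈l , v∈p) → proj₂ (∈-filter⁻ off-line? {xs = square} v∈p) (proj₂ (∈-line⁻ v∈l)))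
                                                         square-unique
                                                         (λ where
                                                           (inj₁ v∈) → proj₁ (∈-line⁻ v∈)
                                                           (inj₂ v∈) → proj₁ (∈-filter⁻ off-line? v∈))
                                                         (λ {v} v∈ → case 1ℤ + + proj₁ v + + proj₂ v ≈? 0ℤ of λ where
                                                           (yes h) → inj₁ (∈-line⁺ v∈ h)
                                                           (no h)  → inj₂ (∈-filter⁺ off-line? v∈ h)) ⟩
      length square                                 ≡⟨ length-cartesianProduct (residues 0) (residues 0) ⟩
      length (residues 0) ℕ.* length (residues 0)   ≡⟨ cong₂ ℕ._*_ (length-residues 0) (length-residues 0) ⟩
      (p ℕ.∸ 2) ℕ.* (p ℕ.∸ 2)                       ∎
      where
      open ≡-Reasoning
      length-cartesianProduct : ∀ {A B : Set} (xs : List A) (ys : List B) → length (cartesianProduct xs ys) ≡ length xs ℕ.* length ys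
      length-cartesianProduct []       ys = refl
      length-cartesianProduct (x ∷ xs) ys = trans (length-++ (map (x ,_) ys)) (cong₂ ℕ._+_ (length-map (x ,_) ys) (length-cartesianProduct xs ys))

-- Even powers of inert primes

prime-divisor : ∀ c .{{_ : ℕ.NonZero c}} → c ≡ 1 ⊎ ∃[ p ] ∃[ c₁ ] Prime p × c ≡ c₁ ℕ.* p
prime-divisor c = go (PrimeFactorisation.factors f) (PrimeFactorisation.isFactorisation f) (PrimeFactorisation.factorsPrime f)
  where
  f = factorise c
  go : ∀ ps → c ≡ product ps → All Prime ps → c ≡ 1 ⊎ ∃[ p ] ∃[ c₁ ] Prime p × c ≡ c₁ ℕ.* p
  go []       e _        = inj₁ e
  go (p ∷ ps) e (pr ∷ _) = inj₂ (p , product ps , pr , trans e (ℕ.*-comm p (product ps)))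

power-∣-cancel : ∀ {q p} → Prime q → ¬ q ℕ.∣ p → ∀ j c → q ℕ.^ j ℕ.∣ c ℕ.* p → q ℕ.^ j ℕ.∣ c
power-∣-cancel q-prime q∤p zero    c d = ℕ.1∣ c
power-∣-cancel {q} {p} q-prime q∤p (suc j) c d =
  case euclidsLemma c p q-prime (ℕ.∣-trans (ℕ.m∣m*n (q ℕ.^ j)) d) of λ where
      (inj₂ q∣p) → contradiction q∣p q∤p
      (inj₁ (ℕ.divides c₁ refl)) → subst (q ℕ.^ suc j ℕ.∣_) (ℕ.*-comm q c₁) (ℕ.*-monoʳ-∣ q
        (power-∣-cancel q-prime q∤p j c₁ (ℕ.*-cancelˡ-∣ q {{prime⇒nonZero q-prime}} (subst (q ℕ.^ suc j ℕ.∣_) (rearrange c₁) d))))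
  where
  rearrange : ∀ c₁ → c₁ ℕ.* q ℕ.* p ≡ q ℕ.* (c₁ ℕ.* p)
  rearrange c₁ = NS.solve 3 (λ a b c → a NS.:* b NS.:* c NS.:= b NS.:* (a NS.:* c)) refl c₁ q p

even-cancel-≢ : ∀ {q p} → Prime q → Prime p → q ≢ p → ∀ c → EvenPower q (c ℕ.* p) → EvenPower q c
even-cancel-≢ {q} {p} q-prime p-prime q≢p c even k d d′ =
  even k (ℕ.∣-trans d (ℕ.m∣m*n p)) (λ e → d′ (power-∣-cancel q-prime q∤p (suc k) c e))
  where
  q∤p : ¬ q ℕ.∣ p
  q∤p q∣p = case prime⇒irreducible p-prime q∣p of λ where
    (inj₁ q≡1) → ℕ.nonTrivial⇒≢1 {{prime⇒nonTrivial q-prime}} q≡1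
    (inj₂ q≡p) → q≢p q≡p

even-cancel-p² : ∀ {p} .{{_ : ℕ.NonZero p}} c → EvenPower p (c ℕ.* p ℕ.* p) → EvenPower p c
even-cancel-p² {p} c even k d d′ = halve (even (suc (suc k)) (to k d) (λ e → d′ (from (suc k) e)))
  where
  shift : ∀ k → p ℕ.^ suc (suc k) ≡ p ℕ.^ k ℕ.* p ℕ.* p
  shift k = NS.solve 2 (λ p q → p NS.:* (p NS.:* q) NS.:= q NS.:* p NS.:* p) refl p (p ℕ.^ k)
  to : ∀ k → p ℕ.^ k ℕ.∣ c → p ℕ.^ suc (suc k) ℕ.∣ c ℕ.* p ℕ.* p
  to k d = subst (ℕ._∣ c ℕ.* p ℕ.* p) (sym (shift k)) (ℕ.*-monoˡ-∣ p (ℕ.*-monoˡ-∣ p d))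
  from : ∀ k → p ℕ.^ suc (suc k) ℕ.∣ c ℕ.* p ℕ.* p → p ℕ.^ k ℕ.∣ c
  from k d = ℕ.*-cancelʳ-∣ p (ℕ.*-cancelʳ-∣ p (subst (ℕ._∣ c ℕ.* p ℕ.* p) (shift k) d))
  halve : ∃[ j ] suc (suc k) ≡ 2 ℕ.* j → ∃[ j ] k ≡ 2 ℕ.* j
  halve (suc j , e) = j , ℕ.suc-injective (ℕ.suc-injective (trans e (cong suc (ℕ.+-suc j (j ℕ.+ 0)))))

even⇒p² : ∀ {p} c → p ℕ.∣ c → EvenPower p c → p ℕ.^ 2 ℕ.∣ c
even⇒p² {p} c p∣c even = case p ℕ.^ 2 ℕ.∣? c of λ where
    (yes d) → d
    (no ¬d) → ⊥-elim (odd (even 1 (subst (ℕ._∣ c) (sym (ℕ.*-identityʳ p)) p∣c) ¬d))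
  where
  odd : ¬ (∃[ j ] 1 ≡ 2 ℕ.* j)
  odd (suc j , e) = case trans (ℕ.suc-injective e) (ℕ.+-suc j (j ℕ.+ 0)) of λ ()

-- Peeling off one prime outside `I`, or the square of one inside, preserves the parity condition on
-- the rest. The induction serves the representations by norms, the multipliers of A₄ and, with `I`
-- empty, the sums of four squares.
module Generate {I : ℕ → Set} (I? : ∀ p → Dec (I p)) (P : ℕ → Set) (P1 : P 1)
                (P-inert : ∀ p c → Prime p → I p → P c → P (c ℕ.* p ℕ.* p))
                (P-split : ∀ p c → Prime p → ¬ I p → P c → P (c ℕ.* p)) where
  private
    generate-acc : ∀ c .{{_ : ℕ.NonZero c}} → PrimesEvenPower I c → Acc ℕ._<_ c → P c
    generate-acc c even (acc rec) = case prime-divisor c of λ where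
        (inj₁ c≡1)                      → subst P (sym c≡1) P1
        (inj₂ (p , c₁ , p-prime , c≡)) → step p c₁ p-prime c≡ (I? p)
      where
      step : ∀ p c₁ → Prime p → c ≡ c₁ ℕ.* p → Dec (I p) → P c
      step p c₁ p-prime c≡ (no ¬Ip) = subst P (sym c≡) (P-split p c₁ p-prime ¬Ip (generate-acc c₁ even₁ (rec c₁<c)))
        where
        instance
          c₁-nonZero : ℕ.NonZero c₁
          c₁-nonZero = ℕ.m*n≢0⇒m≢0 c₁ {{subst ℕ.NonZero c≡ (ℕ.≢-nonZero (ℕ.≢-nonZero⁻¹ c))}}
          p-nonTrivial = prime⇒nonTrivial p-prime
        c₁<c : c₁ ℕ.< c
        c₁<c = subst (c₁ ℕ.<_) (sym c≡) (ℕ.m<m*n c₁ p (ℕ.nonTrivial⇒n>1 p))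
        even₁ : PrimesEvenPower I c₁
        even₁ q q-prime Iq = even-cancel-≢ q-prime p-prime (λ { refl → ¬Ip Iq }) c₁ (subst (EvenPower q) c≡ (even q q-prime Iq))
      step p c₁ p-prime c≡ (yes Ip) = inert (even⇒p² c (ℕ.divides c₁ c≡) (even p p-prime Ip))
        where
        instance
          p-nonTrivial = prime⇒nonTrivial p-prime
          p-nonZero = prime⇒nonZero p-prime
        inert : p ℕ.^ 2 ℕ.∣ c → P c
        inert (ℕ.divides c₂ c≡′) = subst P (sym c≡c₂p²) (P-inert p c₂ p-prime Ip (generate-acc c₂ even₂ (rec c₂<c)))
          where
          c≡c₂p² : c ≡ c₂ ℕ.* p ℕ.* p
          c≡c₂p² = trans c≡′ (trans (cong (c₂ ℕ.*_) (cong (p ℕ.*_) (ℕ.*-identityʳ p))) (sym (ℕ.*-assoc c₂ p p)))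
          instance
            c₂-nonZero : ℕ.NonZero c₂
            c₂-nonZero = ℕ.m*n≢0⇒m≢0 c₂ {{subst ℕ.NonZero c≡′ (ℕ.≢-nonZero (ℕ.≢-nonZero⁻¹ c))}}
          c₂<c : c₂ ℕ.< c
          c₂<c = subst (c₂ ℕ.<_) (sym c≡c₂p²) (ℕ.<-≤-trans (ℕ.m<m*n c₂ p (ℕ.nonTrivial⇒n>1 p)) (ℕ.m≤m*n (c₂ ℕ.* p) p))
          even₂ : PrimesEvenPower I c₂
          even₂ q q-prime Iq = case q ℕ.≟ p of λ where
              (yes refl) → even-cancel-p² c₂ even-c
              (no q≢p)   → even-cancel-≢ q-prime p-prime q≢p c₂ (even-cancel-≢ q-prime p-prime q≢p (c₂ ℕ.* p) even-c)
            where
            even-c : EvenPower q (c₂ ℕ.* p ℕ.* p)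
            even-c = subst (EvenPower q) c≡c₂p² (even q q-prime Iq)

  generate : ∀ c .{{_ : ℕ.NonZero c}} → PrimesEvenPower I c → P c
  generate c even = generate-acc c even (<-wellFounded c)

-- Values of the three norm forms

Rep : ℤ → ℤ → ℕ → Set
Rep u v n = ∃[ r ] ∃[ s ] N u v r s ≡ + n

rep-1 : ∀ u v → Rep u v 1
rep-1 u v = 1ℤ , 0ℤ , solve 2 (λ u v → :N u v :1 :0 := :1) refl u v

N-* : ∀ u v r s r′ s′ → N u v r s * N u v r′ s′ ≡ N u v (r * r′ + v * s * s′) (r * s′ + s * r′ + u * s * s′)
N-* = solve 6 (λ u v r s r′ s′ → :N u v r s :* :N u v r′ s′ := :N u v (r :* r′ :+ v :* s :* s′) (r :* s′ :+ s :* r′ :+ u :* s :* s′)) refl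

rep-* : ∀ u v {m n} → Rep u v m → Rep u v n → Rep u v (m ℕ.* n)
rep-* u v {m} {n} (r , s , h) (r′ , s′ , h′) = r * r′ + v * s * s′ , r * s′ + s * r′ + u * s * s′ ,
  trans (sym (N-* u v r s r′ s′)) (trans (cong₂ _*_ h h′) (sym (ℤ.pos-* m n)))

rep-*p² : ∀ u v {n} p → Rep u v n → Rep u v (n ℕ.* p ℕ.* p)
rep-*p² u v {n} p (r , s , h) = r * + p , s * + p ,
  trans (solve 5 (λ u v r s p → :N u v (r :* p) (s :* p) := :N u v r s :* p :* p) refl u v r s (+ p))
    (trans (cong (λ z → z * + p * + p) h) (trans (cong (_* + p) (sym (ℤ.pos-* n p))) (sym (ℤ.pos-* (n ℕ.* p) p))))

module ModCheck (n : ℕ) .{{_ : ℕ.NonZero n}} where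
  open Mod n

  N-cong : ∀ u v {r r′ s s′} → r ≈ r′ → s ≈ s′ → N u v r s ≈ N u v r′ s′
  N-cong u v {r} {r′} {s} {s′} h h′ = ≈-by₂ (r + r′ + u * s) (u * r′ - v * (s + s′)) h h′
    (solve 6 (λ u v r r′ s s′ → :N u v r s :- :N u v r′ s′ := (r :+ r′ :+ u :* s) :* (r :- r′) :+ (u :* r′ :- v :* (s :+ s′)) :* (s :- s′)) refl u v r r′ s s′)

  residue : ∀ a → ∃[ i ] + toℕ {n} i ≈ a
  residue a = fromℕ< (ℤ.n%ℕd<d a n) , subst (λ z → + z ≈ a) (sym (toℕ-fromℕ< (ℤ.n%ℕd<d a n))) (%ℕ-≈ a)

  -- The norm modulo `n` depends only on the residues of `r` and `s`; the implicit argument is the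
  -- table of all residues, checked by evaluation.
  N≉ : ∀ u v k {_ : True (all? λ (i : Fin n) → all? λ (j : Fin n) → ¬? (N u v (+ toℕ i) (+ toℕ j) ≈? k))} → ∀ r s → ¬ N u v r s ≈ k
  N≉ u v k {ok} r s h = toWitness ok (proj₁ (residue r)) (proj₁ (residue s))
    (≈-trans (N-cong u v (proj₂ (residue r)) (proj₂ (residue s))) h)

  N[t,1]≉ : ∀ u v k {_ : True (all? λ (i : Fin n) → ¬? (N u v (+ toℕ i) 1ℤ ≈? k))} → ∀ t → ¬ N u v t 1ℤ ≈ k
  N[t,1]≉ u v k {ok} t h = toWitness ok (proj₁ (residue t)) (≈-trans (N-cong u v (proj₂ (residue t)) (≡⇒≈ refl)) h)

  %⇒≈ : ∀ m {r} → m ℕ.% n ≡ r → + m ≈ + r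
  %⇒≈ m refl = congruent (divides (+ (m ℕ./ n)) (by₁ 1ℤ (trans (cong +_ (ℕ.m≡m%n+[m/n]*n m n)) (cong (λ z → + (m ℕ.% n) + z) (ℤ.pos-* (m ℕ./ n) n)))
    (solve 4 (λ m r q n → m :- r :- q :* n := :1 :* (m :- (r :+ q :* n))) refl (+ m) (+ (m ℕ.% n)) (+ (m ℕ./ n)) (+ n))))

-- `t² + 1` has no zero modulo 3; for the other two rings, `t² - t + 1` and `t² + t - 1` are always
-- odd.
small-i : Small 0ℤ -1ℤ
small-i = record { ∣u∣≤1 = ℕ.z≤n ; ∣v∣≤1 = ℕ.≤-refl ; N≢0 = λ t h → ModCheck.N[t,1]≉ 3 0ℤ -1ℤ 0ℤ t (Mod.≡⇒≈ 3 h) }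

small-ω : Small -1ℤ -1ℤ
small-ω = record { ∣u∣≤1 = ℕ.≤-refl ; ∣v∣≤1 = ℕ.≤-refl ; N≢0 = λ t h → ModCheck.N[t,1]≉ 2 -1ℤ -1ℤ 0ℤ t (Mod.≡⇒≈ 2 h) }

small-φ : Small 1ℤ 1ℤ
small-φ = record { ∣u∣≤1 = ℕ.≤-refl ; ∣v∣≤1 = ℕ.≤-refl ; N≢0 = λ t h → ModCheck.N[t,1]≉ 2 1ℤ 1ℤ 0ℤ t (Mod.≡⇒≈ 2 h) }

0≤square : ∀ x → 0ℤ ℤ.≤ x * x
0≤square (+ n)    = subst (0ℤ ℤ.≤_) (ℤ.pos-* n n) (ℤ.+≤+ ℕ.z≤n)
0≤square -[1+ n ] = ℤ.+≤+ ℕ.z≤n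

0≤N-i : ∀ r s → 0ℤ ℤ.≤ N 0ℤ -1ℤ r s
0≤N-i r s = subst (0ℤ ℤ.≤_) (solve 2 (λ r s → r :* r :+ s :* s := :N :0 (con -1ℤ) r s) refl r s)
  (ℤ.+-mono-≤ (0≤square r) (0≤square s))

0≤N-ω : ∀ r s → 0ℤ ℤ.≤ N -1ℤ -1ℤ r s
0≤N-ω r s = ℤ.*-cancelˡ-≤-pos 0ℤ (N -1ℤ -1ℤ r s) (+ 4) (subst (0ℤ ℤ.≤_)
  (solve 2 (λ r s → (:2 :* r :- s) :* (:2 :* r :- s) :+ (s :* s :+ s :* s :+ s :* s) := :4 :* :N (con -1ℤ) (con -1ℤ) r s) refl r s)
  (ℤ.+-mono-≤ (0≤square (+ 2 * r - s)) (ℤ.+-mono-≤ (ℤ.+-mono-≤ (0≤square s) (0≤square s)) (0≤square s))))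

unit-cases : ∀ e → e * e ≡ 1ℤ → e ≡ 1ℤ ⊎ e ≡ -1ℤ
unit-cases (+ 1)    _ = inj₁ refl
unit-cases -[1+ 0 ] _ = inj₂ refl
unit-cases (+ suc (suc n)) h = contradiction (ℤ.+-injective (trans (ℤ.pos-* (suc (suc n)) (suc (suc n))) h)) λ ()
unit-cases -[1+ suc n ] h = contradiction (ℤ.+-injective h) λ ()

definite-sign : ∀ {n p} .{{_ : ℕ.NonZero p}} e → e * e ≡ 1ℤ → 0ℤ ℤ.≤ n → n ≡ e * + p → n ≡ + p
definite-sign {p = suc _} e h 0≤n n≡ = case unit-cases e h of λ where
  (inj₁ refl) → trans n≡ (ℤ.*-identityˡ _)
  (inj₂ refl) → case subst (0ℤ ℤ.≤_) n≡ 0≤n of λ ()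

not-norm-i : ∀ p → Is3mod4 p → ∀ r s e → e * e ≡ 1ℤ → N 0ℤ -1ℤ r s ≢ e * + p
not-norm-i zero ()
not-norm-i p@(suc _) h r s e e² eq = ModCheck.N≉ 4 0ℤ -1ℤ (+ 3) r s
  (Mod.≈-trans 4 (Mod.≡⇒≈ 4 (definite-sign e e² (0≤N-i r s) eq)) (ModCheck.%⇒≈ 4 p h))

not-norm-ω : ∀ p → Is2mod3 p → ∀ r s e → e * e ≡ 1ℤ → N -1ℤ -1ℤ r s ≢ e * + p
not-norm-ω zero ()
not-norm-ω p@(suc _) h r s e e² eq = ModCheck.N≉ 3 -1ℤ -1ℤ (+ 2) r s
  (Mod.≈-trans 3 (Mod.≡⇒≈ 3 (definite-sign e e² (0≤N-ω r s) eq)) (ModCheck.%⇒≈ 3 p h))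

-- The form is indefinite, so positivity cannot settle the sign `e`. But four times the norm is
-- `(2 r + s)² - 5 s²`, so norms are 0 or ±1 modulo 5, and this set is stable under negation.
not-norm-φ : ∀ p → Is±2mod5 p → ∀ r s e → e * e ≡ 1ℤ → N 1ℤ 1ℤ r s ≢ e * + p
not-norm-φ p h r s e e² eq = case h of λ where
    (inj₁ h₂) → not±2 e (+ 2) (unit-cases e e²) (inj₁ refl) (ModCheck.%⇒≈ 5 p h₂) eq
    (inj₂ h₃) → not±2 e (+ 3) (unit-cases e e²) (inj₂ refl) (ModCheck.%⇒≈ 5 p h₃) eq
  where
  open Mod 5
  not±2 : ∀ e k → e ≡ 1ℤ ⊎ e ≡ -1ℤ → k ≡ + 2 ⊎ k ≡ + 3 → + p ≈ k → N 1ℤ 1ℤ r s ≢ e * + p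
  not±2 e k he hk p≈k n≡ = go he hk (≈-trans (≡⇒≈ n≡) (≈-by₁ e p≈k (solve 3 (λ e p k → e :* p :- e :* k := e :* (p :- k)) refl e (+ p) k)))
    where
    go : e ≡ 1ℤ ⊎ e ≡ -1ℤ → k ≡ + 2 ⊎ k ≡ + 3 → ¬ N 1ℤ 1ℤ r s ≈ e * k
    go (inj₁ refl) (inj₁ refl) = ModCheck.N≉ 5 1ℤ 1ℤ (+ 2) r s
    go (inj₁ refl) (inj₂ refl) = ModCheck.N≉ 5 1ℤ 1ℤ (+ 3) r s
    go (inj₂ refl) (inj₁ refl) = ModCheck.N≉ 5 1ℤ 1ℤ -[1+ 1 ] r s
    go (inj₂ refl) (inj₂ refl) = ModCheck.N≉ 5 1ℤ 1ℤ -[1+ 2 ] r s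

-- The square factor m² lets this be applied to rational representations of c.
norm⇒even-i : ∀ c m .{{_ : ℕ.NonZero c}} .{{_ : ℕ.NonZero m}} r s → N 0ℤ -1ℤ r s ≡ + c * + m * + m → PrimesEvenPower Is3mod4 c
norm⇒even-i c m r s h p p-prime Ip = Inert.norm⇒even small-i p-prime (not-norm-i p Ip) c m r s h

norm⇒even-ω : ∀ c m .{{_ : ℕ.NonZero c}} .{{_ : ℕ.NonZero m}} r s → N -1ℤ -1ℤ r s ≡ + c * + m * + m → PrimesEvenPower Is2mod3 c
norm⇒even-ω c m r s h p p-prime Ip = Inert.norm⇒even small-ω p-prime (not-norm-ω p Ip) c m r s h

norm⇒even-φ : ∀ c m .{{_ : ℕ.NonZero c}} .{{_ : ℕ.NonZero m}} r s → N 1ℤ 1ℤ r s ≡ + c * + m * + m → PrimesEvenPower Is±2mod5 c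
norm⇒even-φ c m r s h p p-prime Ip = Inert.norm⇒even small-φ p-prime (not-norm-φ p Ip) c m r s h

∣p∸r⇒% : ∀ d .{{_ : ℕ.NonZero d}} p r → r ℕ.≤ p → d ℕ.∣ p ℕ.∸ r → p ℕ.% d ≡ r ℕ.% d
∣p∸r⇒% d p r r≤p (ℕ.divides m e) = trans (cong (ℕ._% d) (trans (sym (ℕ.m+[n∸m]≡n r≤p)) (cong (r ℕ.+_) e))) (ℕ.[m+kn]%n≡m%n r m d)

∣prime⇒≡ : ∀ {p} d .{{_ : ℕ.NonTrivial d}} → Prime p → d ℕ.∣ p → p ≡ d
∣prime⇒≡ d p-prime d∣p = case prime⇒irreducible p-prime d∣p of λ where
  (inj₁ d≡1) → contradiction d≡1 ℕ.nonTrivial⇒≢1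
  (inj₂ d≡p) → sym d≡p

module _ {p : ℕ} (p-prime : Prime p) where
  open Roots p-prime
  open ModPrime p-prime using (_≈_; ≈0⇒∣)

  private
    1<p : 1 ℕ.< p
    1<p = ℕ.nonTrivial⇒n>1 p {{prime⇒nonTrivial p-prime}}

  root-ω : p ℕ.% 3 ≡ 1 → Root -1ℤ -1ℤ
  root-ω h = case root-or-none -1ℤ -1ℤ of λ where
    (inj₁ root) → root
    (inj₂ none) → case trans (sym h) (∣p∸r⇒% 3 p 2 1<p (Order3.3∣p∸2 none)) of λ ()

  root-i : p ℕ.% 4 ≡ 1 → Root 0ℤ -1ℤ
  root-i h = case root-or-none 0ℤ -1ℤ of λ where
      (inj₁ root) → root
      (inj₂ none) → case trans (sym h) (∣p∸r⇒% 4 p 3 2<p (Order4.4∣p∸3 2≉0 none)) of λ ()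
    where
    2<p : 2 ℕ.< p
    2<p = ℕ.≤∧≢⇒< 1<p λ { refl → case h of λ () }
    2≉0 : ¬ + 2 ≈ 0ℤ
    2≉0 = 0<⇒≉0 (ℕ.s≤s ℕ.z≤n) 2<p

  root-φ : p ℕ.% 5 ≡ 1 ⊎ p ℕ.% 5 ≡ 4 → Root 1ℤ 1ℤ
  root-φ h = case root-or-none 1ℤ 1ℤ of λ where
      (inj₁ root) → root
      (inj₂ none) → ⊥-elim (absurd none)
    where
    q = p ℕ.∸ 2
    -- Freeness would give `q + 5 m = q²`, so `q` would be 0 or 1 and `p = q + 2` would be 2 or 3
    -- modulo 5, against `h`.
    q-residue : ∀ r → r ℕ.< 5 → q ℕ.% 5 ≡ r → (r ℕ.* r) ℕ.% 5 ≢ r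
    q-residue r r<5 q≡r = go r r<5 (subst (λ z → z ≡ 1 ⊎ z ≡ 4) (trans p≡ (cong (λ z → (2 ℕ.+ z) ℕ.% 5) q≡r)) h)
      where
      p≡ : p ℕ.% 5 ≡ (2 ℕ.+ q ℕ.% 5) ℕ.% 5
      p≡ = trans (cong (ℕ._% 5) (sym (ℕ.m+[n∸m]≡n 1<p))) (ℕ.%-distribˡ-+ 2 q 5)
      go : ∀ r → r ℕ.< 5 → (2 ℕ.+ r) ℕ.% 5 ≡ 1 ⊎ (2 ℕ.+ r) ℕ.% 5 ≡ 4 → (r ℕ.* r) ℕ.% 5 ≢ r
      go 0 _ (inj₁ ())
      go 0 _ (inj₂ ())
      go 1 _ (inj₁ ())
      go 1 _ (inj₂ ())
      go 2 _ _ ()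
      go 3 _ (inj₁ ())
      go 3 _ (inj₂ ())
      go 4 _ _ ()
      go (suc (suc (suc (suc (suc _))))) (ℕ.s≤s (ℕ.s≤s (ℕ.s≤s (ℕ.s≤s (ℕ.s≤s ())))))
    absurd : (∀ x → x ℕ.< p → ¬ N 1ℤ 1ℤ (- + x) 1ℤ ≈ 0ℤ) → ⊥
    absurd none = case 5∣points of λ where
        (ℕ.divides m e) → q-residue (q ℕ.% 5) (ℕ.m%n<n q 5) refl (begin
          (q ℕ.% 5 ℕ.* (q ℕ.% 5)) ℕ.% 5   ≡⟨ ℕ.%-distribˡ-* q q 5 ⟨
          (q ℕ.* q) ℕ.% 5                 ≡⟨ cong (ℕ._% 5) count ⟨
          (q ℕ.+ _) ℕ.% 5                 ≡⟨ cong (λ z → (q ℕ.+ z) ℕ.% 5) e ⟩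
          (q ℕ.+ m ℕ.* 5) ℕ.% 5           ≡⟨ ℕ.[m+kn]%n≡m%n q m 5 ⟩
          q ℕ.% 5                         ∎)
      where
      open Order5 none
      open ≡-Reasoning

  root⇒norm : ∀ {u v} → Small u v → Root u v → ∃[ r ] ∃[ s ] ∃[ e ] e * e ≡ 1ℤ × N u v r s ≡ e * + p
  root⇒norm {u} {v} small (t , h) = F.r , F.s , F.e , F.unit , F.norm
    where
    p∣N = ≈0⇒∣ h
    instance
      +p-nonZero : ℤ.NonZero (+ p)
      +p-nonZero = ℕ.≢-nonZero (ℕ.≢-nonZero⁻¹ p {{prime⇒nonZero p-prime}})
    module F = Factors (factor small (+ p) t (Signed.quotient p∣N)
      (trans (Signed._∣_.equality p∣N) (ℤ.*-comm (Signed.quotient p∣N) (+ p))))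

  root⇒rep-i : Root 0ℤ -1ℤ → Rep 0ℤ -1ℤ p
  root⇒rep-i root = case root⇒norm small-i root of λ where
    (r , s , e , e² , h) → r , s , definite-sign {{prime⇒nonZero p-prime}} e e² (0≤N-i r s) h

  root⇒rep-ω : Root -1ℤ -1ℤ → Rep -1ℤ -1ℤ p
  root⇒rep-ω root = case root⇒norm small-ω root of λ where
    (r , s , e , e² , h) → r , s , definite-sign {{prime⇒nonZero p-prime}} e e² (0≤N-ω r s) h

  -- A representation of -p is corrected by the unit φ of norm -1.
  root⇒rep-φ : Root 1ℤ 1ℤ → Rep 1ℤ 1ℤ p
  root⇒rep-φ root = case root⇒norm small-φ root of λ where
      (r , s , e , e² , h) → fix r s e (unit-cases e e²) h
    where
    fix : ∀ r s e → e ≡ 1ℤ ⊎ e ≡ -1ℤ → N 1ℤ 1ℤ r s ≡ e * + p → Rep 1ℤ 1ℤ p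
    fix r s _ (inj₁ refl) h = r , s , trans h (ℤ.*-identityˡ (+ p))
    fix r s _ (inj₂ refl) h = s , r + s , by₁ -1ℤ h
      (solve 3 (λ r s p → :N :1 :1 s (r :+ s) :- p := con -1ℤ :* (:N :1 :1 r s :- con -1ℤ :* p)) refl r s (+ p))

  split-i : ¬ Is3mod4 p → p ≡ 2 ⊎ p ℕ.% 4 ≡ 1
  split-i ¬3 = go (p ℕ.% 4) refl (ℕ.m%n<n p 4)
    where
    go : ∀ r → p ℕ.% 4 ≡ r → r ℕ.< 4 → p ≡ 2 ⊎ p ℕ.% 4 ≡ 1
    go 0 h _ = inj₁ (∣prime⇒≡ 2 p-prime (ℕ.∣-trans (ℕ.divides 2 refl) (ℕ.m%n≡0⇒n∣m p 4 h)))
    go 1 h _ = inj₂ h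
    go 2 h _ = inj₁ (∣prime⇒≡ 2 p-prime (ℕ.∣n∣m%n⇒∣m (ℕ.divides 2 refl) (subst (2 ℕ.∣_) (sym h) ℕ.∣-refl)))
    go 3 h _ = contradiction h ¬3
    go (suc (suc (suc (suc _)))) _ (ℕ.s≤s (ℕ.s≤s (ℕ.s≤s (ℕ.s≤s ()))))

  split-ω : ¬ Is2mod3 p → p ≡ 3 ⊎ p ℕ.% 3 ≡ 1
  split-ω ¬2 = go (p ℕ.% 3) refl (ℕ.m%n<n p 3)
    where
    go : ∀ r → p ℕ.% 3 ≡ r → r ℕ.< 3 → p ≡ 3 ⊎ p ℕ.% 3 ≡ 1
    go 0 h _ = inj₁ (∣prime⇒≡ 3 p-prime (ℕ.m%n≡0⇒n∣m p 3 h))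
    go 1 h _ = inj₂ h
    go 2 h _ = contradiction h ¬2
    go (suc (suc (suc _))) _ (ℕ.s≤s (ℕ.s≤s (ℕ.s≤s ())))

  split-φ : ¬ Is±2mod5 p → p ≡ 5 ⊎ (p ℕ.% 5 ≡ 1 ⊎ p ℕ.% 5 ≡ 4)
  split-φ ¬±2 = go (p ℕ.% 5) refl (ℕ.m%n<n p 5)
    where
    go : ∀ r → p ℕ.% 5 ≡ r → r ℕ.< 5 → p ≡ 5 ⊎ (p ℕ.% 5 ≡ 1 ⊎ p ℕ.% 5 ≡ 4)
    go 0 h _ = inj₁ (∣prime⇒≡ 5 p-prime (ℕ.m%n≡0⇒n∣m p 5 h))
    go 1 h _ = inj₂ (inj₁ h)
    go 2 h _ = contradiction (inj₁ h) ¬±2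
    go 3 h _ = contradiction (inj₂ h) ¬±2
    go 4 h _ = inj₂ (inj₂ h)
    go (suc (suc (suc (suc (suc _))))) _ (ℕ.s≤s (ℕ.s≤s (ℕ.s≤s (ℕ.s≤s (ℕ.s≤s ())))))

  rep-i : ¬ Is3mod4 p → Rep 0ℤ -1ℤ p
  rep-i ¬3 = case split-i ¬3 of λ where
    (inj₁ refl) → 1ℤ , 1ℤ , refl
    (inj₂ h)    → root⇒rep-i (root-i h)

  rep-ω : ¬ Is2mod3 p → Rep -1ℤ -1ℤ p
  rep-ω ¬2 = case split-ω ¬2 of λ where
    (inj₁ refl) → 1ℤ , -1ℤ , refl
    (inj₂ h)    → root⇒rep-ω (root-ω h)

  rep-φ : ¬ Is±2mod5 p → Rep 1ℤ 1ℤ p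
  rep-φ ¬±2 = case split-φ ¬±2 of λ where
    (inj₁ refl) → + 2 , 1ℤ , refl
    (inj₂ h)    → root⇒rep-φ (root-φ h)

Is3mod4? : ∀ p → Dec (Is3mod4 p)
Is3mod4? p = p ℕ.% 4 ℕ.≟ 3

Is2mod3? : ∀ p → Dec (Is2mod3 p)
Is2mod3? p = p ℕ.% 3 ℕ.≟ 2

Is±2mod5? : ∀ p → Dec (Is±2mod5 p)
Is±2mod5? p = (p ℕ.% 5 ℕ.≟ 2) ⊎-dec (p ℕ.% 5 ℕ.≟ 3)

even⇒rep-i : ∀ c .{{_ : ℕ.NonZero c}} → PrimesEvenPower Is3mod4 c → Rep 0ℤ -1ℤ c
even⇒rep-i = Generate.generate Is3mod4? (Rep 0ℤ -1ℤ) (rep-1 0ℤ -1ℤ) (λ p c _ _ → rep-*p² 0ℤ -1ℤ p) (λ p c p-prime ¬I rep → rep-* 0ℤ -1ℤ rep (rep-i p-prime ¬I))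

even⇒rep-ω : ∀ c .{{_ : ℕ.NonZero c}} → PrimesEvenPower Is2mod3 c → Rep -1ℤ -1ℤ c
even⇒rep-ω = Generate.generate Is2mod3? (Rep -1ℤ -1ℤ) (rep-1 -1ℤ -1ℤ) (λ p c _ _ → rep-*p² -1ℤ -1ℤ p) (λ p c p-prime ¬I rep → rep-* -1ℤ -1ℤ rep (rep-ω p-prime ¬I))

even⇒rep-φ : ∀ c .{{_ : ℕ.NonZero c}} → PrimesEvenPower Is±2mod5 c → Rep 1ℤ 1ℤ c
even⇒rep-φ = Generate.generate Is±2mod5? (Rep 1ℤ 1ℤ) (rep-1 1ℤ 1ℤ) (λ p c _ _ → rep-*p² 1ℤ 1ℤ p) (λ p c p-prime ¬I rep → rep-* 1ℤ 1ℤ rep (rep-φ p-prime ¬I))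

-- Reduction of quaternary forms

square-abs : ∀ x → + (∣ x ∣ ℕ.* ∣ x ∣) ≡ x * x
square-abs (+ n)    = ℤ.pos-* n n
square-abs -[1+ n ] = refl

0<* : ∀ {x y} → 0ℤ ℤ.< x → 0ℤ ℤ.< y → 0ℤ ℤ.< x * y
0<* {x} {y} 0<x 0<y = subst (ℤ._< x * y) (ℤ.*-zeroʳ x) (ℤ.*-monoˡ-<-pos x {{ℤ.positive 0<x}} 0<y)

-- One step of Gauss reduction of the binary form (A, 2E, C) of determinant Δ.
gauss-step : ∀ A E C Δ → 0ℤ ℤ.< A → A * C - E * E ≡ Δ → 0ℤ ℤ.< Δ →
             ∃[ m ] let C′ = C - m * E - m * (E - m * A) in
               0ℤ ℤ.< C′ × (C′ ℤ.< A ⊎ + 3 * (A * A) ℤ.≤ + 4 * Δ)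
gauss-step A E C Δ 0<A AC-E²≡Δ 0<Δ = m , 0<C′ , (case C′ ℤ.<? A of λ where
    (yes C′<A) → inj₁ C′<A
    (no C′≮A)  → inj₂ (bound (ℤ.≮⇒≥ C′≮A)))
  where
  instance
    A-positive : ℤ.Positive A
    A-positive = ℤ.positive 0<A
    A-nonNegative : ℤ.NonNegative A
    A-nonNegative = ℤ.nonNegative (ℤ.<⇒≤ 0<A)
    A-nonZero : ℤ.NonZero A
    A-nonZero = ℤ.>-nonZero 0<A
  m = proj₁ (round E A)
  E′ = E - m * A
  C′ = C - m * E - m * (E - m * A)
  AC′≡ : A * C′ ≡ Δ + E′ * E′
  AC′≡ = by₁ 1ℤ AC-E²≡Δ (solve 5 (λ A E C Δ m → A :* (C :- m :* E :- m :* (E :- m :* A)) :- (Δ :+ (E :- m :* A) :* (E :- m :* A))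
    := :1 :* (A :* C :- E :* E :- Δ)) refl A E C Δ m)
  0≤E′² : 0ℤ ℤ.≤ E′ * E′
  0≤E′² = subst (0ℤ ℤ.≤_) (square-abs E′) (ℤ.+≤+ ℕ.z≤n)
  0<C′ : 0ℤ ℤ.< C′
  0<C′ = ℤ.*-cancelˡ-<-nonNeg A (subst₂ ℤ._<_ (sym (ℤ.*-zeroʳ A)) (sym AC′≡) (ℤ.+-mono-<-≤ 0<Δ 0≤E′²))
  4E′²≤A² : + 4 * (E′ * E′) ℤ.≤ A * A
  4E′²≤A² = subst₂ ℤ._≤_ eq (square-abs A) (ℤ.+≤+ (ℕ.*-mono-≤ half half))
    where
    half = proj₂ (round E A)
    eq : + (2 ℕ.* ∣ E′ ∣ ℕ.* (2 ℕ.* ∣ E′ ∣)) ≡ + 4 * (E′ * E′)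
    eq = trans (cong +_ (NS.solve 1 (λ x → NS.con 2 NS.:* x NS.:* (NS.con 2 NS.:* x) NS.:= NS.con 4 NS.:* (x NS.:* x)) refl ∣ E′ ∣))
           (trans (ℤ.pos-* 4 (∣ E′ ∣ ℕ.* ∣ E′ ∣)) (cong (+ 4 *_) (square-abs E′)))
  -- From `A ≤ C′` follows `4 A² ≤ 4 A C′ = 4 Δ + 4 E′² ≤ 4 Δ + A²`.
  bound : A ℤ.≤ C′ → + 3 * (A * A) ℤ.≤ + 4 * Δ
  bound A≤C′ = subst₂ ℤ._≤_
    (solve 1 (λ A → :4 :* (A :* A) :- A :* A := :3 :* (A :* A)) refl A)
    (trans (cong (λ z → + 4 * z - + 4 * (E′ * E′)) AC′≡) (solve 2 (λ Δ E → :4 :* (Δ :+ E) :- :4 :* E := :4 :* Δ) refl Δ (E′ * E′)))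
    (ℤ.+-mono-≤ (ℤ.*-monoˡ-≤-nonNeg (+ 4) (ℤ.*-monoˡ-≤-nonNeg A A≤C′)) (ℤ.neg-mono-≤ 4E′²≤A²))

-- The operations are abstract so that the same formulas give integers and the polynomials that the
-- ring solver compares.
module Determinants {R : Set} (_⊞_ _⊟_ _⊠_ : R → R → R) where
  det2 : R → R → R → R
  det2 aa ab bb = (aa ⊠ bb) ⊟ (ab ⊠ ab)

  det3×3 : R → R → R → R → R → R → R → R → R → R
  det3×3 a b c d e f g h i =
    ((a ⊠ ((e ⊠ i) ⊟ (f ⊠ h))) ⊟ (b ⊠ ((d ⊠ i) ⊟ (f ⊠ g)))) ⊞ (c ⊠ ((d ⊠ h) ⊟ (e ⊠ g)))

  det3 : R → R → R → R → R → R → R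
  det3 aa ab ac bb bc cc = det3×3 aa ab ac ab bb bc ac bc cc

  det4 : R → R → R → R → R → R → R → R → R → R → R
  det4 aa ab ac ad bb bc bd cc cd dd =
    (((aa ⊠ det3×3 bb bc bd bc cc cd bd cd dd) ⊟ (ab ⊠ det3×3 ab bc bd ac cc cd ad cd dd))
    ⊞ (ac ⊠ det3×3 ab bb bd ac bc cd ad bd dd)) ⊟ (ad ⊠ det3×3 ab bb bc ac bc cc ad bd cd)

open Determinants _+_ _-_ _*_ public
module :D {n : ℕ} = Determinants {Polynomial n} _:+_ _:-_ _:*_

-- Sylvester's determinant identity. The 2 × 2 minors bordering `aa` form the Gram matrix of a
-- binary form of determinant `aa · det3`, so a Gauss step applies to them; `det4-expand` is the
-- same one dimension higher.
det3-expand : ∀ aa ab ac bb bc cc →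
  det2 aa ab bb * det2 aa ac cc - (aa * bc - ab * ac) * (aa * bc - ab * ac) ≡ aa * det3 aa ab ac bb bc cc
det3-expand = solve 6 (λ aa ab ac bb bc cc →
  :D.det2 aa ab bb :* :D.det2 aa ac cc :- (aa :* bc :- ab :* ac) :* (aa :* bc :- ab :* ac) := aa :* :D.det3 aa ab ac bb bc cc) refl

det4-expand : ∀ aa ab ac ad bb bc bd cc cd dd →
  det3 aa ab ac bb bc cc * det3 aa ab ad bb bd dd - det3×3 aa ab ad ab bb bd ac bc cd * det3×3 aa ab ad ab bb bd ac bc cd
  ≡ det2 aa ab bb * det4 aa ab ac ad bb bc bd cc cd dd
det4-expand = solve 10 (λ aa ab ac ad bb bc bd cc cd dd →
  :D.det3 aa ab ac bb bc cc :* :D.det3 aa ab ad bb bd dd :- :D.det3×3 aa ab ad ab bb bd ac bc cd :* :D.det3×3 aa ab ad ab bb bd ac bc cd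
  := :D.det2 aa ab bb :* :D.det4 aa ab ac ad bb bc bd cc cd dd) refl

cong₃ : ∀ {A B C D : Set} (f : A → B → C → D) {a a′ b b′ c c′} → a ≡ a′ → b ≡ b′ → c ≡ c′ → f a b c ≡ f a′ b′ c′
cong₃ f refl refl refl = refl

cong₆ : (f : ℤ → ℤ → ℤ → ℤ → ℤ → ℤ → ℤ) → ∀ {a a′ b b′ c c′ d d′ e e′ g g′} →
        a ≡ a′ → b ≡ b′ → c ≡ c′ → d ≡ d′ → e ≡ e′ → g ≡ g′ → f a b c d e g ≡ f a′ b′ c′ d′ e′ g′
cong₆ f refl refl refl refl refl refl = refl

cong₁₀ : (f : ℤ → ℤ → ℤ → ℤ → ℤ → ℤ → ℤ → ℤ → ℤ → ℤ → ℤ) →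
         ∀ {a a′ b b′ c c′ d d′ e e′ g g′ h h′ i i′ j j′ k k′} →
         a ≡ a′ → b ≡ b′ → c ≡ c′ → d ≡ d′ → e ≡ e′ → g ≡ g′ → h ≡ h′ → i ≡ i′ → j ≡ j′ → k ≡ k′ →
         f a b c d e g h i j k ≡ f a′ b′ c′ d′ e′ g′ h′ i′ j′ k′
cong₁₀ f refl refl refl refl refl refl refl refl refl refl = refl

-- `x ⊖ m · y` stands for `x - m y`, the elementary move of lattice reduction. Sign changes need no
-- further operation, since `x ⊖ 2 · x` is `- x`.
record BilinearSpace : Set₁ where
  infixl 6 _⊖_·_
  field
    X     : Set
    _⊖_·_ : X → ℤ → X → X
    ⟨_,_⟩ : X → X → ℤ
    comm  : ∀ x y → ⟨ x , y ⟩ ≡ ⟨ y , x ⟩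
    linear : ∀ x m y z → ⟨ x ⊖ m · y , z ⟩ ≡ ⟨ x , z ⟩ - m * ⟨ y , z ⟩

module Reduction (V : BilinearSpace) where
  open BilinearSpace V

  same : ∀ x y → ⟨ x , y ⟩ ≡ ⟨ x , y ⟩
  same x y = refl

  linearʳ : ∀ z x m y → ⟨ z , x ⊖ m · y ⟩ ≡ ⟨ z , x ⟩ - m * ⟨ z , y ⟩
  linearʳ z x m y = trans (comm z _) (trans (linear x m y z) (cong₂ (λ p q → p - m * q) (comm x z) (comm y z)))

  quadratic : ∀ x m y → ⟨ x ⊖ m · y , x ⊖ m · y ⟩ ≡ ⟨ x , x ⟩ - m * ⟨ y , x ⟩ - m * (⟨ y , x ⟩ - m * ⟨ y , y ⟩)
  quadratic x m y = trans (linear x m y _) (cong₂ (λ p q → p - m * q)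
    (trans (linearʳ x x m y) (cong (λ q → ⟨ x , x ⟩ - m * q) (comm x y))) (linearʳ y x m y))

  D₁ : X → ℤ
  D₁ a = ⟨ a , a ⟩

  D₂ : X → X → ℤ
  D₂ a b = det2 ⟨ a , a ⟩ ⟨ a , b ⟩ ⟨ b , b ⟩

  D₃ : X → X → X → ℤ
  D₃ a b c = det3 ⟨ a , a ⟩ ⟨ a , b ⟩ ⟨ a , c ⟩ ⟨ b , b ⟩ ⟨ b , c ⟩ ⟨ c , c ⟩

  D₄ : X → X → X → X → ℤ
  D₄ a b c d = det4 ⟨ a , a ⟩ ⟨ a , b ⟩ ⟨ a , c ⟩ ⟨ a , d ⟩ ⟨ b , b ⟩ ⟨ b , c ⟩ ⟨ b , d ⟩ ⟨ c , c ⟩ ⟨ c , d ⟩ ⟨ d , d ⟩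

  D₂-step : ∀ a b m → D₂ (b ⊖ m · a) a ≡ D₂ a b
  D₂-step a b m = trans
    (cong₃ det2 (quadratic b m a) (trans (linear b m a a) (cong (_- m * ⟨ a , a ⟩) (comm b a))) (same a a))
    (solve 4 (λ m aa ab bb → :D.det2 (bb :- m :* ab :- m :* (ab :- m :* aa)) (ab :- m :* aa) aa := :D.det2 aa ab bb) refl m ⟨ a , a ⟩ ⟨ a , b ⟩ ⟨ b , b ⟩)

  -- The right side has the shape of `C′` in `gauss-step`, with `A = D₂ a b`, `C = D₂ a c` and the
  -- mixed minor `e` as `E`. Reducing the minors is thus a Gauss step performed by a move of
  -- vectors.
  D₂-shear : ∀ a b c m → D₂ a (c ⊖ m · b) ≡
    (let e = ⟨ a , a ⟩ * ⟨ b , c ⟩ - ⟨ a , b ⟩ * ⟨ a , c ⟩ in D₂ a c - m * e - m * (e - m * D₂ a b))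
  D₂-shear a b c m = trans (cong₃ det2 (same a a) (linearʳ a c m b) (quadratic c m b))
    (solve 7 (λ m aa ab ac bb bc cc → :D.det2 aa (ac :- m :* ab) (cc :- m :* bc :- m :* (bc :- m :* bb)) :=
      :D.det2 aa ac cc :- m :* (aa :* bc :- ab :* ac) :- m :* ((aa :* bc :- ab :* ac) :- m :* :D.det2 aa ab bb)) refl
      m ⟨ a , a ⟩ ⟨ a , b ⟩ ⟨ a , c ⟩ ⟨ b , b ⟩ ⟨ b , c ⟩ ⟨ c , c ⟩)

  D₃-shear : ∀ a b c d m → D₃ a b (d ⊖ m · c) ≡
    (let e = det3×3 ⟨ a , a ⟩ ⟨ a , b ⟩ ⟨ a , d ⟩ ⟨ a , b ⟩ ⟨ b , b ⟩ ⟨ b , d ⟩ ⟨ a , c ⟩ ⟨ b , c ⟩ ⟨ c , d ⟩ in D₃ a b d - m * e - m * (e - m * D₃ a b c))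
  D₃-shear a b c d m = trans (cong₆ det3 (same a a) (same a b) (linearʳ a d m c) (same b b) (linearʳ b d m c) (quadratic d m c))
    (solve 11 (λ m aa ab ac ad bb bc bd cc cd dd →
       :D.det3 aa ab (ad :- m :* ac) bb (bd :- m :* bc) (dd :- m :* cd :- m :* (cd :- m :* cc)) :=
       (let e = :D.det3×3 aa ab ad ab bb bd ac bc cd in :D.det3 aa ab ad bb bd dd :- m :* e :- m :* (e :- m :* :D.det3 aa ab ac bb bc cc))) refl
       m ⟨ a , a ⟩ ⟨ a , b ⟩ ⟨ a , c ⟩ ⟨ a , d ⟩ ⟨ b , b ⟩ ⟨ b , c ⟩ ⟨ b , d ⟩ ⟨ c , c ⟩ ⟨ c , d ⟩ ⟨ d , d ⟩)

  D₃-swap₁₂ : ∀ a b c → D₃ b a c ≡ D₃ a b c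
  D₃-swap₁₂ a b c = trans
    (cong₆ det3 (same b b) (comm b a) (same b c) (same a a) (same a c) (same c c))
    (solve 6 (λ aa ab ac bb bc cc → :D.det3 bb ab bc aa ac cc := :D.det3 aa ab ac bb bc cc) refl
      ⟨ a , a ⟩ ⟨ a , b ⟩ ⟨ a , c ⟩ ⟨ b , b ⟩ ⟨ b , c ⟩ ⟨ c , c ⟩)

  D₃-swap₂₃ : ∀ a b c → D₃ a c b ≡ D₃ a b c
  D₃-swap₂₃ a b c = trans
    (cong₆ det3 (same a a) (same a c) (same a b) (same c c) (comm c b) (same b b))
    (solve 6 (λ aa ab ac bb bc cc → :D.det3 aa ac ab cc bc bb := :D.det3 aa ab ac bb bc cc) refl
      ⟨ a , a ⟩ ⟨ a , b ⟩ ⟨ a , c ⟩ ⟨ b , b ⟩ ⟨ b , c ⟩ ⟨ c , c ⟩)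

  D₃-shear-cb : ∀ a b c m → D₃ a b (c ⊖ m · b) ≡ D₃ a b c
  D₃-shear-cb a b c m = trans
    (cong₆ det3 (same a a) (same a b) (linearʳ a c m b) (same b b) (linearʳ b c m b)
      (quadratic c m b))
    (solve 7 (λ m aa ab ac bb bc cc → :D.det3 aa ab (ac :- m :* ab) bb (bc :- m :* bb) (cc :- m :* bc :- m :* (bc :- m :* bb))
      := :D.det3 aa ab ac bb bc cc) refl
      m ⟨ a , a ⟩ ⟨ a , b ⟩ ⟨ a , c ⟩ ⟨ b , b ⟩ ⟨ b , c ⟩ ⟨ c , c ⟩)

  D₃-flip-c : ∀ a b c → D₃ a b (c ⊖ + 2 · c) ≡ D₃ a b c
  D₃-flip-c a b c = trans
    (cong₆ det3 (same a a) (same a b) (linearʳ a c (+ 2) c) (same b b) (linearʳ b c (+ 2) c)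
      (quadratic c (+ 2) c))
    (solve 6 (λ aa ab ac bb bc cc → :D.det3 aa ab (ac :- :2 :* ac) bb (bc :- :2 :* bc) (cc :- :2 :* cc :- :2 :* (cc :- :2 :* cc))
      := :D.det3 aa ab ac bb bc cc) refl
      ⟨ a , a ⟩ ⟨ a , b ⟩ ⟨ a , c ⟩ ⟨ b , b ⟩ ⟨ b , c ⟩ ⟨ c , c ⟩)

  D₄-swap₁₂ : ∀ a b c d → D₄ b a c d ≡ D₄ a b c d
  D₄-swap₁₂ a b c d = trans
    (cong₁₀ det4 (same b b) (comm b a) (same b c) (same b d) (same a a) (same a c) (same a d) (same c c) (same c d) (same d d))
    (solve 10 (λ aa ab ac ad bb bc bd cc cd dd → :D.det4 bb ab bc bd aa ac ad cc cd dd := :D.det4 aa ab ac ad bb bc bd cc cd dd) refl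
      ⟨ a , a ⟩ ⟨ a , b ⟩ ⟨ a , c ⟩ ⟨ a , d ⟩ ⟨ b , b ⟩ ⟨ b , c ⟩ ⟨ b , d ⟩ ⟨ c , c ⟩ ⟨ c , d ⟩ ⟨ d , d ⟩)

  D₄-swap₂₃ : ∀ a b c d → D₄ a c b d ≡ D₄ a b c d
  D₄-swap₂₃ a b c d = trans
    (cong₁₀ det4 (same a a) (same a c) (same a b) (same a d) (same c c)
      (comm c b) (same c d) (same b b) (same b d) (same d d))
    (solve 10 (λ aa ab ac ad bb bc bd cc cd dd → :D.det4 aa ac ab ad cc bc cd bb bd dd := :D.det4 aa ab ac ad bb bc bd cc cd dd) refl
      ⟨ a , a ⟩ ⟨ a , b ⟩ ⟨ a , c ⟩ ⟨ a , d ⟩ ⟨ b , b ⟩ ⟨ b , c ⟩ ⟨ b , d ⟩ ⟨ c , c ⟩ ⟨ c , d ⟩ ⟨ d , d ⟩)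

  D₄-swap₃₄ : ∀ a b c d → D₄ a b d c ≡ D₄ a b c d
  D₄-swap₃₄ a b c d = trans
    (cong₁₀ det4 (same a a) (same a b) (same a d) (same a c) (same b b) (same b d) (same b c) (same d d) (comm d c) (same c c))
    (solve 10 (λ aa ab ac ad bb bc bd cc cd dd → :D.det4 aa ab ad ac bb bd bc dd cd cc := :D.det4 aa ab ac ad bb bc bd cc cd dd) refl
      ⟨ a , a ⟩ ⟨ a , b ⟩ ⟨ a , c ⟩ ⟨ a , d ⟩ ⟨ b , b ⟩ ⟨ b , c ⟩ ⟨ b , d ⟩ ⟨ c , c ⟩ ⟨ c , d ⟩ ⟨ d , d ⟩)

  D₄-shear-dc : ∀ a b c d m → D₄ a b c (d ⊖ m · c) ≡ D₄ a b c d
  D₄-shear-dc a b c d m = trans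
    (cong₁₀ det4 (same a a) (same a b) (same a c) (linearʳ a d m c) (same b b) (same b c) (linearʳ b d m c) (same c c) (linearʳ c d m c)
      (quadratic d m c))
    (solve 11 (λ m aa ab ac ad bb bc bd cc cd dd → :D.det4 aa ab ac (ad :- m :* ac) bb bc (bd :- m :* bc) cc (cd :- m :* cc) (dd :- m :* cd :- m :* (cd :- m :* cc))
      := :D.det4 aa ab ac ad bb bc bd cc cd dd) refl
      m ⟨ a , a ⟩ ⟨ a , b ⟩ ⟨ a , c ⟩ ⟨ a , d ⟩ ⟨ b , b ⟩ ⟨ b , c ⟩ ⟨ b , d ⟩ ⟨ c , c ⟩ ⟨ c , d ⟩ ⟨ d , d ⟩)

  D₄-flip-d : ∀ a b c d → D₄ a b c (d ⊖ + 2 · d) ≡ D₄ a b c d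
  D₄-flip-d a b c d = trans
    (cong₁₀ det4 (same a a) (same a b) (same a c) (linearʳ a d (+ 2) d) (same b b) (same b c) (linearʳ b d (+ 2) d) (same c c) (linearʳ c d (+ 2) d)
      (quadratic d (+ 2) d))
    (solve 10 (λ aa ab ac ad bb bc bd cc cd dd → :D.det4 aa ab ac (ad :- :2 :* ad) bb bc (bd :- :2 :* bd) cc (cd :- :2 :* cd) (dd :- :2 :* dd :- :2 :* (dd :- :2 :* dd))
      := :D.det4 aa ab ac ad bb bc bd cc cd dd) refl
      ⟨ a , a ⟩ ⟨ a , b ⟩ ⟨ a , c ⟩ ⟨ a , d ⟩ ⟨ b , b ⟩ ⟨ b , c ⟩ ⟨ b , d ⟩ ⟨ c , c ⟩ ⟨ c , d ⟩ ⟨ d , d ⟩)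

  D₃-shear-ca : ∀ a b c m → D₃ a b (c ⊖ m · a) ≡ D₃ a b c
  D₃-shear-ca a b c m = trans (sym (D₃-swap₁₂ a b (c ⊖ m · a))) (trans (D₃-shear-cb b a c m) (D₃-swap₁₂ a b c))

  D₃-shear-ba : ∀ a b c m → D₃ a (b ⊖ m · a) c ≡ D₃ a b c
  D₃-shear-ba a b c m = trans (sym (D₃-swap₂₃ a (b ⊖ m · a) c)) (trans (D₃-shear-ca a c b m) (D₃-swap₂₃ a b c))

  D₃-step₁ : ∀ a b c m → D₃ (b ⊖ m · a) a c ≡ D₃ a b c
  D₃-step₁ a b c m = trans (D₃-swap₁₂ a (b ⊖ m · a) c) (D₃-shear-ba a b c m)

  D₃-step₂ : ∀ a b c m → D₃ a (c ⊖ m · b) b ≡ D₃ a b c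
  D₃-step₂ a b c m = trans (D₃-swap₂₃ a b (c ⊖ m · b)) (D₃-shear-cb a b c m)

  D₄-shear-db : ∀ a b c d m → D₄ a b c (d ⊖ m · b) ≡ D₄ a b c d
  D₄-shear-db a b c d m = trans (sym (D₄-swap₂₃ a b c (d ⊖ m · b))) (trans (D₄-shear-dc a c b d m) (D₄-swap₂₃ a b c d))

  D₄-shear-da : ∀ a b c d m → D₄ a b c (d ⊖ m · a) ≡ D₄ a b c d
  D₄-shear-da a b c d m = trans (sym (D₄-swap₁₂ a b c (d ⊖ m · a))) (trans (D₄-shear-db b a c d m) (D₄-swap₁₂ a b c d))

  D₄-shear-cb : ∀ a b c d m → D₄ a b (c ⊖ m · b) d ≡ D₄ a b c d
  D₄-shear-cb a b c d m = trans (sym (D₄-swap₃₄ a b (c ⊖ m · b) d)) (trans (D₄-shear-db a b d c m) (D₄-swap₃₄ a b c d))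

  D₄-shear-ca : ∀ a b c d m → D₄ a b (c ⊖ m · a) d ≡ D₄ a b c d
  D₄-shear-ca a b c d m = trans (sym (D₄-swap₃₄ a b (c ⊖ m · a) d)) (trans (D₄-shear-da a b d c m) (D₄-swap₃₄ a b c d))

  D₄-shear-ba : ∀ a b c d m → D₄ a (b ⊖ m · a) c d ≡ D₄ a b c d
  D₄-shear-ba a b c d m = trans (sym (D₄-swap₂₃ a (b ⊖ m · a) c d)) (trans (D₄-shear-ca a c b d m) (D₄-swap₂₃ a b c d))

  D₄-flip-c : ∀ a b c d → D₄ a b (c ⊖ + 2 · c) d ≡ D₄ a b c d
  D₄-flip-c a b c d = trans (sym (D₄-swap₃₄ a b (c ⊖ + 2 · c) d)) (trans (D₄-flip-d a b d c) (D₄-swap₃₄ a b c d))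

  D₄-step₁ : ∀ a b c d m → D₄ (b ⊖ m · a) a c d ≡ D₄ a b c d
  D₄-step₁ a b c d m = trans (D₄-swap₁₂ a (b ⊖ m · a) c d) (D₄-shear-ba a b c d m)

  D₄-step₂ : ∀ a b c d m → D₄ a (c ⊖ m · b) b d ≡ D₄ a b c d
  D₄-step₂ a b c d m = trans (D₄-swap₂₃ a b (c ⊖ m · b) d) (D₄-shear-cb a b c d m)

  D₄-step₃ : ∀ a b c d m → D₄ a b (d ⊖ m · c) c ≡ D₄ a b c d
  D₄-step₃ a b c d m = trans (D₄-swap₃₄ a b c (d ⊖ m · c)) (D₄-shear-dc a b c d m)

  -- LLL reduction with all leading minors D₁, …, D₄ integral: a swap at position k decreases Dₖ and preserves the other minors.
  record Frame (D : ℤ) : Set where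
    field
      a b c d : X
      0<D₁ : 0ℤ ℤ.< D₁ a
      0<D₂ : 0ℤ ℤ.< D₂ a b
      0<D₃ : 0ℤ ℤ.< D₃ a b c
      D₄≡D : D₄ a b c d ≡ D

  size : ∀ {D} → Frame D → ℕ
  size F = ∣ D₁ a ∣ ℕ.+ (∣ D₂ a b ∣ ℕ.+ ∣ D₃ a b c ∣)
    where open Frame F

  -- In terms of the Gram-Schmidt norms `Dₖ / Dₖ₋₁`, with `D₀ = 1`, each bound says that a norm is
  -- at most 4/3 of the next one.
  record Reduced {D : ℤ} (F : Frame D) : Set where
    open Frame F
    field
      bound₁ : + 3 * (D₁ a * D₁ a) ℤ.≤ + 4 * D₂ a b
      bound₂ : + 3 * (D₂ a b * D₂ a b) ℤ.≤ + 4 * (D₁ a * D₃ a b c)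
      bound₃ : + 3 * (D₃ a b c * D₃ a b c) ℤ.≤ + 4 * (D₂ a b * D)

  private
    ∣∣-mono-< : ∀ {x y} → 0ℤ ℤ.< x → x ℤ.< y → ∣ x ∣ ℕ.< ∣ y ∣
    ∣∣-mono-< (ℤ.+<+ _) (ℤ.+<+ h) = h

    module Step {D : ℤ} (0<D : 0ℤ ℤ.< D) (F : Frame D) where
      open Frame F

      Smaller : Set
      Smaller = ∃[ G ] size {D} G ℕ.< size F

      step₁ : Smaller ⊎ + 3 * (D₁ a * D₁ a) ℤ.≤ + 4 * D₂ a b
      step₁ = case gauss-step (D₁ a) ⟨ a , b ⟩ (D₁ b) (D₂ a b) 0<D₁ refl 0<D₂ of λ where
          (m , 0<C , inj₂ bound) → inj₂ bound
          (m , 0<C , inj₁ C<A)   → inj₁ (swap m (subst (0ℤ ℤ.<_) (sym (quadratic b m a)) 0<C) (subst (ℤ._< D₁ a) (sym (quadratic b m a)) C<A))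
        where
        swap : ∀ m → 0ℤ ℤ.< D₁ (b ⊖ m · a) → D₁ (b ⊖ m · a) ℤ.< D₁ a → Smaller
        swap m 0<C C<A = record
          { a = b ⊖ m · a ; b = a ; c = c ; d = d
          ; 0<D₁ = 0<C
          ; 0<D₂ = subst (0ℤ ℤ.<_) (sym (D₂-step a b m)) 0<D₂
          ; 0<D₃ = subst (0ℤ ℤ.<_) (sym (D₃-step₁ a b c m)) 0<D₃
          ; D₄≡D = trans (D₄-step₁ a b c d m) D₄≡D
          } , ℕ.+-mono-<-≤ (∣∣-mono-< 0<C C<A) (ℕ.≤-reflexive (cong₂ (λ x y → ∣ x ∣ ℕ.+ ∣ y ∣) (D₂-step a b m) (D₃-step₁ a b c m)))

      step₂ : Smaller ⊎ + 3 * (D₂ a b * D₂ a b) ℤ.≤ + 4 * (D₁ a * D₃ a b c)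
      step₂ = case gauss-step (D₂ a b) (⟨ a , a ⟩ * ⟨ b , c ⟩ - ⟨ a , b ⟩ * ⟨ a , c ⟩) (D₂ a c) (D₁ a * D₃ a b c) 0<D₂
            (det3-expand ⟨ a , a ⟩ ⟨ a , b ⟩ ⟨ a , c ⟩ ⟨ b , b ⟩ ⟨ b , c ⟩ ⟨ c , c ⟩) (0<* 0<D₁ 0<D₃) of λ where
          (m , 0<C , inj₂ bound) → inj₂ bound
          (m , 0<C , inj₁ C<A)   → inj₁ (swap m (subst (0ℤ ℤ.<_) (sym (D₂-shear a b c m)) 0<C) (subst (ℤ._< D₂ a b) (sym (D₂-shear a b c m)) C<A))
        where
        swap : ∀ m → 0ℤ ℤ.< D₂ a (c ⊖ m · b) → D₂ a (c ⊖ m · b) ℤ.< D₂ a b → Smaller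
        swap m 0<C C<A = record
          { a = a ; b = c ⊖ m · b ; c = b ; d = d
          ; 0<D₁ = 0<D₁
          ; 0<D₂ = 0<C
          ; 0<D₃ = subst (0ℤ ℤ.<_) (sym (D₃-step₂ a b c m)) 0<D₃
          ; D₄≡D = trans (D₄-step₂ a b c d m) D₄≡D
          } , ℕ.+-monoʳ-< ∣ D₁ a ∣ (ℕ.+-mono-<-≤ (∣∣-mono-< 0<C C<A) (ℕ.≤-reflexive (cong ∣_∣ (D₃-step₂ a b c m))))

      step₃ : Smaller ⊎ + 3 * (D₃ a b c * D₃ a b c) ℤ.≤ + 4 * (D₂ a b * D)
      step₃ = case gauss-step (D₃ a b c) (det3×3 ⟨ a , a ⟩ ⟨ a , b ⟩ ⟨ a , d ⟩ ⟨ a , b ⟩ ⟨ b , b ⟩ ⟨ b , d ⟩ ⟨ a , c ⟩ ⟨ b , c ⟩ ⟨ c , d ⟩)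
            (D₃ a b d) (D₂ a b * D) 0<D₃
            (trans (det4-expand ⟨ a , a ⟩ ⟨ a , b ⟩ ⟨ a , c ⟩ ⟨ a , d ⟩ ⟨ b , b ⟩ ⟨ b , c ⟩ ⟨ b , d ⟩ ⟨ c , c ⟩ ⟨ c , d ⟩ ⟨ d , d ⟩) (cong (D₂ a b *_) D₄≡D))
            (0<* 0<D₂ 0<D) of λ where
          (m , 0<C , inj₂ bound) → inj₂ bound
          (m , 0<C , inj₁ C<A)   → inj₁ (swap m (subst (0ℤ ℤ.<_) (sym (D₃-shear a b c d m)) 0<C) (subst (ℤ._< D₃ a b c) (sym (D₃-shear a b c d m)) C<A))
        where
        swap : ∀ m → 0ℤ ℤ.< D₃ a b (d ⊖ m · c) → D₃ a b (d ⊖ m · c) ℤ.< D₃ a b c → Smaller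
        swap m 0<C C<A = record
          { a = a ; b = b ; c = d ⊖ m · c ; d = c
          ; 0<D₁ = 0<D₁
          ; 0<D₂ = 0<D₂
          ; 0<D₃ = 0<C
          ; D₄≡D = trans (D₄-step₃ a b c d m) D₄≡D
          } , ℕ.+-monoʳ-< ∣ D₁ a ∣ (ℕ.+-monoʳ-< ∣ D₂ a b ∣ (∣∣-mono-< 0<C C<A))

      step : Smaller ⊎ Reduced F
      step = combine step₁ step₂ step₃
        where
        combine : _ → _ → _ → Smaller ⊎ Reduced F
        combine (inj₁ s) _ _ = inj₁ s
        combine (inj₂ _) (inj₁ s) _ = inj₁ s
        combine (inj₂ _) (inj₂ _) (inj₁ s) = inj₁ s
        combine (inj₂ b₁) (inj₂ b₂) (inj₂ b₃) = inj₂ record { bound₁ = b₁ ; bound₂ = b₂ ; bound₃ = b₃ }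

    reduce-acc : ∀ {D} → 0ℤ ℤ.< D → (F : Frame D) → Acc ℕ._<_ (size F) → ∃[ G ] Reduced {D} G
    reduce-acc 0<D F (acc rec) = case Step.step 0<D F of λ where
      (inj₂ red)       → F , red
      (inj₁ (G , G<F)) → reduce-acc 0<D G (rec G<F)

  reduce : ∀ {D} → 0ℤ ℤ.< D → Frame D → ∃[ G ] Reduced {D} G
  reduce 0<D F = reduce-acc 0<D F (<-wellFounded (size F))

not-multiple : ∀ n r {_ : False (n ℕ.∣? r)} q → q * + n ≢ + r
not-multiple n r {n∤r} q e = toWitnessFalse n∤r (∣⇒∣ᵤ (divides q (sym e)))

square-≤⇒≤ : ∀ c B k y {_ : False (c ℕ.* (suc k ℕ.* suc k) ℕ.≤? B)} → c ℕ.* (y ℕ.* y) ℕ.≤ B → y ℕ.≤ k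
square-≤⇒≤ c B k y {too-big} h = ℕ.≮⇒≥ λ k<y → toWitnessFalse too-big (ℕ.≤-trans (ℕ.*-monoʳ-≤ c (ℕ.*-mono-≤ k<y k<y)) h)

division : ∀ x n .{{_ : ℕ.NonZero n}} → ∃[ k ] ∃[ r ] r ℕ.< n × x ≡ + r + k * + n
division x n = x /ℕ n , x %ℕ n , ℤ.n%ℕd<d x n , ℤ.a≡a%ℕn+[a/ℕn]*n x n

0<⇒+ : ∀ {x} → 0ℤ ℤ.< x → ∃[ n ] 0 ℕ.< n × x ≡ + n
0<⇒+ (ℤ.+<+ {n = n} 0<n) = n , 0<n , refl

drop-+ : ∀ p a b q c d → + p * (+ a * + b) ℤ.≤ + q * (+ c * + d) → p ℕ.* (a ℕ.* b) ℕ.≤ q ℕ.* (c ℕ.* d)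
drop-+ p a b q c d h = ℤ.drop‿+≤+ (subst₂ ℤ._≤_ (sym (eq p a b)) (sym (eq q c d)) h)
  where
  eq : ∀ p a b → + (p ℕ.* (a ℕ.* b)) ≡ + p * (+ a * + b)
  eq p a b = trans (ℤ.pos-* p (a ℕ.* b)) (cong (+ p *_) (ℤ.pos-* a b))

-- Squaring the middle bound and inserting the outer two eliminates `x` and `z` and leaves
-- `81 y⁴ ≤ 256 y² D`. A bound on `y` then bounds `x` and `z` as well.
minor-bound : ∀ D x y z → 0 ℕ.< y → 3 ℕ.* (x ℕ.* x) ℕ.≤ 4 ℕ.* y → 3 ℕ.* (y ℕ.* y) ℕ.≤ 4 ℕ.* (x ℕ.* z) →
              3 ℕ.* (z ℕ.* z) ℕ.≤ 4 ℕ.* (y ℕ.* D) → 81 ℕ.* (y ℕ.* y) ℕ.≤ 256 ℕ.* D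
minor-bound D x y@(suc _) z _ h₁ h₂ h₃ = ℕ.*-cancelˡ-≤ (y ℕ.* y) (begin
  y ℕ.* y ℕ.* (81 ℕ.* (y ℕ.* y))                        ≡⟨ NS.solve 1 (λ y → y NS.:* y NS.:* (NS.con 81 NS.:* (y NS.:* y)) NS.:= NS.con 9 NS.:* (NS.con 3 NS.:* (y NS.:* y) NS.:* (NS.con 3 NS.:* (y NS.:* y)))) refl y ⟩
  9 ℕ.* (3 ℕ.* (y ℕ.* y) ℕ.* (3 ℕ.* (y ℕ.* y)))         ≤⟨ ℕ.*-monoʳ-≤ 9 (ℕ.*-mono-≤ h₂ h₂) ⟩
  9 ℕ.* (4 ℕ.* (x ℕ.* z) ℕ.* (4 ℕ.* (x ℕ.* z)))         ≡⟨ NS.solve 2 (λ x z → NS.con 9 NS.:* (NS.con 4 NS.:* (x NS.:* z) NS.:* (NS.con 4 NS.:* (x NS.:* z))) NS.:= NS.con 16 NS.:* (NS.con 3 NS.:* (x NS.:* x) NS.:* (NS.con 3 NS.:* (z NS.:* z)))) refl x z ⟩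
  16 ℕ.* (3 ℕ.* (x ℕ.* x) ℕ.* (3 ℕ.* (z ℕ.* z)))        ≤⟨ ℕ.*-monoʳ-≤ 16 (ℕ.*-mono-≤ h₁ h₃) ⟩
  16 ℕ.* (4 ℕ.* y ℕ.* (4 ℕ.* (y ℕ.* D)))                ≡⟨ NS.solve 2 (λ y D → NS.con 16 NS.:* (NS.con 4 NS.:* y NS.:* (NS.con 4 NS.:* (y NS.:* D))) NS.:= y NS.:* y NS.:* (NS.con 256 NS.:* D)) refl y D ⟩
  y ℕ.* y ℕ.* (256 ℕ.* D)                               ∎)
  where open ℕ.≤-Reasoning

-- Quaternary forms of determinant 1, and even ones of determinant 5

module Small-Determinant (V : BilinearSpace) where
  open BilinearSpace V
  open Reduction V

  record Minors (n : ℕ) (F : Frame (+ n)) : Set where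
    open Frame F
    field
      x y z : ℕ
      0<x : 0 ℕ.< x
      D₁≡ : D₁ a ≡ + x
      D₂≡ : D₂ a b ≡ + y
      D₃≡ : D₃ a b c ≡ + z
      h₁ : 3 ℕ.* (x ℕ.* x) ℕ.≤ 4 ℕ.* y
      h₂ : 3 ℕ.* (y ℕ.* y) ℕ.≤ 4 ℕ.* (x ℕ.* z)
      h₃ : 3 ℕ.* (z ℕ.* z) ℕ.≤ 4 ℕ.* (y ℕ.* n)
      y-bound : 81 ℕ.* (y ℕ.* y) ℕ.≤ 256 ℕ.* n

  minors : ∀ n F → Reduced F → Minors n F
  minors n F red = record
    { x = x ; y = y ; z = z ; 0<x = proj₁ (proj₂ X₁) ; D₁≡ = D₁≡ ; D₂≡ = D₂≡ ; D₃≡ = D₃≡ ; h₁ = h₁ ; h₂ = h₂ ; h₃ = h₃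
    ; y-bound = minor-bound n x y z (proj₁ (proj₂ X₂)) h₁ h₂ h₃ }
    where
    open Frame F
    open Reduced red
    X₁ = 0<⇒+ 0<D₁
    X₂ = 0<⇒+ 0<D₂
    X₃ = 0<⇒+ 0<D₃
    x = proj₁ X₁
    y = proj₁ X₂
    z = proj₁ X₃
    D₁≡ : D₁ a ≡ + x
    D₁≡ = proj₂ (proj₂ X₁)
    D₂≡ : D₂ a b ≡ + y
    D₂≡ = proj₂ (proj₂ X₂)
    D₃≡ : D₃ a b c ≡ + z
    D₃≡ = proj₂ (proj₂ X₃)
    h₁ : 3 ℕ.* (x ℕ.* x) ℕ.≤ 4 ℕ.* y
    h₁ = subst (λ w → 3 ℕ.* (x ℕ.* x) ℕ.≤ 4 ℕ.* w) (ℕ.*-identityˡ y) (drop-+ 3 x x 4 1 y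
      (subst₂ ℤ._≤_ (cong (λ w → + 3 * (w * w)) D₁≡) (cong (+ 4 *_) (trans D₂≡ (sym (ℤ.*-identityˡ (+ y))))) bound₁))
    h₂ : 3 ℕ.* (y ℕ.* y) ℕ.≤ 4 ℕ.* (x ℕ.* z)
    h₂ = drop-+ 3 y y 4 x z (subst₂ ℤ._≤_ (cong (λ w → + 3 * (w * w)) D₂≡) (cong₂ (λ v w → + 4 * (v * w)) D₁≡ D₃≡) bound₂)
    h₃ : 3 ℕ.* (z ℕ.* z) ℕ.≤ 4 ℕ.* (y ℕ.* n)
    h₃ = drop-+ 3 z z 4 y n (subst₂ ℤ._≤_ (cong (λ w → + 3 * (w * w)) D₃≡) (cong (λ w → + 4 * (w * + n)) D₂≡) bound₃)

  unimodular⇒unit-vector : Frame 1ℤ → ∃[ a ] ⟨ a , a ⟩ ≡ 1ℤ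
  unimodular⇒unit-vector F₀ = Frame.a F , trans M.D₁≡ (cong +_ (ℕ.≤-antisym x≤1 M.0<x))
    where
    F = proj₁ (reduce (ℤ.+<+ (ℕ.s≤s ℕ.z≤n)) F₀)
    module M = Minors (minors 1 F (proj₂ (reduce (ℤ.+<+ (ℕ.s≤s ℕ.z≤n)) F₀)))
    y≤1 : M.y ℕ.≤ 1
    y≤1 = square-≤⇒≤ 81 256 1 M.y M.y-bound
    x≤1 : M.x ℕ.≤ 1
    x≤1 = square-≤⇒≤ 3 4 1 M.x (ℕ.≤-trans M.h₁ (ℕ.*-monoʳ-≤ 4 y≤1))

  record A₄-Frame : Set where
    field
      a b c d : X
      aa : ⟨ a , a ⟩ ≡ + 2
      ab : ⟨ a , b ⟩ ≡ -1ℤ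
      ac : ⟨ a , c ⟩ ≡ 0ℤ
      ad : ⟨ a , d ⟩ ≡ 0ℤ
      bb : ⟨ b , b ⟩ ≡ + 2
      bc : ⟨ b , c ⟩ ≡ -1ℤ
      bd : ⟨ b , d ⟩ ≡ 0ℤ
      cc : ⟨ c , c ⟩ ≡ + 2
      cd : ⟨ c , d ⟩ ≡ -1ℤ
      dd : ⟨ d , d ⟩ ≡ + 2

  private
    record Stage₁ : Set where
      field
        a b c d : X
        aa : ⟨ a , a ⟩ ≡ + 2
        ab : ⟨ a , b ⟩ ≡ -1ℤ
        bb : ⟨ b , b ⟩ ≡ + 2
        D₃≡4 : D₃ a b c ≡ + 4
        D₄≡5 : D₄ a b c d ≡ + 5

    record Stage₂ : Set where
      field
        a b c d : X
        aa : ⟨ a , a ⟩ ≡ + 2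
        ab : ⟨ a , b ⟩ ≡ -1ℤ
        ac : ⟨ a , c ⟩ ≡ 0ℤ
        bb : ⟨ b , b ⟩ ≡ + 2
        bc : ⟨ b , c ⟩ ≡ -1ℤ
        cc : ⟨ c , c ⟩ ≡ + 2
        D₄≡5 : D₄ a b c d ≡ + 5

    -- det A₂ = 3 forces ⟨ a , b ⟩ to be odd, so b can be moved to make it -1.
    fit₁ : ∀ x z → + 2 * z - x * x ≡ + 3 → ∃[ m ] x - m * + 2 ≡ -1ℤ × z - m * x - m * (x - m * + 2) ≡ + 2
    fit₁ x z h = go (division x 2)
      where
      go : ∃[ k ] ∃[ r ] r ℕ.< 2 × x ≡ + r + k * + 2 → ∃[ m ] x - m * + 2 ≡ -1ℤ × z - m * x - m * (x - m * + 2) ≡ + 2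
      go (k , 0 , _ , x≡) = contradiction
        (by₂ 1ℤ (x + k * + 2) h x≡ (solve 3 (λ x z k → (z :- :2 :* k :* k) :* :2 :- :3 :=
          :1 :* (:2 :* z :- x :* x :- :3) :+ (x :+ k :* :2) :* (x :- (:0 :+ k :* :2))) refl x z k))
        (not-multiple 2 3 (z - + 2 * k * k))
      go (k , 1 , _ , x≡) = k + 1ℤ ,
        by₁ 1ℤ x≡ (solve 2 (λ x k → x :- (k :+ :1) :* :2 :- con -1ℤ := :1 :* (x :- (:1 :+ k :* :2))) refl x k) ,
        ℤ.*-cancelˡ-≡ (+ 2) _ _ (by₂ 1ℤ (x - + 2 * k - + 3) h x≡
          (solve 3 (λ x z k → :2 :* (z :- (k :+ :1) :* x :- (k :+ :1) :* (x :- (k :+ :1) :* :2)) :- :2 :* :2 :=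
            :1 :* (:2 :* z :- x :* x :- :3) :+ (x :- :2 :* k :- :3) :* (x :- (:1 :+ k :* :2))) refl x z k))
      go (k , suc (suc _) , ℕ.s≤s (ℕ.s≤s ()) , _)

    stage₁ : ∀ a b c d → ⟨ a , a ⟩ ≡ + 2 → D₂ a b ≡ + 3 → D₃ a b c ≡ + 4 → D₄ a b c d ≡ + 5 → Stage₁
    stage₁ a b c d aa D₂≡3 D₃≡4 D₄≡5 = move (fit₁ ⟨ a , b ⟩ ⟨ b , b ⟩ (trans (cong (λ z → z * ⟨ b , b ⟩ - ⟨ a , b ⟩ * ⟨ a , b ⟩) (sym aa)) D₂≡3))
      where
      move : ∃[ m ] ⟨ a , b ⟩ - m * + 2 ≡ -1ℤ × ⟨ b , b ⟩ - m * ⟨ a , b ⟩ - m * (⟨ a , b ⟩ - m * + 2) ≡ + 2 → Stage₁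
      move (m , x≡ , z≡) = record
        { a = a ; b = b ⊖ m · a ; c = c ; d = d ; aa = aa
        ; ab = trans (linearʳ a b m a) (trans (cong (λ w → ⟨ a , b ⟩ - m * w) aa) x≡)
        ; bb = trans (quadratic b m a) (trans (cong (λ w → ⟨ b , b ⟩ - m * ⟨ a , b ⟩ - m * (⟨ a , b ⟩ - m * w)) aa) z≡)
        ; D₃≡4 = trans (D₃-shear-ba a b c m) D₃≡4
        ; D₄≡5 = trans (D₄-shear-ba a b c d m) D₄≡5
        }

    flipped : ∀ x c → ⟨ x , c ⊖ + 2 · c ⟩ ≡ - ⟨ x , c ⟩
    flipped x c = trans (linearʳ x c (+ 2) c) (solve 1 (λ x → x :- :2 :* x := :- x) refl ⟨ x , c ⟩)

    module Stage₁⇒₂ (a b d : X) (aa : ⟨ a , a ⟩ ≡ + 2) (ab : ⟨ a , b ⟩ ≡ -1ℤ) (bb : ⟨ b , b ⟩ ≡ + 2) where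
      D₃-value : ∀ c {x y} → ⟨ a , c ⟩ ≡ x → ⟨ b , c ⟩ ≡ y → D₃ a b c ≡ det3 (+ 2) -1ℤ x (+ 2) y ⟨ c , c ⟩
      D₃-value c x≡ y≡ = cong₆ det3 aa ab x≡ bb y≡ refl

      -- Subtracting multiples of `a` and `b` from `c` moves `(x , y)` by rows of A₂, and the only
      -- invariant is `x - y` modulo 3, because the discriminant group of A₂ has order 3. The target
      -- `(0 , -1)` lies in class 1; `m₁` and `m₂` solve the linear system, and the determinant then
      -- forces `⟨ c″ , c″ ⟩ = 2`.
      aim : ∀ c k → ⟨ a , c ⟩ - ⟨ b , c ⟩ ≡ 1ℤ + k * + 3 → D₃ a b c ≡ + 4 → D₄ a b c d ≡ + 5 → Stage₂
      aim c k x-y≡ D₃≡4 D₄≡5 = record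
        { a = a ; b = b ; c = c″ ; d = d ; aa = aa ; ab = ab ; ac = ac ; bb = bb ; bc = bc ; cc = cc
        ; D₄≡5 = trans (D₄-shear-cb a b c′ d m₂) (trans (D₄-shear-ca a b c d m₁) D₄≡5)
        }
        where
        x = ⟨ a , c ⟩
        y = ⟨ b , c ⟩
        m₁ = y + + 2 * k + 1ℤ
        m₂ = y + k + 1ℤ
        c′ = c ⊖ m₁ · a
        c″ = c′ ⊖ m₂ · b
        ac : ⟨ a , c″ ⟩ ≡ 0ℤ
        ac = trans (trans (linearʳ a c′ m₂ b) (cong₂ (λ v w → v - m₂ * w) (trans (linearʳ a c m₁ a) (cong (λ w → x - m₁ * w) aa)) ab))
          (by₁ 1ℤ x-y≡ (solve 3 (λ x y k → x :- (y :+ :2 :* k :+ :1) :* :2 :- (y :+ k :+ :1) :* con -1ℤ :- :0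
            := :1 :* (x :- y :- (:1 :+ k :* :3))) refl x y k))
        bc : ⟨ b , c″ ⟩ ≡ -1ℤ
        bc = trans (trans (linearʳ b c′ m₂ b) (cong₂ (λ v w → v - m₂ * w) (trans (linearʳ b c m₁ a) (cong (λ w → y - m₁ * w) (trans (comm b a) ab))) bb))
          (solve 2 (λ y k → y :- (y :+ :2 :* k :+ :1) :* con -1ℤ :- (y :+ k :+ :1) :* :2 := con -1ℤ) refl y k)
        cc : ⟨ c″ , c″ ⟩ ≡ + 2
        cc = ℤ.*-cancelˡ-≡ (+ 3) _ _ (by₁ 1ℤ
          (trans (sym (D₃-value c″ ac bc)) (trans (D₃-shear-cb a b c′ m₂) (trans (D₃-shear-ca a b c m₁) D₃≡4)))
          (solve 1 (λ z → :3 :* z :- :3 :* :2 := :1 :* (:D.det3 :2 (con -1ℤ) :0 :2 (con -1ℤ) z :- :4)) refl ⟨ c″ , c″ ⟩))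

      -- Modulo 3 the determinant is `-2 (x² + x y + y²)`, which vanishes when `x ≡ y`, whereas 4
      -- does not. Of the two remaining classes, a sign change of `c` turns one into the other.
      fit₂ : ∀ x y z k → det3 (+ 2) -1ℤ x (+ 2) y z ≡ + 4 → x - y ≢ k * + 3
      fit₂ x y z k h e = not-multiple 3 4 (z - + 2 * (y * y) - + 6 * (k * y) - + 6 * (k * k)) (by₂ 1ℤ (+ 2 * (x + + 2 * y + k * + 3)) h e
        (solve 4 (λ x y z k → (z :- :2 :* (y :* y) :- con (+ 6) :* (k :* y) :- con (+ 6) :* (k :* k)) :* :3 :- :4 :=
          :1 :* (:D.det3 :2 (con -1ℤ) x :2 y z :- :4) :+ :2 :* (x :+ :2 :* y :+ k :* :3) :* (x :- y :- k :* :3)) refl x y z k))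

      stage₂ : ∀ c → D₃ a b c ≡ + 4 → D₄ a b c d ≡ + 5 → Stage₂
      stage₂ c D₃≡4 D₄≡5 = go (division (⟨ a , c ⟩ - ⟨ b , c ⟩) 3)
        where
        go : ∃[ k ] ∃[ r ] r ℕ.< 3 × ⟨ a , c ⟩ - ⟨ b , c ⟩ ≡ + r + k * + 3 → Stage₂
        go (k , 0 , _ , e) = contradiction (trans e (ℤ.+-identityˡ (k * + 3)))
          (fit₂ ⟨ a , c ⟩ ⟨ b , c ⟩ ⟨ c , c ⟩ k (trans (sym (D₃-value c refl refl)) D₃≡4))
        go (k , 1 , _ , e) = aim c k e D₃≡4 D₄≡5
        go (k , 2 , _ , e) = aim (c ⊖ + 2 · c) (- k - 1ℤ)
          (trans (cong₂ _-_ (flipped a c) (flipped b c)) (by₁ -1ℤ e (solve 3 (λ x y k → :- x :- (:- y) :- (:1 :+ (:- k :- :1) :* :3) :=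
            con -1ℤ :* (x :- y :- (:2 :+ k :* :3))) refl ⟨ a , c ⟩ ⟨ b , c ⟩ k)))
          (trans (D₃-flip-c a b c) D₃≡4) (trans (D₄-flip-c a b c d) D₄≡5)
        go (k , suc (suc (suc _)) , ℕ.s≤s (ℕ.s≤s (ℕ.s≤s ())) , _)

    module Stage₂⇒₃ (S : Stage₂) where
      open Stage₂ S hiding (d; D₄≡5)

      D₄-value : ∀ d {x y z} → ⟨ a , d ⟩ ≡ x → ⟨ b , d ⟩ ≡ y → ⟨ c , d ⟩ ≡ z →
                 D₄ a b c d ≡ det4 (+ 2) -1ℤ 0ℤ x (+ 2) -1ℤ y (+ 2) z ⟨ d , d ⟩
      D₄-value d refl refl refl = trans (cong₆ (λ p q r s t u → det4 p q r ⟨ a , d ⟩ s t ⟨ b , d ⟩ u ⟨ c , d ⟩ ⟨ d , d ⟩) aa ab ac bb bc cc) refl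

      -- The discriminant group of A₃ is cyclic of order 4, and `x + 2 y + 3 z` modulo 4 is its
      -- coordinate. The target `(0 , 0 , -1)` has class 1, and `m₁`, `m₂`, `m₃` carry `(x , y , z)`
      -- there.
      aim : ∀ d k → ⟨ a , d ⟩ + + 2 * ⟨ b , d ⟩ + + 3 * ⟨ c , d ⟩ ≡ 1ℤ + k * + 4 → D₄ a b c d ≡ + 5 → A₄-Frame
      aim d k f≡ D₄≡5 = record
        { a = a ; b = b ; c = c ; d = d‴ ; aa = aa ; ab = ab ; ac = ac ; ad = ad ; bb = bb ; bc = bc ; bd = bd ; cc = cc ; cd = cd ; dd = dd }
        where
        x = ⟨ a , d ⟩
        y = ⟨ b , d ⟩
        z = ⟨ c , d ⟩
        m₁ = + 3 * k + 1ℤ - y - + 2 * z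
        m₂ = + 2 * k + 1ℤ - z
        m₃ = k + 1ℤ
        d′ = d ⊖ m₁ · a
        d″ = d′ ⊖ m₂ · b
        d‴ = d″ ⊖ m₃ · c
        expand : ∀ u {p q r} → ⟨ u , a ⟩ ≡ p → ⟨ u , b ⟩ ≡ q → ⟨ u , c ⟩ ≡ r → ⟨ u , d‴ ⟩ ≡ ⟨ u , d ⟩ - m₁ * p - m₂ * q - m₃ * r
        expand u refl refl refl = trans (linearʳ u d″ m₃ c) (cong (_- m₃ * ⟨ u , c ⟩)
          (trans (linearʳ u d′ m₂ b) (cong (_- m₂ * ⟨ u , b ⟩) (linearʳ u d m₁ a))))
        ad : ⟨ a , d‴ ⟩ ≡ 0ℤ
        ad = trans (expand a aa ab ac) (by₁ 1ℤ f≡ (solve 4 (λ x y z k →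
          x :- (:3 :* k :+ :1 :- y :- :2 :* z) :* :2 :- (:2 :* k :+ :1 :- z) :* con -1ℤ :- (k :+ :1) :* :0 :- :0
          := :1 :* (x :+ :2 :* y :+ :3 :* z :- (:1 :+ k :* :4))) refl x y z k))
        bd : ⟨ b , d‴ ⟩ ≡ 0ℤ
        bd = trans (expand b (trans (comm b a) ab) bb bc) (solve 3 (λ y z k →
          y :- (:3 :* k :+ :1 :- y :- :2 :* z) :* con -1ℤ :- (:2 :* k :+ :1 :- z) :* :2 :- (k :+ :1) :* con -1ℤ
          := :0) refl y z k)
        cd : ⟨ c , d‴ ⟩ ≡ -1ℤ
        cd = trans (expand c (trans (comm c a) ac) (trans (comm c b) bc) cc) (solve 3 (λ y z k →
          z :- (:3 :* k :+ :1 :- y :- :2 :* z) :* :0 :- (:2 :* k :+ :1 :- z) :* con -1ℤ :- (k :+ :1) :* :2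
          := con -1ℤ) refl y z k)
        dd : ⟨ d‴ , d‴ ⟩ ≡ + 2
        dd = ℤ.*-cancelˡ-≡ (+ 4) _ _ (by₁ 1ℤ
          (trans (sym (D₄-value d‴ ad bd cd)) (trans (D₄-shear-dc a b c d″ m₃) (trans (D₄-shear-db a b c d′ m₂) (trans (D₄-shear-da a b c d m₁) D₄≡5))))
          (solve 1 (λ w → :4 :* w :- :4 :* :2 :=
            :1 :* (:D.det4 :2 (con -1ℤ) :0 :0 :2 (con -1ℤ) :0 :2 (con -1ℤ) w :- :5)) refl ⟨ d‴ , d‴ ⟩))

      -- Modulo 4 the determinant is -3 (x + 2y + 3z)².
      fit₃ : ∀ x y z w k → det4 (+ 2) -1ℤ 0ℤ x (+ 2) -1ℤ y (+ 2) z w ≡ + 5 → x + + 2 * y + + 3 * z ≢ k * + 2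
      fit₃ x y z w k h e = not-multiple 2 5 q (by₂ 1ℤ (+ 3 * (x + + 2 * y + + 3 * z + k * + 2)) h e
        (solve 5 (λ x y z w k → (:2 :* w :+ :4 :* y :* y :+ con (+ 12) :* z :* z :+ :4 :* x :* y :+ con (+ 8) :* x :* z :+ con (+ 16) :* y :* z :- con (+ 6) :* k :* k) :* :2 :- :5 :=
          :1 :* (:D.det4 :2 (con -1ℤ) :0 x :2 (con -1ℤ) y :2 z w :- :5)
          :+ :3 :* (x :+ :2 :* y :+ :3 :* z :+ k :* :2) :* (x :+ :2 :* y :+ :3 :* z :- k :* :2)) refl x y z w k))
        where
        q = + 2 * w + + 4 * y * y + + 12 * z * z + + 4 * x * y + + 8 * x * z + + 16 * y * z - + 6 * k * k

      frame : ∀ d → D₄ a b c d ≡ + 5 → A₄-Frame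
      frame d D₄≡5 = go (division f 4)
        where
        x = ⟨ a , d ⟩
        y = ⟨ b , d ⟩
        z = ⟨ c , d ⟩
        f = x + + 2 * y + + 3 * z
        even : ∀ k → f ≢ k * + 2
        even k = fit₃ x y z ⟨ d , d ⟩ k (trans (sym (D₄-value d refl refl refl)) D₄≡5)
        go : ∃[ k ] ∃[ r ] r ℕ.< 4 × f ≡ + r + k * + 4 → A₄-Frame
        go (k , 0 , _ , e) = contradiction (trans e (solve 1 (λ k → :0 :+ k :* :4 := k :* :2 :* :2) refl k)) (even (k * + 2))
        go (k , 1 , _ , e) = aim d k e D₄≡5
        go (k , 2 , _ , e) = contradiction (trans e (solve 1 (λ k → :2 :+ k :* :4 := (:1 :+ k :* :2) :* :2) refl k)) (even (1ℤ + k * + 2))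
        go (k , 3 , _ , e) = aim (d ⊖ + 2 · d) (- k - 1ℤ)
          (trans (cong₂ _+_ (cong₂ (λ p q → p + + 2 * q) (flipped a d) (flipped b d)) (cong (λ p → + 3 * p) (flipped c d)))
            (by₁ -1ℤ e (solve 4 (λ x y z k → :- x :+ :2 :* (:- y) :+ :3 :* (:- z) :- (:1 :+ (:- k :- :1) :* :4) :=
              con -1ℤ :* (x :+ :2 :* y :+ :3 :* z :- (:3 :+ k :* :4))) refl x y z k)))
          (trans (D₄-flip-d a b c d) D₄≡5)
        go (k , suc (suc (suc (suc _))) , ℕ.s≤s (ℕ.s≤s (ℕ.s≤s (ℕ.s≤s ()))) , _)

  -- The bounds leave only the leading minors 2, 3, 4 of A₄. As `81 · 4² > 256 · 5`, `y ≤ 3`; hence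
  -- `x ≤ 2`, and evenness gives `x = 2`, which forces `y = 3`. Finally `27 ≤ 8 z` and `3 z² ≤ 60`
  -- leave `z = 4`.
  determinant-5⇒A₄ : (∀ x → ∃[ h ] ⟨ x , x ⟩ ≡ + 2 * h) → Frame (+ 5) → A₄-Frame
  determinant-5⇒A₄ even F₀ = Stage₂⇒₃.frame stage-2 (Stage₂.d stage-2) (Stage₂.D₄≡5 stage-2)
    where
    0<5 : 0ℤ ℤ.< + 5
    0<5 = ℤ.+<+ (ℕ.s≤s ℕ.z≤n)
    F = proj₁ (reduce 0<5 F₀)
    open Frame F
    module M = Minors (minors 5 F (proj₂ (reduce 0<5 F₀)))
    y≤3 : M.y ℕ.≤ 3
    y≤3 = square-≤⇒≤ 81 1280 3 M.y M.y-bound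
    x≤2 : M.x ℕ.≤ 2
    x≤2 = square-≤⇒≤ 3 12 2 M.x (ℕ.≤-trans M.h₁ (ℕ.*-monoʳ-≤ 4 y≤3))
    z≤4 : M.z ℕ.≤ 4
    z≤4 = square-≤⇒≤ 3 60 4 M.z (ℕ.≤-trans M.h₃ (ℕ.*-monoʳ-≤ 4 (ℕ.*-monoˡ-≤ 5 y≤3)))
    x≢1 : M.x ≢ 1
    x≢1 x≡1 = not-multiple 2 1 (proj₁ (even a)) (trans (ℤ.*-comm (proj₁ (even a)) (+ 2)) (trans (sym (proj₂ (even a))) (trans M.D₁≡ (cong +_ x≡1))))
    x≡2 : M.x ≡ 2
    x≡2 = ℕ.≤-antisym x≤2 (ℕ.≤∧≢⇒< M.0<x (λ e → x≢1 (sym e)))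
    y≡3 : M.y ≡ 3
    y≡3 = ℕ.≤-antisym y≤3 (ℕ.*-cancelˡ-≤ 4 (subst (λ x → 3 ℕ.* (x ℕ.* x) ℕ.≤ 4 ℕ.* M.y) x≡2 M.h₁))
    z≡4 : M.z ≡ 4
    z≡4 = ℕ.≤-antisym z≤4 (ℕ.*-cancelˡ-< 8 3 M.z (ℕ.≤-trans (ℕ.m≤n+m 25 2) (subst (27 ℕ.≤_) (sym (ℕ.*-assoc 4 2 M.z))
      (subst₂ (λ x y → 3 ℕ.* (y ℕ.* y) ℕ.≤ 4 ℕ.* (x ℕ.* M.z)) x≡2 y≡3 M.h₂))))
    stage-1 : Stage₁
    stage-1 = stage₁ a b c d (trans M.D₁≡ (cong +_ x≡2)) (trans M.D₂≡ (cong +_ y≡3)) (trans M.D₃≡ (cong +_ z≡4)) D₄≡D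
    stage-2 : Stage₂
    stage-2 = Stage₁⇒₂.stage₂ S.a S.b S.d S.aa S.ab S.bb S.c S.D₃≡4 S.D₄≡5
      where module S = Stage₁ stage-1

-- Linear algebra over ℤ

Vector : ℕ → Set
Vector n = Fin n → ℤ

Matrix : ℕ → ℕ → Set
Matrix m n = Fin m → Fin n → ℤ

Σ-cong : ∀ n {f g : Vector n} → (∀ i → f i ≡ g i) → Σℤ n f ≡ Σℤ n g
Σ-cong zero    h = refl
Σ-cong (suc n) h = cong₂ _+_ (h zero) (Σ-cong n (λ i → h (suc i)))

Σ-0 : ∀ n → Σℤ n (λ _ → 0ℤ) ≡ 0ℤ
Σ-0 zero    = refl
Σ-0 (suc n) = trans (ℤ.+-identityˡ _) (Σ-0 n)

Σ-linear : ∀ n a b (f g : Vector n) → Σℤ n (λ i → a * f i + b * g i) ≡ a * Σℤ n f + b * Σℤ n g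
Σ-linear zero    a b f g = solve 2 (λ a b → :0 := a :* :0 :+ b :* :0) refl a b
Σ-linear (suc n) a b f g = trans (cong (λ z → a * f zero + b * g zero + z) (Σ-linear n a b (λ i → f (suc i)) (λ i → g (suc i))))
  (solve 6 (λ a b f g s t → a :* f :+ b :* g :+ (a :* s :+ b :* t) := a :* (f :+ s) :+ b :* (g :+ t)) refl
    a b (f zero) (g zero) (Σℤ n (λ i → f (suc i))) (Σℤ n (λ i → g (suc i))))

Σ-+ : ∀ n (f g : Vector n) → Σℤ n (λ i → f i + g i) ≡ Σℤ n f + Σℤ n g
Σ-+ n f g = trans (Σ-cong n (λ i → sym (cong₂ _+_ (ℤ.*-identityˡ (f i)) (ℤ.*-identityˡ (g i)))))
  (trans (Σ-linear n 1ℤ 1ℤ f g) (cong₂ _+_ (ℤ.*-identityˡ (Σℤ n f)) (ℤ.*-identityˡ (Σℤ n g))))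

Σ-* : ∀ n a (f : Vector n) → Σℤ n (λ i → a * f i) ≡ a * Σℤ n f
Σ-* n a f = trans (Σ-cong n (λ i → sym (ℤ.+-identityʳ (a * f i)))) (trans (Σ-linear n a 0ℤ f f) (ℤ.+-identityʳ _))

Σ-swap : ∀ m n (f : Matrix m n) → Σℤ m (λ i → Σℤ n (f i)) ≡ Σℤ n (λ j → Σℤ m (λ i → f i j))
Σ-swap zero    n f = sym (Σ-0 n)
Σ-swap (suc m) n f = trans (cong (λ z → Σℤ n (f zero) + z) (Σ-swap m n (λ i → f (suc i))))
  (sym (Σ-+ n (f zero) (λ j → Σℤ m (λ i → f (suc i) j))))

dot : ∀ {n} → Vector n → Vector n → ℤ
dot {n} x y = Σℤ n (λ k → x k * y k)

mv : ∀ {m n} → Matrix m n → Vector n → Vector m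
mv M x i = dot (M i) x

transpose : ∀ {m n} → Matrix m n → Matrix n m
transpose M i j = M j i

dot-congˡ : ∀ {n} {x x′ : Vector n} y → (∀ i → x i ≡ x′ i) → dot x y ≡ dot x′ y
dot-congˡ {n} y h = Σ-cong n (λ i → cong (_* y i) (h i))

dot-congʳ : ∀ {n} x {y y′ : Vector n} → (∀ i → y i ≡ y′ i) → dot x y ≡ dot x y′
dot-congʳ {n} x h = Σ-cong n (λ i → cong (x i *_) (h i))

dot-comm : ∀ {n} (x y : Vector n) → dot x y ≡ dot y x
dot-comm {n} x y = Σ-cong n (λ i → ℤ.*-comm (x i) (y i))

dot-linearˡ : ∀ {n} a b (x y z : Vector n) → dot (λ i → a * x i + b * y i) z ≡ a * dot x z + b * dot y z
dot-linearˡ {n} a b x y z = trans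
  (Σ-cong n (λ i → solve 5 (λ a b x y z → (a :* x :+ b :* y) :* z := a :* (x :* z) :+ b :* (y :* z)) refl a b (x i) (y i) (z i)))
  (Σ-linear n a b (λ i → x i * z i) (λ i → y i * z i))

dot-*ˡ : ∀ {n} a (x y : Vector n) → dot (λ i → a * x i) y ≡ a * dot x y
dot-*ˡ {n} a x y = trans (Σ-cong n (λ i → ℤ.*-assoc a (x i) (y i))) (Σ-* n a (λ i → x i * y i))

dot-*ʳ : ∀ {n} a (x y : Vector n) → dot x (λ i → a * y i) ≡ a * dot x y
dot-*ʳ a x y = trans (dot-comm x _) (trans (dot-*ˡ a y x) (cong (a *_) (dot-comm y x)))

adjoint : ∀ {m n} (M : Matrix m n) x y → dot (mv M x) y ≡ dot x (mv (transpose M) y)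
adjoint {m} {n} M x y = begin
  Σℤ m (λ i → Σℤ n (λ j → M i j * x j) * y i)     ≡⟨ Σ-cong m (λ i → trans (ℤ.*-comm _ (y i)) (sym (Σ-* n (y i) (λ j → M i j * x j)))) ⟩
  Σℤ m (λ i → Σℤ n (λ j → y i * (M i j * x j)))   ≡⟨ Σ-swap m n (λ i j → y i * (M i j * x j)) ⟩
  Σℤ n (λ j → Σℤ m (λ i → y i * (M i j * x j)))   ≡⟨ Σ-cong n (λ j → trans (Σ-cong m (λ i → rearrange (y i) (M i j) (x j))) (Σ-* m (x j) (λ i → M i j * y i))) ⟩
  Σℤ n (λ j → x j * Σℤ m (λ i → M i j * y i))     ∎
  where
  open ≡-Reasoning
  rearrange : ∀ y m x → y * (m * x) ≡ x * (m * y)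
  rearrange = solve 3 (λ y m x → y :* (m :* x) := x :* (m :* y)) refl

-- Written as this double sum so that `imageGram G M i j` is, by definition, the form on two columns
-- of `M`.
form : ∀ {n} → Gram n → Vector n → Vector n → ℤ
form {n} G x y = Σℤ n (λ k → Σℤ n (λ l → x k * G k l * y l))

form-dot : ∀ {n} (G : Gram n) x y → form G x y ≡ dot x (mv G y)
form-dot {n} G x y = Σ-cong n (λ k → trans (Σ-cong n (λ l → ℤ.*-assoc (x k) (G k l) (y l))) (Σ-* n (x k) (λ l → G k l * y l)))

form-cong : ∀ {n} (G : Gram n) {x x′ y y′} → (∀ i → x i ≡ x′ i) → (∀ i → y i ≡ y′ i) → form G x y ≡ form G x′ y′
form-cong {n} G h h′ = Σ-cong n (λ k → Σ-cong n (λ l → cong₂ (λ a b → a * G k l * b) (h k) (h′ l)))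

Symmetric : ∀ {n} → Gram n → Set
Symmetric G = ∀ i j → G i j ≡ G j i

form-comm : ∀ {n} (G : Gram n) → Symmetric G → ∀ x y → form G x y ≡ form G y x
form-comm G sym-G x y = begin
  form G x y                   ≡⟨ form-dot G x y ⟩
  dot x (mv G y)               ≡⟨ dot-comm x (mv G y) ⟩
  dot (mv G y) x               ≡⟨ adjoint G y x ⟩
  dot y (mv (transpose G) x)   ≡⟨ dot-congʳ y (λ i → dot-congˡ x (λ j → sym-G j i)) ⟩
  dot y (mv G x)               ≡⟨ form-dot G y x ⟨
  form G y x                   ∎
  where open ≡-Reasoning

form-linear : ∀ {n} (G : Gram n) x m y z → form G (λ i → x i - m * y i) z ≡ form G x z - m * form G y z
form-linear G x m y z = begin
  form G (λ i → x i - m * y i) z                     ≡⟨ form-dot G (λ i → x i - m * y i) z ⟩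
  dot (λ i → x i - m * y i) (mv G z)                 ≡⟨ dot-congˡ (mv G z) (λ i → solve 3 (λ x m y → x :- m :* y := :1 :* x :+ (:- m) :* y) refl (x i) m (y i)) ⟩
  dot (λ i → 1ℤ * x i + (- m) * y i) (mv G z)        ≡⟨ dot-linearˡ 1ℤ (- m) x y (mv G z) ⟩
  1ℤ * dot x (mv G z) + (- m) * dot y (mv G z)       ≡⟨ cong₂ (λ p q → 1ℤ * p + (- m) * q) (form-dot G x z) (form-dot G y z) ⟨
  1ℤ * form G x z + (- m) * form G y z               ≡⟨ solve 3 (λ x m y → :1 :* x :+ (:- m) :* y := x :- m :* y) refl (form G x z) m (form G y z) ⟩
  form G x z - m * form G y z                        ∎
  where open ≡-Reasoning

space : ∀ {n} (G : Gram n) → Symmetric G → BilinearSpace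
space {n} G sym-G = record
  { X = Vector n
  ; _⊖_·_ = λ x m y i → x i - m * y i
  ; ⟨_,_⟩ = form G
  ; comm = form-comm G sym-G
  ; linear = form-linear G
  }

form-mv : ∀ {m n} (G : Gram m) (H : Gram n) (M : Matrix m n) c →
          (∀ i j → form G (λ k → M k i) (λ l → M l j) ≡ c * H i j) →
          ∀ x y → form G (mv M x) (mv M y) ≡ c * form H x y
form-mv G H M c h x y = begin
  form G (mv M x) (mv M y)                                ≡⟨ form-dot G (mv M x) (mv M y) ⟩
  dot (mv M x) (mv G (mv M y))                            ≡⟨ adjoint M x (mv G (mv M y)) ⟩
  dot x (λ i → dot (λ k → M k i) (mv G (mv M y)))         ≡⟨ dot-congʳ x inner ⟩
  dot x (λ i → c * dot (H i) y)                           ≡⟨ dot-*ʳ c x (mv H y) ⟩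
  c * dot x (mv H y)                                      ≡⟨ cong (c *_) (form-dot H x y) ⟨
  c * form H x y                                          ∎
  where
  open ≡-Reasoning
  inner : ∀ i → dot (λ k → M k i) (mv G (mv M y)) ≡ c * dot (H i) y
  inner i = begin
    dot (λ k → M k i) (mv G (mv M y))                           ≡⟨ adjointʳ G (λ k → M k i) (mv M y) ⟩
    dot (mv M y) (mv (transpose G) (λ k → M k i))               ≡⟨ adjoint M y (mv (transpose G) (λ k → M k i)) ⟩
    dot y (λ j → dot (λ l → M l j) (mv (transpose G) (λ k → M k i)))  ≡⟨ dot-congʳ y (λ j → trans (sym (adjointʳ G (λ k → M k i) (λ l → M l j))) (trans (sym (form-dot G (λ k → M k i) (λ l → M l j))) (h i j))) ⟩
    dot y (λ j → c * H i j)                                     ≡⟨ dot-*ʳ c y (H i) ⟩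
    c * dot y (H i)                                             ≡⟨ cong (c *_) (dot-comm y (H i)) ⟩
    c * dot (H i) y                                             ∎
    where
    adjointʳ : ∀ {n} (G : Gram n) u v → dot u (mv G v) ≡ dot v (mv (transpose G) u)
    adjointʳ G u v = trans (dot-comm u (mv G v)) (adjoint G v u)

unit : ∀ {n} → Fin n → Vector n
unit zero    zero    = 1ℤ
unit zero    (suc _) = 0ℤ
unit (suc _) zero    = 0ℤ
unit (suc i) (suc j) = unit i j

dot-unit : ∀ {n} i (x : Vector n) → dot (unit i) x ≡ x i
dot-unit {suc n} zero    x = trans (cong₂ _+_ (ℤ.*-identityˡ (x zero)) (trans (Σ-cong n (λ i → ℤ.*-zeroˡ (x (suc i)))) (Σ-0 n))) (ℤ.+-identityʳ (x zero))
dot-unit {suc n} (suc i) x = trans (ℤ.+-identityˡ (dot (unit i) (λ j → x (suc j)))) (dot-unit i (λ j → x (suc j)))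

form-unit : ∀ {n} (G : Gram n) i j → form G (unit i) (unit j) ≡ G i j
form-unit G i j = trans (form-dot G (unit i) (unit j)) (trans (dot-unit i (mv G (unit j))) (trans (dot-comm (G i) (unit j)) (dot-unit j (G i))))

-- In each equation Aᵢ·t = ± d tᵢ the sign is chosen so that tᵢ can be eliminated.
eliminate : ∀ k d → d ≢ 0ℤ → (A : Matrix k (suc k)) →
            ∃[ t ] t (fromℕ k) ≢ 0ℤ × (∀ i → dot (A i) t * dot (A i) t ≡ (d * t (inject₁ i)) * (d * t (inject₁ i)))
eliminate zero    d d≢0 A = (λ _ → 1ℤ) , (λ ()) , λ ()
eliminate (suc k) d d≢0 A = case d ℤ.≟ a of λ where
    (no d≢a)  → extend 1ℤ refl (λ e → d≢a (trans (sym (ℤ.*-identityˡ d)) (ℤ.i-j≡0⇒i≡j (1ℤ * d) a e)))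
    (yes d≡a) → extend -1ℤ refl λ e → d≢0 (case ℤ.i*j≡0⇒i≡0∨j≡0 (+ 2) (by₂ -1ℤ 1ℤ e d≡a
      (solve 2 (λ d a → :2 :* d :- :0 := con -1ℤ :* (con -1ℤ :* d :- a :- :0) :+ :1 :* (d :- a)) refl d a)) of λ where
        (inj₂ d≡0) → d≡0)
  where
  a = A zero zero
  A₀ : Vector (suc k)
  A₀ j = A zero (suc j)
  extend : ∀ ε → ε * ε ≡ 1ℤ → ε * d - a ≢ 0ℤ →
           ∃[ t ] t (fromℕ (suc k)) ≢ 0ℤ × (∀ i → dot (A i) t * dot (A i) t ≡ (d * t (inject₁ i)) * (d * t (inject₁ i)))
  extend ε ε²≡1 e≢0 = t , last≢0 , equation
    where
    -- Solving `a t₀ + A₀ · t′ = ε d t₀` gives `t₀ = (A₀ · t′) / e`. To stay in ℤ the other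
    -- coordinates are multiplied by `e` instead, which turns `d` into `e d` in the remaining
    -- equations.
    e = ε * d - a
    A′ : Matrix k (suc k)
    A′ i j = A (suc i) zero * A₀ j + e * A (suc i) (suc j)
    rec = eliminate k (e * d) (λ h → case ℤ.i*j≡0⇒i≡0∨j≡0 e h of λ { (inj₁ e≡0) → e≢0 e≡0 ; (inj₂ d≡0) → d≢0 d≡0 }) A′
    t′ = proj₁ rec
    t : Vector (suc (suc k))
    t zero    = dot A₀ t′
    t (suc j) = e * t′ j
    last≢0 : e * t′ (fromℕ k) ≢ 0ℤ
    last≢0 h = case ℤ.i*j≡0⇒i≡0∨j≡0 e h of λ { (inj₁ e≡0) → e≢0 e≡0 ; (inj₂ z) → proj₁ (proj₂ rec) z }
    equation : ∀ i → dot (A i) t * dot (A i) t ≡ (d * t (inject₁ i)) * (d * t (inject₁ i))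
    equation zero = trans (cong (λ z → z * z) (cong (λ z → a * dot A₀ t′ + z) (dot-*ʳ e A₀ t′)))
      (by₁ (d * r * (d * r)) ε²≡1 (solve 4 (λ a r ε d → (a :* r :+ (ε :* d :- a) :* r) :* (a :* r :+ (ε :* d :- a) :* r) :- d :* r :* (d :* r)
        := d :* r :* (d :* r) :* (ε :* ε :- :1)) refl a r ε d))
      where r = dot A₀ t′
    equation (suc i) = trans (cong (λ z → z * z)
        (trans (cong (λ z → A (suc i) zero * dot A₀ t′ + z) (dot-*ʳ e (λ j → A (suc i) (suc j)) t′))
          (sym (dot-linearˡ (A (suc i) zero) e A₀ (λ j → A (suc i) (suc j)) t′))))
      (trans (proj₂ (proj₂ rec) i) (solve 3 (λ e d t → e :* d :* t :* (e :* d :* t) := d :* (e :* t) :* (d :* (e :* t))) refl e d (t′ (inject₁ i))))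

:Σ : ∀ {m} n → (Fin n → Polynomial m) → Polynomial m
:Σ zero    f = :0
:Σ (suc n) f = f zero :+ :Σ n (λ i → f (suc i))

:form : ∀ {m n} → (Fin n → Fin n → Polynomial m) → (Fin n → Polynomial m) → (Fin n → Polynomial m) → Polynomial m
:form {n = n} G x y = :Σ n (λ k → :Σ n (λ l → x k :* G k l :* y l))

module _ {A : Set} where
  symmetric₄ : A → A → A → A → A → A → A → A → A → A → Fin 4 → Fin 4 → A
  symmetric₄ aa ab ac ad bb bc bd cc cd dd i j = lookup (lookup rows i) j
    where
    rows : Vec (Vec A 4) 4
    rows = (aa ∷ ab ∷ ac ∷ ad ∷ []) ∷ (ab ∷ bb ∷ bc ∷ bd ∷ []) ∷ (ac ∷ bc ∷ cc ∷ cd ∷ []) ∷ (ad ∷ bd ∷ cd ∷ dd ∷ []) ∷ []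

pattern #0 = zero
pattern #1 = suc zero
pattern #2 = suc (suc zero)
pattern #3 = suc (suc (suc zero))

symmetric₄-symmetric : ∀ aa ab ac ad bb bc bd cc cd dd → Symmetric (symmetric₄ aa ab ac ad bb bc bd cc cd dd)
symmetric₄-symmetric aa ab ac ad bb bc bd cc cd dd = go
  where
  go : Symmetric (symmetric₄ aa ab ac ad bb bc bd cc cd dd)
  go #0 #0 = refl
  go #0 #1 = refl
  go #0 #2 = refl
  go #0 #3 = refl
  go #1 #0 = refl
  go #1 #1 = refl
  go #1 #2 = refl
  go #1 #3 = refl
  go #2 #0 = refl
  go #2 #1 = refl
  go #2 #2 = refl
  go #2 #3 = refl
  go #3 #0 = refl
  go #3 #1 = refl
  go #3 #2 = refl
  go #3 #3 = refl

unit-frame : ∀ D aa ab ac ad bb bc bd cc cd dd → 0ℤ ℤ.< aa → 0ℤ ℤ.< det2 aa ab bb → 0ℤ ℤ.< det3 aa ab ac bb bc cc →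
             det4 aa ab ac ad bb bc bd cc cd dd ≡ D →
             Reduction.Frame (space (symmetric₄ aa ab ac ad bb bc bd cc cd dd) (symmetric₄-symmetric aa ab ac ad bb bc bd cc cd dd)) D
unit-frame D aa ab ac ad bb bc bd cc cd dd h₁ h₂ h₃ h₄ = record
  { a = unit #0 ; b = unit #1 ; c = unit #2 ; d = unit #3
  ; 0<D₁ = subst (0ℤ ℤ.<_) (sym (u #0 #0)) h₁
  ; 0<D₂ = subst (0ℤ ℤ.<_) (sym D₂≡) h₂
  ; 0<D₃ = subst (0ℤ ℤ.<_) (sym D₃≡) h₃
  ; D₄≡D = trans D₄≡ h₄
  }
  where
  G = symmetric₄ aa ab ac ad bb bc bd cc cd dd
  open Reduction (space G (symmetric₄-symmetric aa ab ac ad bb bc bd cc cd dd))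
  u : ∀ i j → form G (unit i) (unit j) ≡ G i j
  u = form-unit G
  D₂≡ : D₂ (unit #0) (unit #1) ≡ det2 aa ab bb
  D₂≡ = cong₃ det2 (u #0 #0) (u #0 #1) (u #1 #1)
  D₃≡ : D₃ (unit #0) (unit #1) (unit #2) ≡ det3 aa ab ac bb bc cc
  D₃≡ = cong₆ det3 (u #0 #0) (u #0 #1) (u #0 #2) (u #1 #1) (u #1 #2) (u #2 #2)
  D₄≡ : D₄ (unit #0) (unit #1) (unit #2) (unit #3) ≡ det4 aa ab ac ad bb bc bd cc cd dd
  D₄≡ = cong₁₀ det4 (u #0 #0) (u #0 #1) (u #0 #2) (u #0 #3) (u #1 #1) (u #1 #2) (u #1 #3) (u #2 #2) (u #2 #3) (u #3 #3)

-- Sums of four squares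

module _ {p : ℕ} (p-prime : Prime p) where
  open ModPrime p-prime

  private
    module Odd (q : ℕ) (p≡ : p ≡ suc (q ℕ.+ q)) where
      square-injective : ∀ {x y} → x ℕ.≤ q → y ℕ.≤ q → + x * + x ≈ + y * + y → x ≡ y
      square-injective {x} {y} x≤q y≤q h = case euclid (+ x - + y) (+ x + + y) factored of λ where
          (inj₁ d) → <∧≈⇒≡ (small x≤q) (small y≤q) (congruent (≈0⇒∣ d))
          (inj₂ d) → zero-sum (<∧≈⇒≡ sum< (small ℕ.z≤n) d)
        where
        factored : (+ x - + y) * (+ x + + y) ≈ 0ℤ
        factored = ≈-by₁ 1ℤ h (solve 2 (λ x y → (x :- y) :* (x :+ y) :- :0 := :1 :* (x :* x :- y :* y)) refl (+ x) (+ y))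
        sum< : x ℕ.+ y ℕ.< p
        sum< = subst (x ℕ.+ y ℕ.<_) (sym p≡) (ℕ.s≤s (ℕ.+-mono-≤ x≤q y≤q))
        small : ∀ {x} → x ℕ.≤ q → x ℕ.< p
        small x≤q = subst (_ ℕ.<_) (sym p≡) (ℕ.s≤s (ℕ.≤-trans x≤q (ℕ.m≤m+n q q)))
        zero-sum : x ℕ.+ y ≡ 0 → x ≡ y
        zero-sum e = trans (ℕ.m+n≡0⇒m≡0 x e) (sym (ℕ.m+n≡0⇒n≡0 x e))

      residue : ℤ → Fin p
      residue a = fromℕ< (ℤ.n%ℕd<d a p)

      residue-≈ : ∀ {a b} → residue a ≡ residue b → a ≈ b
      residue-≈ {a} {b} e = ≈-trans (≈-sym (%ℕ-≈ a)) (≈-trans (≡⇒≈ (cong +_ (fromℕ<-injective (a %ℕ p) (b %ℕ p) (ℤ.n%ℕd<d a p) (ℤ.n%ℕd<d b p) e))) (%ℕ-≈ b))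

      -- The q + 1 squares x² and the q + 1 numbers - 1 - y² cannot all be distinct modulo p = 2q + 1.
      value : Fin (suc q) ⊎ Fin (suc q) → ℤ
      value (inj₁ i) = + toℕ i * + toℕ i
      value (inj₂ j) = -1ℤ - + toℕ j * + toℕ j

      collide : ∀ u v → u ≢ v → value u ≈ value v → ∃[ a ] ∃[ b ] 1ℤ + a * a + b * b ≈ 0ℤ
      collide (inj₁ i) (inj₁ j) u≢v h = contradiction (cong inj₁ (toℕ-injective (square-injective (ℕ.s≤s⁻¹ (toℕ<n i)) (ℕ.s≤s⁻¹ (toℕ<n j)) h))) u≢v
      collide (inj₁ i) (inj₂ j) u≢v h = + toℕ i , + toℕ j , ≈-by₁ 1ℤ h
        (solve 2 (λ x y → :1 :+ x :* x :+ y :* y :- :0 := :1 :* (x :* x :- (con -1ℤ :- y :* y))) refl (+ toℕ i) (+ toℕ j))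
      collide (inj₂ i) (inj₁ j) u≢v h = + toℕ i , + toℕ j , ≈-by₁ -1ℤ h
        (solve 2 (λ x y → :1 :+ x :* x :+ y :* y :- :0 := con -1ℤ :* (con -1ℤ :- x :* x :- y :* y)) refl (+ toℕ i) (+ toℕ j))
      collide (inj₂ i) (inj₂ j) u≢v h = contradiction (cong inj₂ (toℕ-injective (square-injective (ℕ.s≤s⁻¹ (toℕ<n i)) (ℕ.s≤s⁻¹ (toℕ<n j))
        (≈-by₁ -1ℤ h (solve 2 (λ x y → x :* x :- y :* y := con -1ℤ :* (con -1ℤ :- x :* x :- (con -1ℤ :- y :* y))) refl (+ toℕ i) (+ toℕ j)))))) u≢v

      split : Fin (suc q ℕ.+ suc q) → Fin (suc q) ⊎ Fin (suc q)
      split = splitAt (suc q)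

      solution : ∃[ a ] ∃[ b ] 1ℤ + a * a + b * b ≈ 0ℤ
      solution = found (pigeonhole p<2q+2 (λ i → residue (value (split i))))
        where
        p<2q+2 : p ℕ.< suc q ℕ.+ suc q
        p<2q+2 = ℕ.s≤s (ℕ.≤-reflexive (trans p≡ (sym (ℕ.+-suc q q))))
        found : (∃[ i ] ∃[ j ] i Fin.< j × residue (value (split i)) ≡ residue (value (split j))) → ∃[ a ] ∃[ b ] 1ℤ + a * a + b * b ≈ 0ℤ
        found (i , j , i<j , e) = collide (split i) (split j) (λ e′ → ℕ.<⇒≢ i<j (cong toℕ
          (trans (sym (join-splitAt (suc q) (suc q) i)) (trans (cong (join (suc q) (suc q)) e′) (join-splitAt (suc q) (suc q) j))))) (residue-≈ e)

  1+a²+b²≈0 : ∃[ a ] ∃[ b ] 1ℤ + a * a + b * b ≈ 0ℤ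
  1+a²+b²≈0 = go (p ℕ.% 2) refl (ℕ.m%n<n p 2)
    where
    go : ∀ r → p ℕ.% 2 ≡ r → r ℕ.< 2 → ∃[ a ] ∃[ b ] 1ℤ + a * a + b * b ≈ 0ℤ
    go 0 h _ = 1ℤ , 0ℤ , ∣⇒≈0 (∣ᵤ⇒∣ (subst (ℕ._∣ 2) (sym (∣prime⇒≡ 2 p-prime (ℕ.m%n≡0⇒n∣m p 2 h))) ℕ.∣-refl))
    go 1 h _ = Odd.solution (p ℕ./ 2) (trans (ℕ.m≡m%n+[m/n]*n p 2) (cong₂ ℕ._+_ h (trans (ℕ.*-comm (p ℕ./ 2) 2) (cong (p ℕ./ 2 ℕ.+_) (ℕ.+-identityʳ _)))))
    go (suc (suc _)) _ (ℕ.s≤s (ℕ.s≤s ()))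

FourSquares : ℕ → Set
FourSquares n = ∃[ a ] ∃[ b ] ∃[ c ] ∃[ d ] a * a + b * b + c * c + d * d ≡ + n

fourSquares-1 : FourSquares 1
fourSquares-1 = 1ℤ , 0ℤ , 0ℤ , 0ℤ , refl

-- Euler's identity, the multiplicativity of the quaternion norm.
fourSquares-* : ∀ m n → FourSquares m → FourSquares n → FourSquares (m ℕ.* n)
fourSquares-* m n (a , b , c , d , h) (a′ , b′ , c′ , d′ , h′) =
  a * a′ - b * b′ - c * c′ - d * d′ , a * b′ + b * a′ + c * d′ - d * c′ , a * c′ - b * d′ + c * a′ + d * b′ , a * d′ + b * c′ - c * b′ + d * a′ ,
  trans (solve 8 (λ a b c d a′ b′ c′ d′ →
    let w = a :* a′ :- b :* b′ :- c :* c′ :- d :* d′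
        x = a :* b′ :+ b :* a′ :+ c :* d′ :- d :* c′
        y = a :* c′ :- b :* d′ :+ c :* a′ :+ d :* b′
        z = a :* d′ :+ b :* c′ :- c :* b′ :+ d :* a′
    in w :* w :+ x :* x :+ y :* y :+ z :* z := (a :* a :+ b :* b :+ c :* c :+ d :* d) :* (a′ :* a′ :+ b′ :* b′ :+ c′ :* c′ :+ d′ :* d′))
    refl a b c d a′ b′ c′ d′) (trans (cong₂ _*_ h h′) (sym (ℤ.pos-* m n)))

-- The lattice { (w, z) ∈ ℤ² × ℤ² : z ≡ w (a + b i) mod n }, scaled by 1/n, is unimodular when n ∣ 1 + a² + b².
module IsotropicLattice (n : ℕ) .{{_ : ℕ.NonZero n}} (a b k : ℤ) (h : 1ℤ + a * a + b * b ≡ k * + n) where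
  0<n : 0ℤ ℤ.< + n
  0<n = ℤ.+<+ (ℕ.>-nonZero⁻¹ n)
  P : ℤ
  P = + n
  D₂>0 : 0ℤ ℤ.< det2 P 0ℤ P
  D₂>0 = subst (0ℤ ℤ.<_) (solve 1 (λ p → p :* p := :D.det2 p :0 p) refl P) (0<* 0<n 0<n)
  D₃>0 : 0ℤ ℤ.< det3 P 0ℤ a P b k
  D₃>0 = subst (0ℤ ℤ.<_) (by₁ P h (solve 4 (λ p a b k → p :- :D.det3 p :0 a p b k := p :* (:1 :+ a :* a :+ b :* b :- k :* p)) refl P a b k)) 0<n
  D₄≡1 : det4 P 0ℤ a (- b) P b a k 0ℤ k ≡ 1ℤ
  D₄≡1 = by₁ (- (k * P - a * a - b * b + 1ℤ)) h (solve 4 (λ p a b k → :D.det4 p :0 a (:- b) p b a k :0 k :- :1 :=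
    (:- (k :* p :- a :* a :- b :* b :+ :1)) :* (:1 :+ a :* a :+ b :* b :- k :* p)) refl P a b k)
  form-expand : ∀ u → form (symmetric₄ P 0ℤ a (- b) P b a k 0ℤ k) u u ≡
    (P * u #0 + a * u #2 - b * u #3) * u #0 + (P * u #1 + b * u #2 + a * u #3) * u #1
    + (a * u #0 + b * u #1 + k * u #2) * u #2 + (a * u #1 - b * u #0 + k * u #3) * u #3
  form-expand u = solve 8 (λ p a b k u₀ u₁ u₂ u₃ →
    let u = λ i → lookup (u₀ ∷ u₁ ∷ u₂ ∷ u₃ ∷ []) i in
    :form (symmetric₄ p :0 a (:- b) p b a k :0 k) u u :=
    (p :* u₀ :+ a :* u₂ :- b :* u₃) :* u₀ :+ (p :* u₁ :+ b :* u₂ :+ a :* u₃) :* u₁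
    :+ (a :* u₀ :+ b :* u₁ :+ k :* u₂) :* u₂ :+ (a :* u₁ :- b :* u₀ :+ k :* u₃) :* u₃) refl P a b k (u #0) (u #1) (u #2) (u #3)
  -- A vector of norm 1 has norm `n` before scaling. The witnesses are the real coordinates of the
  -- combination with coefficients `u` of `(0 , n)`, `(0 , n i)`, `(1 , a + b i)` and
  -- `(i , - b + a i)`, the basis to which the Gram matrix belongs.
  four-squares : (∃[ u ] form (symmetric₄ P 0ℤ a (- b) P b a k 0ℤ k) u u ≡ 1ℤ) → FourSquares n
  four-squares (u , unit-norm) = u #2 , u #3 , P * u #0 + a * u #2 - b * u #3 , P * u #1 + b * u #2 + a * u #3 ,
    by₂ (u #2 * u #2 + u #3 * u #3) P h (trans (sym (form-expand u)) unit-norm) (solve 8 (λ p a b k u₀ u₁ u₂ u₃ →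
      let y = p :* u₀ :+ a :* u₂ :- b :* u₃
          z = p :* u₁ :+ b :* u₂ :+ a :* u₃
      in u₂ :* u₂ :+ u₃ :* u₃ :+ y :* y :+ z :* z :- p :=
        (u₂ :* u₂ :+ u₃ :* u₃) :* (:1 :+ a :* a :+ b :* b :- k :* p)
        :+ p :* (y :* u₀ :+ z :* u₁ :+ (a :* u₀ :+ b :* u₁ :+ k :* u₂) :* u₂ :+ (a :* u₁ :- b :* u₀ :+ k :* u₃) :* u₃ :- :1))
      refl P a b k (u #0) (u #1) (u #2) (u #3))
  frame : Reduction.Frame (space (symmetric₄ P 0ℤ a (- b) P b a k 0ℤ k) (symmetric₄-symmetric P 0ℤ a (- b) P b a k 0ℤ k)) 1ℤ
  frame = unit-frame 1ℤ P 0ℤ a (- b) P b a k 0ℤ k 0<n D₂>0 D₃>0 D₄≡1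
  solution : FourSquares n
  solution = four-squares (Small-Determinant.unimodular⇒unit-vector (space (symmetric₄ P 0ℤ a (- b) P b a k 0ℤ k) (symmetric₄-symmetric P 0ℤ a (- b) P b a k 0ℤ k)) frame)
fourSquares-prime : ∀ {p} → Prime p → FourSquares p
fourSquares-prime {p} p-prime = lattice (1+a²+b²≈0 p-prime)
  where
  open ModPrime p-prime
  lattice : (∃[ a ] ∃[ b ] 1ℤ + a * a + b * b ≈ 0ℤ) → FourSquares p
  lattice (a , b , h) = IsotropicLattice.solution p a b (Signed.quotient (≈0⇒∣ h)) (Signed._∣_.equality (≈0⇒∣ h))

fourSquares : ∀ n .{{_ : ℕ.NonZero n}} → FourSquares n
fourSquares n = Generate.generate {I = λ _ → ⊥} (λ _ → no λ ()) FourSquares fourSquares-1 (λ _ _ _ ())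
  (λ p c p-prime _ h → fourSquares-* c p h (fourSquares-prime p-prime)) n (λ _ _ ())

-- Multipliers of A₄

form-scale : ∀ {n} (G : Gram n) a b x y → form G (λ i → a * x i) (λ i → b * y i) ≡ a * b * form G x y
form-scale G a b x y = begin
  form G (λ i → a * x i) (λ i → b * y i)        ≡⟨ form-dot G (λ i → a * x i) (λ i → b * y i) ⟩
  dot (λ i → a * x i) (mv G (λ i → b * y i))    ≡⟨ dot-*ˡ a x (mv G (λ i → b * y i)) ⟩
  a * dot x (mv G (λ i → b * y i))              ≡⟨ cong (a *_) (dot-congʳ x (λ i → dot-*ʳ b (G i) y)) ⟩
  a * dot x (λ i → b * mv G y i)                ≡⟨ cong (a *_) (dot-*ʳ b x (mv G y)) ⟩
  a * (b * dot x (mv G y))                      ≡⟨ ℤ.*-assoc a b _ ⟨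
  a * b * dot x (mv G y)                        ≡⟨ cong (a * b *_) (form-dot G x y) ⟨
  a * b * form G x y                            ∎
  where open ≡-Reasoning

multiplier-1 : ∀ {n} (G : Gram n) → HasMultiplier G 1
multiplier-1 G = (λ k j → unit j k) , λ i j → trans (form-unit G i j) (sym (ℤ.*-identityˡ (G i j)))

multiplier-* : ∀ {n} (G : Gram n) c c′ → HasMultiplier G c → HasMultiplier G c′ → HasMultiplier G (c ℕ.* c′)
multiplier-* G c c′ (M , h) (M′ , h′) = (λ k j → mv M (λ i → M′ i j) k) , λ i j →
  trans (form-mv G G M (+ c) h (λ k → M′ k i) (λ k → M′ k j))
    (trans (cong (+ c *_) (h′ i j)) (trans (sym (ℤ.*-assoc (+ c) (+ c′) (G i j))) (cong (_* G i j) (sym (ℤ.pos-* c c′)))))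

multiplier-p² : ∀ {n} (G : Gram n) c p → HasMultiplier G c → HasMultiplier G (c ℕ.* p ℕ.* p)
multiplier-p² G c p (M , h) = (λ k j → + p * M k j) , λ i j →
  trans (form-scale G (+ p) (+ p) (λ k → M k i) (λ k → M k j)) (trans (cong (+ p * + p *_) (h i j))
    (trans (solve 3 (λ p c g → p :* p :* (c :* g) := c :* p :* p :* g) refl (+ p) (+ c) (G i j))
      (cong (_* G i j) (trans (cong (_* + p) (sym (ℤ.pos-* c p))) (sym (ℤ.pos-* (c ℕ.* p) p))))))

A₄-symmetric : Symmetric A₄
A₄-symmetric = from-yes (all? λ i → all? λ j → A₄ i j ℤ.≟ A₄ j i)

vec : ∀ {A : Set} → A → A → A → A → Fin 4 → A
vec a b c d i = lookup (a ∷ b ∷ c ∷ d ∷ []) i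

-- In the coordinates of A₄ ⊂ ℤ⁵ with respect to the standard basis.
A₄-expand : ∀ x y → form A₄ x y ≡
  x #0 * y #0 + (x #1 - x #0) * (y #1 - y #0) + (x #2 - x #1) * (y #2 - y #1) + (x #3 - x #2) * (y #3 - y #2) + x #3 * y #3
A₄-expand x y = solve 8 (λ a b c d a′ b′ c′ d′ →
  :form (λ i j → con (A₄ i j)) (vec a b c d) (vec a′ b′ c′ d′) :=
  a :* a′ :+ (b :- a) :* (b′ :- a′) :+ (c :- b) :* (c′ :- b′) :+ (d :- c) :* (d′ :- c′) :+ d :* d′) refl
  (x #0) (x #1) (x #2) (x #3) (y #0) (y #1) (y #2) (y #3)

-- Up to a permutation of the coordinates of ℤ⁵, `M` is the circulant of the quadratic residue
-- symbols 0, 1, -1, -1, 1 modulo 5. With cyclic shifts as powers of `ζ`, a primitive fifth root of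
-- unity, it is multiplication by the Gauss sum `ζ - ζ² - ζ³ + ζ⁴ = √5`.
A₄-multiplier-5 : HasMultiplier A₄ 5
A₄-multiplier-5 = M , from-yes (all? λ i → all? λ j → imageGram A₄ M i j ℤ.≟ + 5 * A₄ i j)
  where
  M : Matrix 4 4
  M = fromRows ((-[1+ 1 ] ∷ 0ℤ  ∷ 1ℤ  ∷ 1ℤ  ∷ []) ∷
                (-[1+ 2 ] ∷ 1ℤ  ∷ -1ℤ ∷ 1ℤ  ∷ []) ∷
                (-[1+ 2 ] ∷ + 3 ∷ -1ℤ ∷ 0ℤ  ∷ []) ∷
                (-[1+ 1 ] ∷ 1ℤ  ∷ 1ℤ  ∷ -[1+ 1 ] ∷ []) ∷ [])

module _ (V : BilinearSpace) where
  open BilinearSpace V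
  open Small-Determinant V

  frame-vectors : A₄-Frame → Fin 4 → X
  frame-vectors F = vec a b c d
    where open A₄-Frame F

  frame-Gram : ∀ F i j → ⟨ frame-vectors F i , frame-vectors F j ⟩ ≡ A₄ i j
  frame-Gram F = go
    where
    open A₄-Frame F
    go : ∀ i j → ⟨ frame-vectors F i , frame-vectors F j ⟩ ≡ A₄ i j
    go #0 #0 = aa
    go #0 #1 = ab
    go #0 #2 = ac
    go #0 #3 = ad
    go #1 #0 = trans (comm b a) ab
    go #1 #1 = bb
    go #1 #2 = bc
    go #1 #3 = bd
    go #2 #0 = trans (comm c a) ac
    go #2 #1 = trans (comm c b) bc
    go #2 #2 = cc
    go #2 #3 = cd
    go #3 #0 = trans (comm d a) ad
    go #3 #1 = trans (comm d b) bd
    go #3 #2 = trans (comm d c) cd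
    go #3 #3 = dd

-- Let eᵢ ↦ eᵢ - e₅ identify ℤ⁴ with A₄. The vectors n e₃, n e₄, e₁ + α e₃ + β e₄, e₂ + γ e₃ + δ e₄ span a sublattice
-- on which the form is divisible by n; after division it is even of determinant 5, hence isometric to A₄.
module Sublattice (n : ℕ) .{{_ : ℕ.NonZero n}} (α β γ δ h₁₁ h₁₂ h₂₂ : ℤ)
  (h₁₁-eq : 1ℤ + α * α + β * β + α + β + α * β ≡ h₁₁ * + n)
  (h₁₂-eq : α * γ + β * δ + (1ℤ + α + β) * (1ℤ + γ + δ) ≡ h₁₂ * + n)
  (h₂₂-eq : 1ℤ + γ * γ + δ * δ + γ + δ + γ * δ ≡ h₂₂ * + n) where

  P x₁ x₂ y₁ y₂ : ℤ
  P = + n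
  x₁ = 1ℤ + + 2 * α + β
  x₂ = 1ℤ + + 2 * γ + δ
  y₁ = 1ℤ + α + + 2 * β
  y₂ = 1ℤ + γ + + 2 * δ

  F₀ : Gram 4
  F₀ = symmetric₄ (+ 2 * P) P x₁ x₂ (+ 2 * P) y₁ y₂ (+ 2 * h₁₁) h₁₂ (+ 2 * h₂₂)

  F₀-symmetric : Symmetric F₀
  F₀-symmetric = symmetric₄-symmetric (+ 2 * P) P x₁ x₂ (+ 2 * P) y₁ y₂ (+ 2 * h₁₁) h₁₂ (+ 2 * h₂₂)

  basis : Matrix 4 4
  basis = fromRows ((0ℤ ∷ 0ℤ ∷ 1ℤ ∷ 0ℤ ∷ []) ∷
                    (0ℤ ∷ 0ℤ ∷ 1ℤ ∷ 1ℤ ∷ []) ∷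
                    (P ∷ 0ℤ ∷ 1ℤ + α ∷ 1ℤ + γ ∷ []) ∷
                    (P ∷ P ∷ 1ℤ + α + β ∷ 1ℤ + γ + δ ∷ []) ∷ [])

  private
    upper : ∀ i j → form A₄ (λ k → basis k i) (λ k → basis k j) ≡ P * F₀ i j → form A₄ (λ k → basis k j) (λ k → basis k i) ≡ P * F₀ j i
    upper i j h = trans (form-comm A₄ A₄-symmetric (λ k → basis k j) (λ k → basis k i)) (trans h (cong (P *_) (F₀-symmetric i j)))

    E : ∀ i j {z} → _ ≡ z → form A₄ (λ k → basis k i) (λ k → basis k j) ≡ z
    E i j = trans (A₄-expand (λ k → basis k i) (λ k → basis k j))

    :A₄ : ∀ {m} → (Fin 4 → Polynomial m) → (Fin 4 → Polynomial m) → Polynomial m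
    :A₄ x y = x #0 :* y #0 :+ (x #1 :- x #0) :* (y #1 :- y #0) :+ (x #2 :- x #1) :* (y #2 :- y #1) :+ (x #3 :- x #2) :* (y #3 :- y #2) :+ x #3 :* y #3

    :b₁ :b₂ : ∀ {m} → Polynomial m → Fin 4 → Polynomial m
    :b₁ p = vec :0 :0 p p
    :b₂ p = vec :0 :0 :0 p

    :b₃ :b₄ : ∀ {m} → Polynomial m → Polynomial m → Fin 4 → Polynomial m
    :b₃ α β = vec :1 :1 (:1 :+ α) (:1 :+ α :+ β)
    :b₄ γ δ = vec :0 :1 (:1 :+ γ) (:1 :+ γ :+ δ)

  basis-Gram : ∀ i j → form A₄ (λ k → basis k i) (λ k → basis k j) ≡ P * F₀ i j
  basis-Gram #0 #0 = E #0 #0 (solve 1 (λ p → :A₄ (:b₁ p) (:b₁ p) := p :* (:2 :* p)) refl P)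
  basis-Gram #0 #1 = E #0 #1 (solve 1 (λ p → :A₄ (:b₁ p) (:b₂ p) := p :* p) refl P)
  basis-Gram #0 #2 = E #0 #2 (solve 3 (λ p α β → :A₄ (:b₁ p) (:b₃ α β) := p :* (:1 :+ :2 :* α :+ β)) refl P α β)
  basis-Gram #0 #3 = E #0 #3 (solve 3 (λ p α β → :A₄ (:b₁ p) (:b₄ α β) := p :* (:1 :+ :2 :* α :+ β)) refl P γ δ)
  basis-Gram #1 #1 = E #1 #1 (solve 1 (λ p → :A₄ (:b₂ p) (:b₂ p) := p :* (:2 :* p)) refl P)
  basis-Gram #1 #2 = E #1 #2 (solve 3 (λ p α β → :A₄ (:b₂ p) (:b₃ α β) := p :* (:1 :+ α :+ :2 :* β)) refl P α β)
  basis-Gram #1 #3 = E #1 #3 (solve 3 (λ p α β → :A₄ (:b₂ p) (:b₄ α β) := p :* (:1 :+ α :+ :2 :* β)) refl P γ δ)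
  basis-Gram #2 #2 = E #2 #2 (by₁ (+ 2) h₁₁-eq (solve 4 (λ p α β h → :A₄ (:b₃ α β) (:b₃ α β) :- p :* (:2 :* h) :=
    :2 :* (:1 :+ α :* α :+ β :* β :+ α :+ β :+ α :* β :- h :* p)) refl P α β h₁₁))
  basis-Gram #2 #3 = E #2 #3 (by₁ 1ℤ h₁₂-eq (solve 6 (λ p α β γ δ h → :A₄ (:b₃ α β) (:b₄ γ δ) :- p :* h :=
    :1 :* (α :* γ :+ β :* δ :+ (:1 :+ α :+ β) :* (:1 :+ γ :+ δ) :- h :* p)) refl P α β γ δ h₁₂))
  basis-Gram #3 #3 = E #3 #3 (by₁ (+ 2) h₂₂-eq (solve 4 (λ p α β h → :A₄ (:b₄ α β) (:b₄ α β) :- p :* (:2 :* h) :=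
    :2 :* (:1 :+ α :* α :+ β :* β :+ α :+ β :+ α :* β :- h :* p)) refl P γ δ h₂₂))
  basis-Gram #1 #0 = upper #0 #1 (basis-Gram #0 #1)
  basis-Gram #2 #0 = upper #0 #2 (basis-Gram #0 #2)
  basis-Gram #2 #1 = upper #1 #2 (basis-Gram #1 #2)
  basis-Gram #3 #0 = upper #0 #3 (basis-Gram #0 #3)
  basis-Gram #3 #1 = upper #1 #3 (basis-Gram #1 #3)
  basis-Gram #3 #2 = upper #2 #3 (basis-Gram #2 #3)

  -- The Gram matrix of the projections of the last two vectors orthogonal to the first two, times 3.
  U V W : ℤ
  U = + 6 * (h₁₁ * P) - (+ 2 * (x₁ * x₁) - + 2 * (x₁ * y₁) + + 2 * (y₁ * y₁))
  V = + 6 * (h₂₂ * P) - (+ 2 * (x₂ * x₂) - + 2 * (x₂ * y₂) + + 2 * (y₂ * y₂))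
  W = + 3 * (h₁₂ * P) - (+ 2 * (x₁ * x₂) - x₁ * y₂ - y₁ * x₂ + + 2 * (y₁ * y₂))

  private
    -- Whatever `α` and `β` are, projecting the third basis vector gives `e₁ - (e₃ + e₄ + e₅)/3`, of
    -- norm 4/3; the fourth gives `e₂ - (e₃ + e₄ + e₅)/3`, and their inner product is 1/3. Hence the
    -- values 4, 4 and 1, and the determinant `(4 · 4 - 1)/3 = 5`.
    projection-norm : ∀ α β h → 1ℤ + α * α + β * β + α + β + α * β ≡ h * P →
      let x = 1ℤ + + 2 * α + β ; y = 1ℤ + α + + 2 * β in + 6 * (h * P) - (+ 2 * (x * x) - + 2 * (x * y) + + 2 * (y * y)) ≡ + 4
    projection-norm α β h e = by₁ -[1+ 5 ] e (solve 4 (λ p α β h →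
      let x = :1 :+ :2 :* α :+ β
          y = :1 :+ α :+ :2 :* β
      in con (+ 6) :* (h :* p) :- (:2 :* (x :* x) :- :2 :* (x :* y) :+ :2 :* (y :* y)) :- :4
        := con -[1+ 5 ] :* (:1 :+ α :* α :+ β :* β :+ α :+ β :+ α :* β :- h :* p)) refl P α β h)

    U≡4 : U ≡ + 4
    U≡4 = projection-norm α β h₁₁ h₁₁-eq

    V≡4 : V ≡ + 4
    V≡4 = projection-norm γ δ h₂₂ h₂₂-eq

    W≡1 : W ≡ 1ℤ
    W≡1 = by₁ -[1+ 2 ] h₁₂-eq (solve 6 (λ p α β γ δ h →
      let x₁ = :1 :+ :2 :* α :+ β
          y₁ = :1 :+ α :+ :2 :* β
          x₂ = :1 :+ :2 :* γ :+ δ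
          y₂ = :1 :+ γ :+ :2 :* δ
      in :3 :* (h :* p) :- (:2 :* (x₁ :* x₂) :- x₁ :* y₂ :- y₁ :* x₂ :+ :2 :* (y₁ :* y₂)) :- :1
        := con -[1+ 2 ] :* (α :* γ :+ β :* δ :+ (:1 :+ α :+ β) :* (:1 :+ γ :+ δ) :- h :* p)) refl P α β γ δ h₁₂)

    0<P : 0ℤ ℤ.< P
    0<P = ℤ.+<+ (ℕ.>-nonZero⁻¹ n)

    0<+ : ∀ k → 0ℤ ℤ.< + suc k
    0<+ k = ℤ.+<+ (ℕ.s≤s ℕ.z≤n)

    D₂>0 : 0ℤ ℤ.< det2 (+ 2 * P) P (+ 2 * P)
    D₂>0 = subst (0ℤ ℤ.<_) (solve 1 (λ p → :3 :* (p :* p) := :D.det2 (:2 :* p) p (:2 :* p)) refl P)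
      (0<* (0<+ 2) (0<* 0<P 0<P))

    D₃>0 : 0ℤ ℤ.< det3 (+ 2 * P) P x₁ (+ 2 * P) y₁ (+ 2 * h₁₁)
    D₃>0 = subst (0ℤ ℤ.<_) (by₁ (- P) U≡4 (solve 4 (λ p x y h → :4 :* p :- :D.det3 (:2 :* p) p x (:2 :* p) y (:2 :* h) :=
      (:- p) :* (con (+ 6) :* (h :* p) :- (:2 :* (x :* x) :- :2 :* (x :* y) :+ :2 :* (y :* y)) :- :4)) refl P x₁ y₁ h₁₁)) (0<* (0<+ 3) 0<P)

    D₄≡5 : det4 (+ 2 * P) P x₁ x₂ (+ 2 * P) y₁ y₂ (+ 2 * h₁₁) h₁₂ (+ 2 * h₂₂) ≡ + 5
    D₄≡5 = ℤ.*-cancelˡ-≡ (+ 3) _ _ (trans 3D₄≡ (trans (cong (_- W * W) (cong₂ _*_ U≡4 V≡4)) (cong (λ w → + 16 - w * w) W≡1)))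
      where
      3D₄≡ : + 3 * det4 (+ 2 * P) P x₁ x₂ (+ 2 * P) y₁ y₂ (+ 2 * h₁₁) h₁₂ (+ 2 * h₂₂) ≡ U * V - W * W
      3D₄≡ = solve 8 (λ p x₁ x₂ y₁ y₂ h₁₁ h₁₂ h₂₂ →
        let U = con (+ 6) :* (h₁₁ :* p) :- (:2 :* (x₁ :* x₁) :- :2 :* (x₁ :* y₁) :+ :2 :* (y₁ :* y₁))
            V = con (+ 6) :* (h₂₂ :* p) :- (:2 :* (x₂ :* x₂) :- :2 :* (x₂ :* y₂) :+ :2 :* (y₂ :* y₂))
            W = :3 :* (h₁₂ :* p) :- (:2 :* (x₁ :* x₂) :- x₁ :* y₂ :- y₁ :* x₂ :+ :2 :* (y₁ :* y₂))
        in :3 :* :D.det4 (:2 :* p) p x₁ x₂ (:2 :* p) y₁ y₂ (:2 :* h₁₁) h₁₂ (:2 :* h₂₂) := U :* V :- W :* W)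
        refl P x₁ x₂ y₁ y₂ h₁₁ h₁₂ h₂₂

    frame : Reduction.Frame (space (symmetric₄ (+ 2 * P) P x₁ x₂ (+ 2 * P) y₁ y₂ (+ 2 * h₁₁) h₁₂ (+ 2 * h₂₂))
              (symmetric₄-symmetric (+ 2 * P) P x₁ x₂ (+ 2 * P) y₁ y₂ (+ 2 * h₁₁) h₁₂ (+ 2 * h₂₂))) (+ 5)
    frame = unit-frame (+ 5) (+ 2 * P) P x₁ x₂ (+ 2 * P) y₁ y₂ (+ 2 * h₁₁) h₁₂ (+ 2 * h₂₂) (0<* (0<+ 1) 0<P) D₂>0 D₃>0 D₄≡5

    even : ∀ aa ab ac ad bb bc bd cc cd dd (u : Vector 4) → ∃[ h ] form (symmetric₄ (+ 2 * aa) ab ac ad (+ 2 * bb) bc bd (+ 2 * cc) cd (+ 2 * dd)) u u ≡ + 2 * h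
    even aa ab ac ad bb bc bd cc cd dd u =
      aa * u #0 * u #0 + ab * u #0 * u #1 + ac * u #0 * u #2 + ad * u #0 * u #3 + bb * u #1 * u #1 + bc * u #1 * u #2 + bd * u #1 * u #3
        + cc * u #2 * u #2 + cd * u #2 * u #3 + dd * u #3 * u #3 ,
      solve 14 (λ aa ab ac ad bb bc bd cc cd dd u₀ u₁ u₂ u₃ →
        :form (symmetric₄ (:2 :* aa) ab ac ad (:2 :* bb) bc bd (:2 :* cc) cd (:2 :* dd)) (vec u₀ u₁ u₂ u₃) (vec u₀ u₁ u₂ u₃) :=
        :2 :* (aa :* u₀ :* u₀ :+ ab :* u₀ :* u₁ :+ ac :* u₀ :* u₂ :+ ad :* u₀ :* u₃ :+ bb :* u₁ :* u₁ :+ bc :* u₁ :* u₂ :+ bd :* u₁ :* u₃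
          :+ cc :* u₂ :* u₂ :+ cd :* u₂ :* u₃ :+ dd :* u₃ :* u₃)) refl aa ab ac ad bb bc bd cc cd dd (u #0) (u #1) (u #2) (u #3)

    vectors : ∃[ v ] (∀ i j → form F₀ (v i) (v j) ≡ A₄ i j)
    vectors = frame-vectors Sp F , frame-Gram Sp F
      where
      Sp = space (symmetric₄ (+ 2 * P) P x₁ x₂ (+ 2 * P) y₁ y₂ (+ 2 * h₁₁) h₁₂ (+ 2 * h₂₂))
              (symmetric₄-symmetric (+ 2 * P) P x₁ x₂ (+ 2 * P) y₁ y₂ (+ 2 * h₁₁) h₁₂ (+ 2 * h₂₂))
      F = Small-Determinant.determinant-5⇒A₄ Sp (even P P x₁ x₂ P y₁ y₂ h₁₁ h₁₂ h₂₂) frame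

  multiplier : HasMultiplier A₄ n
  multiplier = build vectors
    where
    build : (∃[ v ] (∀ i j → form F₀ (v i) (v j) ≡ A₄ i j)) → HasMultiplier A₄ n
    build (v , h) = (λ k j → mv basis (v j) k) , λ i j → trans (form-mv A₄ F₀ basis P basis-Gram (v i) (v j)) (cong (P *_) (h i j))

-- Modulo p put κ = (3 + t)/10, where t² + t = 1, and wᵢ = eᵢ - κ (e₁ + e₂ + e₃ + e₄). Then w₁, …, w₄ is orthonormal modulo p
-- for the form of A₄, so w₁ + a w₃ + b w₄ and w₂ - b w₃ + a w₄ span a totally isotropic plane when p ∣ 1 + a² + b².
module _ {p : ℕ} (p-prime : Prime p) (2<p : 2 ℕ.< p) (5≢p : 5 ≢ p) where
  open ModPrime p-prime

  private
    2≉0 : ¬ + 2 ≈ 0ℤ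
    2≉0 h = ℕ.<⇒≢ 2<p (sym (∣prime⇒≡ 2 p-prime (subst (2 ℕ.∣_) p≡2 ℕ.∣-refl)))
      where
      p≡2 : 2 ≡ p
      p≡2 = case ∣⇒∣ᵤ (≈0⇒∣ h) of λ d → ℕ.≤-antisym (ℕ.<⇒≤ 2<p) (ℕ.∣⇒≤ d)

    5≉0 : ¬ + 5 ≈ 0ℤ
    5≉0 h = case prime⇒irreducible prime[5] (∣⇒∣ᵤ (≈0⇒∣ h)) of λ where
        (inj₁ p≡1) → ℕ.<⇒≢ (ℕ.<-trans (ℕ.n<1+n 1) 2<p) (sym p≡1)
        (inj₂ p≡5) → 5≢p (sym p≡5)
      where
      prime[5] : Prime 5
      prime[5] = from-yes (prime? 5)

    -- Cramer's rule brings the plane into the shape required by `Sublattice`. `s` and `s′` are the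
    -- sums of the coefficients of the two spanning vectors in the `wᵢ`, `D` is the minor of their
    -- coordinates at `e₁` and `e₂`, and the plane contains `(D , 0 , A , B)` and `(0 , D , C , E)`.
    module :Plane {n : ℕ} (κ a b : Polynomial n) where
      s s′ D A B C E : Polynomial n
      s  = :1 :+ a :+ b
      s′ = :1 :- b :+ a
      D  = :1 :- :2 :* κ :* (:1 :+ a)
      A  = a :- κ :* s :- κ :* (s′ :* a :+ s :* b)
      B  = b :- κ :* s :- κ :* (s′ :* b :- s :* a)
      C  = κ :* s′ :* a :- b :- κ :* s′ :+ κ :* s :* b
      E  = κ :* s′ :* b :+ a :- κ :* s′ :- κ :* s :* a

    -- The inner product of `wᵢ` and `wⱼ` is `20 κ² - 10 κ + 1`, increased by 1 when `i = j`; so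
    -- `K≈0` is the orthonormality of the `wᵢ` modulo `p`. It leaves norm `1 + a² + b²` for both
    -- spanning vectors and inner product 0 between them.
    module Plane (κ a b d : ℤ) (K≈0 : + 20 * κ * κ - + 10 * κ + 1ℤ ≈ 0ℤ) (S≈0 : 1ℤ + a * a + b * b ≈ 0ℤ)
                 (inv : (1ℤ - + 2 * κ * (1ℤ + a)) * d ≈ 1ℤ) where
      s s′ D A B C E : ℤ
      s  = 1ℤ + a + b
      s′ = 1ℤ - b + a
      D  = 1ℤ - + 2 * κ * (1ℤ + a)
      A  = a - κ * s - κ * (s′ * a + s * b)
      B  = b - κ * s - κ * (s′ * b - s * a)
      C  = κ * s′ * a - b - κ * s′ + κ * s * b
      E  = κ * s′ * b + a - κ * s′ - κ * s * a

      half-norm-cong : ∀ {D A B} α β → α ≡ d * A → β ≡ d * B → D * d ≈ 1ℤ → D * D + A * A + B * B + D * A + D * B + A * B ≈ 0ℤ →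
                       1ℤ + α * α + β * β + α + β + α * β ≈ 0ℤ
      half-norm-cong {D} {A} {B} α β refl refl inv h = ≈-by₂ (- (D * d + 1ℤ) - d * A - d * B) (d * d) inv h
        (solve 4 (λ d D A B → :1 :+ d :* A :* (d :* A) :+ d :* B :* (d :* B) :+ d :* A :+ d :* B :+ d :* A :* (d :* B) :- :0 :=
          (:- (D :* d :+ :1) :- d :* A :- d :* B) :* (D :* d :- :1) :+ d :* d :* (D :* D :+ A :* A :+ B :* B :+ D :* A :+ D :* B :+ A :* B :- :0)) refl d D A B)

      half : ∀ x → + 2 * x ≈ 0ℤ → x ≈ 0ℤ
      half x h = case euclid (+ 2) x h of λ where
        (inj₁ 2≈0) → contradiction 2≈0 2≉0
        (inj₂ x≈0) → x≈0

      norm₁ : D * D + A * A + B * B + D * A + D * B + A * B ≈ 0ℤ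
      norm₁ = half _ (≈-by₂ ((1ℤ - κ * s′) * (1ℤ - κ * s′) + κ * s * (κ * s)) (s * s) S≈0 K≈0
        (solve 3 (λ κ a b →
          let module Q = :Plane κ a b in :2 :* (Q.D :* Q.D :+ Q.A :* Q.A :+ Q.B :* Q.B :+ Q.D :* Q.A :+ Q.D :* Q.B :+ Q.A :* Q.B) :- :0 :=
            ((:1 :- κ :* Q.s′) :* (:1 :- κ :* Q.s′) :+ κ :* Q.s :* (κ :* Q.s)) :* (:1 :+ a :* a :+ b :* b :- :0)
            :+ Q.s :* Q.s :* (con (+ 20) :* κ :* κ :- con (+ 10) :* κ :+ :1 :- :0)) refl κ a b))

      norm₂ : D * D + C * C + E * E + D * C + D * E + C * E ≈ 0ℤ
      norm₂ = half _ (≈-by₂ ((1ℤ - κ * s) * (1ℤ - κ * s) + κ * s′ * (κ * s′)) (s′ * s′) S≈0 K≈0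
        (solve 3 (λ κ a b →
          let module Q = :Plane κ a b in :2 :* (Q.D :* Q.D :+ Q.C :* Q.C :+ Q.E :* Q.E :+ Q.D :* Q.C :+ Q.D :* Q.E :+ Q.C :* Q.E) :- :0 :=
            ((:1 :- κ :* Q.s) :* (:1 :- κ :* Q.s) :+ κ :* Q.s′ :* (κ :* Q.s′)) :* (:1 :+ a :* a :+ b :* b :- :0)
            :+ Q.s′ :* Q.s′ :* (con (+ 20) :* κ :* κ :- con (+ 10) :* κ :+ :1 :- :0)) refl κ a b))

      product₁₂ : A * C + B * E + (D + A + B) * (D + C + E) ≈ 0ℤ
      product₁₂ = ≈-by₂ ((1ℤ - κ * s′) * (κ * s′) + κ * s * (1ℤ - κ * s)) (s * s′) S≈0 K≈0
        (solve 3 (λ κ a b →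
          let module Q = :Plane κ a b in Q.A :* Q.C :+ Q.B :* Q.E :+ (Q.D :+ Q.A :+ Q.B) :* (Q.D :+ Q.C :+ Q.E) :- :0 :=
            ((:1 :- κ :* Q.s′) :* (κ :* Q.s′) :+ κ :* Q.s :* (:1 :- κ :* Q.s)) :* (:1 :+ a :* a :+ b :* b :- :0)
            :+ Q.s :* Q.s′ :* (con (+ 20) :* κ :* κ :- con (+ 10) :* κ :+ :1 :- :0)) refl κ a b)

      α β γ δ : ℤ
      α = d * A
      β = d * B
      γ = d * C
      δ = d * E

      h₁₁ : 1ℤ + α * α + β * β + α + β + α * β ≈ 0ℤ
      h₁₁ = half-norm-cong {D} {A} {B} α β refl refl inv norm₁

      h₂₂ : 1ℤ + γ * γ + δ * δ + γ + δ + γ * δ ≈ 0ℤ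
      h₂₂ = half-norm-cong {D} {C} {E} γ δ refl refl inv norm₂

      h₁₂ : α * γ + β * δ + (1ℤ + α + β) * (1ℤ + γ + δ) ≈ 0ℤ
      h₁₂ = bilinear D A B C E inv product₁₂
        where
        bilinear : ∀ D A B C E → D * d ≈ 1ℤ → A * C + B * E + (D + A + B) * (D + C + E) ≈ 0ℤ →
                   d * A * (d * C) + d * B * (d * E) + (1ℤ + d * A + d * B) * (1ℤ + d * C + d * E) ≈ 0ℤ
        bilinear D A B C E inv h = ≈-by₂ (- (1ℤ + D * d + d * A + d * B + d * C + d * E)) (d * d) inv h
          (solve 6 (λ d D A B C E → d :* A :* (d :* C) :+ d :* B :* (d :* E) :+ (:1 :+ d :* A :+ d :* B) :* (:1 :+ d :* C :+ d :* E) :- :0 :=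
            (:- (:1 :+ D :* d :+ d :* A :+ d :* B :+ d :* C :+ d :* E)) :* (D :* d :- :1)
            :+ d :* d :* (A :* C :+ B :* E :+ (D :+ A :+ B) :* (D :+ C :+ E) :- :0)) refl d D A B C E)

      multiplier : HasMultiplier A₄ p
      multiplier = Sublattice.multiplier p α β γ δ (quotient h₁₁) (quotient h₁₂) (quotient h₂₂) (equality h₁₁) (equality h₁₂) (equality h₂₂)
        where
        quotient : ∀ {z} → z ≈ 0ℤ → ℤ
        quotient h = Signed.quotient (≈0⇒∣ h)
        equality : ∀ {z} (h : z ≈ 0ℤ) → z ≡ quotient h * + p
        equality h = Signed._∣_.equality (≈0⇒∣ h)

    -- With `10 κ = 3 + t`, five times `20 κ² - 10 κ + 1` becomes `t² + t - 1`.
    K-root : ∀ t e → + 10 * e ≈ 1ℤ → N 1ℤ 1ℤ t 1ℤ ≈ 0ℤ → let κ = (+ 3 + t) * e in + 20 * κ * κ - + 10 * κ + 1ℤ ≈ 0ℤ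
    K-root t e inv root = *-cancel-≈ (+ 5) 5≉0 (≈-by₂ ((+ 3 + t) * (+ 3 + t) * (+ 10 * e + 1ℤ) - + 5 * (+ 3 + t)) 1ℤ inv root
      (solve 2 (λ t e → let κ = (:3 :+ t) :* e in
        :5 :* (con (+ 20) :* κ :* κ :- con (+ 10) :* κ :+ :1) :- :5 :* :0 :=
        ((:3 :+ t) :* (:3 :+ t) :* (con (+ 10) :* e :+ :1) :- :5 :* (:3 :+ t)) :* (con (+ 10) :* e :- :1)
        :+ :1 :* (:N :1 :1 t :1 :- :0)) refl t e))

    -- The minor 1 - 2κ(1 + a) cannot vanish for both choices of the sign of a.
    choose-sign : ∀ κ a b → + 20 * κ * κ - + 10 * κ + 1ℤ ≈ 0ℤ → 1ℤ + a * a + b * b ≈ 0ℤ → HasMultiplier A₄ p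
    choose-sign κ a b K≈0 S≈0 = case 1ℤ - + 2 * κ * (1ℤ + a) ≈? 0ℤ of λ where
        (no D≉0)  → plane κ a b K≈0 S≈0 (inverse _ D≉0)
        (yes D≈0) → plane κ (- a) b K≈0 (≈-by₁ 1ℤ S≈0 (solve 2 (λ a b → :1 :+ (:- a) :* (:- a) :+ b :* b :- :0 := :1 :* (:1 :+ a :* a :+ b :* b :- :0)) refl a b))
          -- The sum of the two minors is `2 - 4 κ`. If it vanished, `κ` would be 1/2, where
          -- `20 κ² - 10 κ + 1` has the value 1.
          (inverse _ (λ D′≈0 → 1≉0 (≈-by₂ 1ℤ (+ 5 * κ) K≈0 (2-4κ D≈0 D′≈0)
            (solve 1 (λ κ → :1 :- :0 := :1 :* (con (+ 20) :* κ :* κ :- con (+ 10) :* κ :+ :1 :- :0) :+ :5 :* κ :* (:2 :- :4 :* κ :- :0)) refl κ))))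
      where
      plane : ∀ κ a b → + 20 * κ * κ - + 10 * κ + 1ℤ ≈ 0ℤ → 1ℤ + a * a + b * b ≈ 0ℤ →
              (∃[ d ] (1ℤ - + 2 * κ * (1ℤ + a)) * d ≈ 1ℤ) → HasMultiplier A₄ p
      plane κ a b K≈0 S≈0 (d , inv) = Plane.multiplier κ a b d K≈0 S≈0 inv
      2-4κ : 1ℤ - + 2 * κ * (1ℤ + a) ≈ 0ℤ → 1ℤ - + 2 * κ * (1ℤ + - a) ≈ 0ℤ → + 2 - + 4 * κ ≈ 0ℤ
      2-4κ h h′ = ≈-by₂ 1ℤ 1ℤ h h′ (solve 2 (λ κ a → :2 :- :4 :* κ :- :0 :=
        :1 :* (:1 :- :2 :* κ :* (:1 :+ a) :- :0) :+ :1 :* (:1 :- :2 :* κ :* (:1 :+ (:- a)) :- :0)) refl κ a)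

  A₄-multiplier-root : Roots.Root p-prime 1ℤ 1ℤ → HasMultiplier A₄ p
  A₄-multiplier-root (t , root) = go (inverse (+ 10) (*-≉0 {+ 2} {+ 5} 2≉0 5≉0)) (1+a²+b²≈0 p-prime)
    where
    go : (∃[ e ] + 10 * e ≈ 1ℤ) → (∃[ a ] ∃[ b ] 1ℤ + a * a + b * b ≈ 0ℤ) → HasMultiplier A₄ p
    go (e , inv) (a , b , S≈0) = choose-sign ((+ 3 + t) * e) a b (K-root t e inv root) S≈0

A₄-multiplier-prime : ∀ p → Prime p → ¬ Is±2mod5 p → HasMultiplier A₄ p
A₄-multiplier-prime p p-prime ¬±2 = case p ℕ.≟ 5 of λ where
    (yes refl) → A₄-multiplier-5
    (no p≢5)   → case split-φ p-prime ¬±2 of λ where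
      (inj₁ p≡5) → contradiction p≡5 p≢5
      (inj₂ h)   → A₄-multiplier-root p-prime 2<p (λ e → p≢5 (sym e)) (root-φ p-prime h)
  where
  2<p : 2 ℕ.< p
  2<p = ℕ.≤∧≢⇒< (ℕ.nonTrivial⇒n>1 p {{prime⇒nonTrivial p-prime}}) λ { refl → ¬±2 (inj₁ refl) }

even⇒A₄-multiplier : ∀ c .{{_ : ℕ.NonZero c}} → PrimesEvenPower Is±2mod5 c → HasMultiplier A₄ c
even⇒A₄-multiplier = Generate.generate Is±2mod5? (HasMultiplier A₄) (multiplier-1 A₄)
  (λ p c _ _ → multiplier-p² A₄ c p)
  (λ p c p-prime ¬I h → multiplier-* A₄ c p h (A₄-multiplier-prime p p-prime ¬I))

-- The remaining lattices

form-bilinear : ∀ {n} (G : Gram n) → Symmetric G → ∀ a b x y x′ y′ →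
  form G (λ i → a * x i + b * y i) (λ i → a * x′ i + b * y′ i) ≡
  a * a * form G x x′ + a * b * (form G x y′ + form G y x′) + b * b * form G y y′
form-bilinear G sym-G a b x y x′ y′ = begin
  form G (λ i → a * x i + b * y i) z                                        ≡⟨ left a b x y z ⟩
  a * form G x z + b * form G y z                                           ≡⟨ cong₂ (λ p q → a * p + b * q) (right x) (right y) ⟩
  a * (a * form G x x′ + b * form G x y′) + b * (a * form G y x′ + b * form G y y′)
    ≡⟨ solve 6 (λ a b p q r s → a :* (a :* p :+ b :* q) :+ b :* (a :* r :+ b :* s) := a :* a :* p :+ a :* b :* (q :+ r) :+ b :* b :* s) refl
         a b (form G x x′) (form G x y′) (form G y x′) (form G y y′) ⟩
  a * a * form G x x′ + a * b * (form G x y′ + form G y x′) + b * b * form G y y′   ∎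
  where
  open ≡-Reasoning
  z = λ i → a * x′ i + b * y′ i
  left : ∀ a b x y z → form G (λ i → a * x i + b * y i) z ≡ a * form G x z + b * form G y z
  left a b x y z = trans (form-dot G (λ i → a * x i + b * y i) z) (trans (dot-linearˡ a b x y (mv G z))
    (sym (cong₂ (λ p q → a * p + b * q) (form-dot G x z) (form-dot G y z))))
  right : ∀ u → form G u z ≡ a * form G u x′ + b * form G u y′
  right u = trans (form-comm G sym-G u z) (trans (left a b x′ y′ u) (cong₂ (λ p q → a * p + b * q) (form-comm G sym-G x′ u) (form-comm G sym-G y′ u)))

-- An isometry ρ with ρ + ρ⁻¹ = u makes the lattice a ℤ[ρ]-module in which r + s ρ multiplies norms by r² + u r s + s².
module _ {n : ℕ} (G : Gram n) (sym-G : Symmetric G) (ρ : Matrix n n) (u : ℤ)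
  (isometry : ∀ i j → imageGram G ρ i j ≡ G i j)
  (trace : ∀ i j → form G (unit i) (λ k → ρ k j) + form G (λ k → ρ k i) (unit j) ≡ u * G i j) where

  multiplier-r+sρ : ∀ c r s → N u -1ℤ r s ≡ + c → HasMultiplier G c
  multiplier-r+sρ c r s h = (λ k j → r * unit j k + s * ρ k j) , λ i j →
    trans (form-bilinear G sym-G r s (unit i) (λ k → ρ k i) (unit j) (λ k → ρ k j))
      (trans (cong₂ _+_ (cong₂ (λ p q → r * r * p + r * s * q) (form-unit G i j) (trace i j)) (cong (s * s *_) (isometry i j)))
        (trans (solve 4 (λ u r s g → r :* r :* g :+ r :* s :* (u :* g) :+ s :* s :* g := :N u (con -1ℤ) r s :* g) refl u r s (G i j))
          (cong (_* G i j) h)))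

rows : ∀ {m n} → Vec (Vec ℤ n) m → Matrix m n
rows xss i j = lookup (lookup xss i) j

symmetric? : ∀ {n} (G : Gram n) → Dec (Symmetric G)
symmetric? G = all? λ i → all? λ j → G i j ℤ.≟ G j i

isometry? : ∀ {n} (G : Gram n) (ρ : Matrix n n) → Dec (∀ i j → imageGram G ρ i j ≡ G i j)
isometry? G ρ = all? λ i → all? λ j → imageGram G ρ i j ℤ.≟ G i j

trace? : ∀ {n} (G : Gram n) (ρ : Matrix n n) u → Dec (∀ i j → form G (unit i) (λ k → ρ k j) + form G (λ k → ρ k i) (unit j) ≡ u * G i j)
trace? G ρ u = all? λ i → all? λ j → form G (unit i) (λ k → ρ k j) + form G (λ k → ρ k i) (unit j) ℤ.≟ u * G i j

rep⇒ℤ² : ∀ c → Rep 0ℤ -1ℤ c → HasMultiplier (ℤⁿ 2) c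
rep⇒ℤ² c (r , s , h) = multiplier-r+sρ (ℤⁿ 2) (from-yes (symmetric? (ℤⁿ 2))) ρ 0ℤ
    (from-yes (isometry? (ℤⁿ 2) ρ)) (from-yes (trace? (ℤⁿ 2) ρ 0ℤ)) c r s h
  where
  ρ : Matrix 2 2
  ρ = rows ((0ℤ ∷ -1ℤ ∷ []) ∷ (1ℤ ∷ 0ℤ ∷ []) ∷ [])

rep⇒ℤ⁶ : ∀ c → Rep 0ℤ -1ℤ c → HasMultiplier (ℤⁿ 6) c
rep⇒ℤ⁶ c (r , s , h) = multiplier-r+sρ (ℤⁿ 6) (from-yes (symmetric? (ℤⁿ 6))) ρ 0ℤ
    (from-yes (isometry? (ℤⁿ 6) ρ)) (from-yes (trace? (ℤⁿ 6) ρ 0ℤ)) c r s h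
  where
  ρ : Matrix 6 6
  ρ = rows ((0ℤ ∷ -1ℤ ∷ 0ℤ ∷ 0ℤ ∷ 0ℤ ∷ 0ℤ ∷ []) ∷ (1ℤ ∷ 0ℤ ∷ 0ℤ ∷ 0ℤ ∷ 0ℤ ∷ 0ℤ ∷ []) ∷
                (0ℤ ∷ 0ℤ ∷ 0ℤ ∷ -1ℤ ∷ 0ℤ ∷ 0ℤ ∷ []) ∷ (0ℤ ∷ 0ℤ ∷ 1ℤ ∷ 0ℤ ∷ 0ℤ ∷ 0ℤ ∷ []) ∷
                (0ℤ ∷ 0ℤ ∷ 0ℤ ∷ 0ℤ ∷ 0ℤ ∷ -1ℤ ∷ []) ∷ (0ℤ ∷ 0ℤ ∷ 0ℤ ∷ 0ℤ ∷ 1ℤ ∷ 0ℤ ∷ []) ∷ [])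

rep⇒A₂ : ∀ c → Rep -1ℤ -1ℤ c → HasMultiplier A₂ c
rep⇒A₂ c (r , s , h) = multiplier-r+sρ A₂ (from-yes (symmetric? A₂)) ρ -1ℤ
    (from-yes (isometry? A₂ ρ)) (from-yes (trace? A₂ ρ -1ℤ)) c r s h
  where
  ρ : Matrix 2 2
  ρ = rows ((0ℤ ∷ -1ℤ ∷ []) ∷ (1ℤ ∷ -1ℤ ∷ []) ∷ [])

-- ρ is the fourth power of a Coxeter element, whose eigenvalues are primitive cube roots of unity.
rep⇒E₆ : ∀ c → Rep -1ℤ -1ℤ c → HasMultiplier E₆ c
rep⇒E₆ c (r , s , h) = multiplier-r+sρ E₆ (from-yes (symmetric? E₆)) ρ -1ℤ
    (from-yes (isometry? E₆ ρ)) (from-yes (trace? E₆ ρ -1ℤ)) c r s h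
  where
  ρ : Matrix 6 6
  ρ = rows ((0ℤ ∷ 0ℤ ∷ 0ℤ ∷ 0ℤ  ∷ -1ℤ ∷ 0ℤ  ∷ []) ∷ (1ℤ ∷ 0ℤ ∷ 0ℤ ∷ 0ℤ  ∷ -1ℤ ∷ -1ℤ ∷ []) ∷
                (1ℤ ∷ 1ℤ ∷ 0ℤ ∷ -1ℤ ∷ -1ℤ ∷ -1ℤ ∷ []) ∷ (1ℤ ∷ 0ℤ ∷ 1ℤ ∷ -1ℤ ∷ -1ℤ ∷ -1ℤ ∷ []) ∷
                (1ℤ ∷ 0ℤ ∷ 0ℤ ∷ 0ℤ  ∷ -1ℤ ∷ 0ℤ  ∷ []) ∷ (0ℤ ∷ 1ℤ ∷ 0ℤ ∷ 0ℤ  ∷ -1ℤ ∷ -1ℤ ∷ []) ∷ [])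

-- Necessity: rank 2 directly, higher rank by cancelling four squares

pattern #4 = suc (suc (suc (suc zero)))
pattern #5 = suc (suc (suc (suc (suc zero))))

module _ {A : Set} where
  vec₂ : A → A → Fin 2 → A
  vec₂ a b i = lookup (a ∷ b ∷ []) i

  vec₅ : A → A → A → A → A → Fin 5 → A
  vec₅ a b c d e i = lookup (a ∷ b ∷ c ∷ d ∷ e ∷ []) i

  vec₆ : A → A → A → A → A → A → Fin 6 → A
  vec₆ a b c d e f i = lookup (a ∷ b ∷ c ∷ d ∷ e ∷ f ∷ []) i

:dot : ∀ {m n} → Vector n → (Fin n → Polynomial m) → Polynomial m
:dot {n = n} a x = :Σ n (λ i → con (a i) :* x i)

:Σ₄² : ∀ {m} → (Fin 4 → Polynomial m) → Polynomial m
:Σ₄² z = z #0 :* z #0 :+ z #1 :* z #1 :+ z #2 :* z #2 :+ z #3 :* z #3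

-- In rank 2 the form is the norm form up to a constant, so the image of one basis vector already
-- represents `c`.
ℤ²⇒rep : ∀ c → HasMultiplier (ℤⁿ 2) c → Rep 0ℤ -1ℤ c
ℤ²⇒rep c (M , h) = M #0 #0 , M #1 #0 , trans
  (sym (solve 2 (λ x y → :form (λ i j → con (ℤⁿ 2 i j)) (vec₂ x y) (vec₂ x y) := :N :0 (con -1ℤ) x y) refl (M #0 #0) (M #1 #0)))
  (trans (h #0 #0) (ℤ.*-identityʳ (+ c)))

A₂⇒rep : ∀ c → HasMultiplier A₂ c → Rep -1ℤ -1ℤ c
A₂⇒rep c (M , h) = M #0 #0 , M #1 #0 , ℤ.*-cancelʳ-≡ _ _ (+ 2) (trans
  (sym (solve 2 (λ x y → :form (λ i j → con (A₂ i j)) (vec₂ x y) (vec₂ x y) := :N (con -1ℤ) (con -1ℤ) x y :* :2) refl (M #0 #0) (M #1 #0)))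
  (h #0 #0))

Σ₄² : Vector 4 → ℤ
Σ₄² z = z #0 * z #0 + z #1 * z #1 + z #2 * z #2 + z #3 * z #3

first₄ : Vector 5 → Vector 4
first₄ w i = w (inject₁ i)

-- Write c = |h|² with a quaternion h. Then c |z|² = |h̄z|², so four squares can be cancelled against four squares
-- in the identity Q(Mx) = c Q(x) by imposing ψᵢ(Mx) = ± d zᵢ.
cancel-four-squares : ∀ {n} (G : Gram n) c .{{_ : ℕ.NonZero c}} → HasMultiplier G c → (F : Matrix n 5) (ψ : Matrix 4 n) (d : ℤ) → d ≢ 0ℤ →
  ∃[ w ] ∃[ y ] ∃[ Z ] w #4 ≢ 0ℤ × form G y y ≡ + c * form G (mv F w) (mv F w) × Σ₄² (first₄ w) ≡ + c * Z × Σ₄² (mv ψ y) ≡ d * d * Z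
cancel-four-squares {n} G c (M , h) F ψ d d≢0 = go (fourSquares c)
  where
  module Quaternion (α β γ δ : ℤ) (norm : α * α + β * β + γ * γ + δ * δ ≡ + c) where
    -- Left multiplication by the quaternion `α + β i + γ j + δ k` on the first four coordinates.
    -- The fifth passes through unchanged, so the nonzero last coordinate found by `eliminate`
    -- survives in `w`.
    H : Matrix 5 5
    H = rows ((α ∷ - β ∷ - γ ∷ - δ ∷ 0ℤ ∷ []) ∷ (β ∷ α ∷ - δ ∷ γ ∷ 0ℤ ∷ []) ∷ (γ ∷ δ ∷ α ∷ - β ∷ 0ℤ ∷ []) ∷
                  (δ ∷ - γ ∷ β ∷ α ∷ 0ℤ ∷ []) ∷ (0ℤ ∷ 0ℤ ∷ 0ℤ ∷ 0ℤ ∷ 1ℤ ∷ []) ∷ [])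
    A : Matrix 4 5
    A i = mv (transpose H) (mv (transpose F) (mv (transpose M) (ψ i)))
    solution = eliminate 4 d d≢0 A
    t = proj₁ solution
    w : Vector 5
    w = mv H t
    y : Vector n
    y = mv M (mv F w)
    A-dot : ∀ t i → dot (A i) t ≡ dot (ψ i) (mv M (mv F (mv H t)))
    A-dot t i = trans (adjoint (transpose H) (mv (transpose F) (mv (transpose M) (ψ i))) t)
      (trans (adjoint (transpose F) (mv (transpose M) (ψ i)) (mv H t)) (adjoint (transpose M) (ψ i) (mv F (mv H t))))
    w₄ : ∀ t → mv H t #4 ≡ t #4
    w₄ t = solve 5 (λ a b c d e → :0 :* a :+ (:0 :* b :+ (:0 :* c :+ (:0 :* d :+ (:1 :* e :+ :0)))) := e) refl (t #0) (t #1) (t #2) (t #3) (t #4)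
    norm-H : ∀ t → Σ₄² (first₄ (mv H t)) ≡ + c * Σ₄² (first₄ t)
    norm-H t = trans (solve 9 (λ α β γ δ a b c d e →
        let x₀ = α :* a :+ (:- β :* b :+ (:- γ :* c :+ (:- δ :* d :+ (:0 :* e :+ :0))))
            x₁ = β :* a :+ (α :* b :+ (:- δ :* c :+ (γ :* d :+ (:0 :* e :+ :0))))
            x₂ = γ :* a :+ (δ :* b :+ (α :* c :+ (:- β :* d :+ (:0 :* e :+ :0))))
            x₃ = δ :* a :+ (:- γ :* b :+ (β :* c :+ (α :* d :+ (:0 :* e :+ :0))))
        in x₀ :* x₀ :+ x₁ :* x₁ :+ x₂ :* x₂ :+ x₃ :* x₃ := (α :* α :+ β :* β :+ γ :* γ :+ δ :* δ) :* (a :* a :+ b :* b :+ c :* c :+ d :* d))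
        refl α β γ δ (t #0) (t #1) (t #2) (t #3) (t #4))
      (cong (_* Σ₄² (first₄ t)) norm)
    square : ∀ i → mv ψ y i * mv ψ y i ≡ d * first₄ t i * (d * first₄ t i)
    square i = trans (cong₂ _*_ (sym (A-dot t i)) (sym (A-dot t i))) (proj₂ (proj₂ solution) i)
    squares : Σ₄² (mv ψ y) ≡ d * d * Σ₄² (first₄ t)
    squares = trans (cong₂ _+_ (cong₂ _+_ (cong₂ _+_ (square #0) (square #1)) (square #2)) (square #3))
      (solve 5 (λ d x y z w → d :* x :* (d :* x) :+ d :* y :* (d :* y) :+ d :* z :* (d :* z) :+ d :* w :* (d :* w) :=
        d :* d :* (x :* x :+ y :* y :+ z :* z :+ w :* w)) refl d (first₄ t #0) (first₄ t #1) (first₄ t #2) (first₄ t #3))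
  go : FourSquares c → ∃[ w ] ∃[ y ] ∃[ Z ] w #4 ≢ 0ℤ × form G y y ≡ + c * form G (mv F w) (mv F w) × Σ₄² (first₄ w) ≡ + c * Z × Σ₄² (mv ψ y) ≡ d * d * Z
  go (α , β , γ , δ , norm) = Q.w , Q.y , Σ₄² (first₄ Q.t) , (λ w₄≡0 → proj₁ (proj₂ Q.solution) (trans (sym (Q.w₄ Q.t)) w₄≡0)) ,
    form-mv G G M (+ c) h (mv F Q.w) (mv F Q.w) , Q.norm-H Q.t , Q.squares
    where module Q = Quaternion α β γ δ norm

+c≢0 : ∀ k c .{{_ : ℕ.NonZero c}} → + suc k * + c ≢ 0ℤ
+c≢0 k c@(suc _) ()

absolute : ∀ {n} c x → n ≡ + c * (x * x) → n ≡ + c * + ∣ x ∣ * + ∣ x ∣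
absolute c x h = trans h (trans (cong (+ c *_) (sym (trans (sym (ℤ.pos-* ∣ x ∣ ∣ x ∣)) (square-abs x)))) (sym (ℤ.*-assoc (+ c) (+ ∣ x ∣) (+ ∣ x ∣))))

∣x∣-nonZero : ∀ {x} → x ≢ 0ℤ → ℕ.NonZero ∣ x ∣
∣x∣-nonZero x≢0 = ℕ.≢-nonZero (λ e → x≢0 (ℤ.∣i∣≡0⇒i≡0 e))

ℤ⁶⇒even : ∀ c .{{_ : ℕ.NonZero c}} → HasMultiplier (ℤⁿ 6) c → PrimesEvenPower Is3mod4 c
ℤ⁶⇒even c m = go (cancel-four-squares (ℤⁿ 6) c m F ψ (+ 1 * + c) (+c≢0 0 c))
  where
  F : Matrix 6 5
  F = rows ((1ℤ ∷ 0ℤ ∷ 0ℤ ∷ 0ℤ ∷ 0ℤ ∷ []) ∷ (0ℤ ∷ 1ℤ ∷ 0ℤ ∷ 0ℤ ∷ 0ℤ ∷ []) ∷ (0ℤ ∷ 0ℤ ∷ 1ℤ ∷ 0ℤ ∷ 0ℤ ∷ []) ∷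
               (0ℤ ∷ 0ℤ ∷ 0ℤ ∷ 1ℤ ∷ 0ℤ ∷ []) ∷ (0ℤ ∷ 0ℤ ∷ 0ℤ ∷ 0ℤ ∷ 1ℤ ∷ []) ∷ (0ℤ ∷ 0ℤ ∷ 0ℤ ∷ 0ℤ ∷ 0ℤ ∷ []) ∷ [])
  ψ : Matrix 4 6
  ψ i j = unit (inject₁ (inject₁ i)) j
  expand : ∀ y → form (ℤⁿ 6) y y ≡ Σ₄² (mv ψ y) + N 0ℤ -1ℤ (y #4) (y #5)
  expand y = trans (solve 6 (λ a b c d e f → :form (λ i j → con (ℤⁿ 6 i j)) (vec₆ a b c d e f) (vec₆ a b c d e f) := a :* a :+ b :* b :+ c :* c :+ d :* d :+ :N :0 (con -1ℤ) e f)
      refl (y #0) (y #1) (y #2) (y #3) (y #4) (y #5))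
    (cong (_+ N 0ℤ -1ℤ (y #4) (y #5)) (sym (cong₂ _+_ (cong₂ _+_ (cong₂ _+_ (sq #0) (sq #1)) (sq #2)) (sq #3))))
    where
    sq : ∀ i → mv ψ y i * mv ψ y i ≡ y (inject₁ (inject₁ i)) * y (inject₁ (inject₁ i))
    sq i = cong (λ z → z * z) (dot-unit (inject₁ (inject₁ i)) y)
  expandF : ∀ w → form (ℤⁿ 6) (mv F w) (mv F w) ≡ Σ₄² (first₄ w) + w #4 * w #4
  expandF w = trans (form-cong (ℤⁿ 6) coordinate coordinate)
    (solve 5 (λ a b c d e → :form (λ i j → con (ℤⁿ 6 i j)) (vec₆ a b c d e :0) (vec₆ a b c d e :0) := a :* a :+ b :* b :+ c :* c :+ d :* d :+ e :* e) refl (w #0) (w #1) (w #2) (w #3) (w #4))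
    where
    coordinate : ∀ i → mv F w i ≡ lookup (w #0 ∷ w #1 ∷ w #2 ∷ w #3 ∷ w #4 ∷ 0ℤ ∷ []) i
    coordinate #0 = dot-unit #0 w
    coordinate #1 = dot-unit #1 w
    coordinate #2 = dot-unit #2 w
    coordinate #3 = dot-unit #3 w
    coordinate #4 = dot-unit #4 w
    coordinate #5 = solve 5 (λ a b c d e → :0 :* a :+ (:0 :* b :+ (:0 :* c :+ (:0 :* d :+ (:0 :* e :+ :0)))) := :0) refl (w #0) (w #1) (w #2) (w #3) (w #4)
  go : _ → PrimesEvenPower Is3mod4 c
  go (w , y , Z , w₄≢0 , similar , w-norm , ψ-norm) = norm⇒even-i c ∣ w #4 ∣ {{it}} {{∣x∣-nonZero w₄≢0}} (y #4) (y #5) (absolute c (w #4)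
    (by₃ 1ℤ (+ c) -1ℤ (trans (sym (expand y)) (trans similar (cong (+ c *_) (expandF w)))) w-norm ψ-norm
      (solve 6 (λ n c W Z Y p → n :- c :* (p :* p) := :1 :* (Y :+ n :- c :* (W :+ p :* p)) :+ c :* (W :- c :* Z) :+ con -1ℤ :* (Y :- :1 :* c :* (:1 :* c) :* Z)) refl
        (N 0ℤ -1ℤ (y #4) (y #5)) (+ c) (Σ₄² (first₄ w)) Z (Σ₄² (mv ψ y)) (w #4))))

-- E₆ ⊃ D₄ ⊥ A₂(2): the fᵢ are orthogonal roots of D₄, and f₅ has norm 4 in the complement.
E₆⇒even : ∀ c .{{_ : ℕ.NonZero c}} → HasMultiplier E₆ c → PrimesEvenPower Is2mod3 c
-- The choice `d = 2 c` balances the squares: `3 (2 c)² Z` on the side of `ψ` against `6 c · 2 c Z`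
-- on the side of `F`.
E₆⇒even c m = go (cancel-four-squares E₆ c m F ψ (+ 2 * + c) (+c≢0 1 c))
  where
  F : Matrix 6 5
  F = rows ((0ℤ ∷ 0ℤ ∷ 0ℤ ∷ 0ℤ ∷ 0ℤ ∷ []) ∷ (1ℤ ∷ 0ℤ ∷ 0ℤ ∷ 1ℤ ∷ 1ℤ ∷ []) ∷ (0ℤ ∷ 0ℤ ∷ 0ℤ ∷ + 2 ∷ + 2 ∷ []) ∷
             (0ℤ ∷ 1ℤ ∷ 0ℤ ∷ 1ℤ ∷ + 2 ∷ []) ∷ (0ℤ ∷ 0ℤ ∷ 0ℤ ∷ 0ℤ ∷ + 2 ∷ []) ∷ (0ℤ ∷ 0ℤ ∷ 1ℤ ∷ 1ℤ ∷ 1ℤ ∷ []) ∷ [])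
  -- `ψᵢ` is the inner product with `fᵢ`; the fourth root is the highest root of D₄. Half the sum of
  -- the squares is the norm of the projection to D₄, and what remains is the projection to the
  -- complement.
  ψ : Matrix 4 6
  ψ = rows ((-1ℤ ∷ + 2 ∷ -1ℤ ∷ 0ℤ ∷ 0ℤ ∷ 0ℤ ∷ []) ∷ (0ℤ ∷ 0ℤ ∷ -1ℤ ∷ + 2 ∷ -1ℤ ∷ 0ℤ ∷ []) ∷
             (0ℤ ∷ 0ℤ ∷ -1ℤ ∷ 0ℤ ∷ 0ℤ ∷ + 2 ∷ []) ∷ (-1ℤ ∷ 0ℤ ∷ 1ℤ ∷ 0ℤ ∷ -1ℤ ∷ 0ℤ ∷ []) ∷ [])
  expand : ∀ y → + 6 * form E₆ y y ≡ + 3 * Σ₄² (mv ψ y) + + 2 * N -1ℤ -1ℤ (+ 2 * y #4 - y #0) (y #0 + y #4)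
  expand y = solve 6 (λ a b c d e f → con (+ 6) :* :form (λ i j → con (E₆ i j)) (vec₆ a b c d e f) (vec₆ a b c d e f) :=
      :3 :* :Σ₄² (λ i → :dot (ψ i) (vec₆ a b c d e f)) :+ :2 :* :N (con -1ℤ) (con -1ℤ) (:2 :* e :- a) (a :+ e))
    refl (y #0) (y #1) (y #2) (y #3) (y #4) (y #5)
  expandF : ∀ w → form E₆ (mv F w) (mv F w) ≡ + 2 * Σ₄² (first₄ w) + + 4 * (w #4 * w #4)
  expandF w = solve 5 (λ a b c d e → :form (λ i j → con (E₆ i j)) (λ i → :dot (F i) (vec₅ a b c d e)) (λ i → :dot (F i) (vec₅ a b c d e)) :=
      :2 :* (a :* a :+ b :* b :+ c :* c :+ d :* d) :+ :4 :* (e :* e)) refl (w #0) (w #1) (w #2) (w #3) (w #4)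
  go : _ → PrimesEvenPower Is2mod3 c
  go (w , y , Z , w₄≢0 , similar , w-norm , ψ-norm) = norm⇒even-ω c ∣ + 6 * w #4 ∣ {{it}} {{∣x∣-nonZero 6w≢0}} r₃ s₃ (absolute c (+ 6 * w #4) r₃-norm)
    where
    r = + 2 * y #4 - y #0
    s = y #0 + y #4
    -- The cancellation leaves `N (r + s ω) = 12 c w₄²`, and 12 is not a square. Multiplying by
    -- `1 - ω`, of norm 3, completes it to `6²`.
    r₃ = r * 1ℤ + -1ℤ * s * -1ℤ
    s₃ = r * -1ℤ + s * 1ℤ + -1ℤ * s * -1ℤ
    6w≢0 : + 6 * w #4 ≢ 0ℤ
    6w≢0 e = case ℤ.i*j≡0⇒i≡0∨j≡0 (+ 6) e of λ where
      (inj₂ w₄≡0) → w₄≢0 w₄≡0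
    2n≡ : + 2 * N -1ℤ -1ℤ r s ≡ + 24 * (+ c * (w #4 * w #4))
    2n≡ = by₃ 1ℤ (+ 12 * + c) -[1+ 2 ] (trans (sym (expand y)) (cong (+ 6 *_) (trans similar (cong (+ c *_) (expandF w))))) w-norm ψ-norm
      (solve 6 (λ n c W Z Y p → :2 :* n :- con (+ 24) :* (c :* (p :* p)) :=
        :1 :* (:3 :* Y :+ :2 :* n :- con (+ 6) :* (c :* (:2 :* W :+ :4 :* (p :* p))))
        :+ con (+ 12) :* c :* (W :- c :* Z) :+ con -[1+ 2 ] :* (Y :- :2 :* c :* (:2 :* c) :* Z)) refl
        (N -1ℤ -1ℤ r s) (+ c) (Σ₄² (first₄ w)) Z (Σ₄² (mv ψ y)) (w #4))
    r₃-norm : N -1ℤ -1ℤ r₃ s₃ ≡ + c * (+ 6 * w #4 * (+ 6 * w #4))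
    r₃-norm = trans (sym (N-* -1ℤ -1ℤ r s 1ℤ -1ℤ)) (ℤ.*-cancelˡ-≡ (+ 2) _ _ (by₁ (+ 3) 2n≡
      (solve 3 (λ n c p → :2 :* (n :* :3) :- :2 :* (c :* (con (+ 6) :* p :* (con (+ 6) :* p))) :=
        :3 :* (:2 :* n :- con (+ 24) :* (c :* (p :* p)))) refl (N -1ℤ -1ℤ r s) (+ c) (w #4))))

-- The prime 2 is inert, so a zero of the norm can be halved indefinitely. `π` selects the
-- coordinate on which the descent runs.
N-φ-anisotropic : ∀ r s → N 1ℤ 1ℤ r s ≡ 0ℤ → r ≡ 0ℤ × s ≡ 0ℤ
N-φ-anisotropic r s h = descent (λ r s → r) r s (λ r₁ s₁ r s e _ → e) h (<-wellFounded _) , descent (λ r s → s) r s (λ r₁ s₁ r s _ e → e) h (<-wellFounded _)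
  where
  open ModPrime prime[2]
  module I = Inert small-φ prime[2] (not-norm-φ 2 (inj₁ refl))
  descent : (π : ℤ → ℤ → ℤ) → ∀ r s → (∀ r₁ s₁ r s → r ≡ r₁ * + 2 → s ≡ s₁ * + 2 → π r s ≡ π r₁ s₁ * + 2) →
            N 1ℤ 1ℤ r s ≡ 0ℤ → Acc ℕ._<_ ∣ π r s ∣ → π r s ≡ 0ℤ
  descent π r s π-* h (acc rec) = case π r s ℤ.≟ 0ℤ of λ where
      (yes π≡0) → π≡0
      (no π≢0)  → trans π≡ (cong (_* + 2) (descent π r₁ s₁ π-* N₁≡0 (rec (smaller π≢0))))
    where
    2∣r = ≈0⇒∣ (I.∣N⇒∣r r s (≡⇒≈ h))
    2∣s = ≈0⇒∣ (I.∣N⇒∣s r s (≡⇒≈ h))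
    r₁ = Signed.quotient 2∣r
    s₁ = Signed.quotient 2∣s
    π≡ : π r s ≡ π r₁ s₁ * + 2
    π≡ = π-* r₁ s₁ r s (Signed._∣_.equality 2∣r) (Signed._∣_.equality 2∣s)
    N₁≡0 : N 1ℤ 1ℤ r₁ s₁ ≡ 0ℤ
    N₁≡0 = ℤ.*-cancelˡ-≡ (+ 4) _ _ (trans (sym (solve 2 (λ r s → :N :1 :1 (r :* :2) (s :* :2) := :4 :* :N :1 :1 r s) refl r₁ s₁))
      (trans (cong₂ (N 1ℤ 1ℤ) (sym (Signed._∣_.equality 2∣r)) (sym (Signed._∣_.equality 2∣s))) h))
    smaller : π r s ≢ 0ℤ → ∣ π r₁ s₁ ∣ ℕ.< ∣ π r s ∣
    smaller π≢0 = subst (∣ π r₁ s₁ ∣ ℕ.<_) (sym eq) (ℕ.m<m*n ∣ π r₁ s₁ ∣ 2 {{ℕ.≢-nonZero λ e → π≢0 (ℤ.∣i∣≡0⇒i≡0 (trans eq (cong (ℕ._* 2) e)))}} (ℕ.s≤s (ℕ.s≤s ℕ.z≤n)))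
      where
      eq : ∣ π r s ∣ ≡ ∣ π r₁ s₁ ∣ ℕ.* 2
      eq = trans (cong ∣_∣ π≡) (ℤ.∣i*j∣≡∣i∣*∣j∣ (π r₁ s₁) (+ 2))

-- A₄ ⊥ ⟨5⟩ embeds in ℤ⁵: the columns of F are the projections 5eⱼ - (1, …, 1) of the standard basis vectors.
A₄⇒even : ∀ c .{{_ : ℕ.NonZero c}} → HasMultiplier A₄ c → PrimesEvenPower Is±2mod5 c
-- With `d = 5 c` both sides carry the same four squares, `25 c² Z`.
A₄⇒even c m = go (cancel-four-squares A₄ c m F ψ (+ 5 * + c) (+c≢0 4 c))
  where
  F : Matrix 4 5
  F = rows ((+ 4 ∷ -1ℤ ∷ -1ℤ ∷ -1ℤ ∷ -1ℤ ∷ []) ∷ (+ 3 ∷ + 3 ∷ -[1+ 1 ] ∷ -[1+ 1 ] ∷ -[1+ 1 ] ∷ []) ∷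
             (+ 2 ∷ + 2 ∷ + 2 ∷ -[1+ 2 ] ∷ -[1+ 2 ] ∷ []) ∷ (1ℤ ∷ 1ℤ ∷ 1ℤ ∷ 1ℤ ∷ -[1+ 3 ] ∷ []) ∷ [])
  ψ : Matrix 4 4
  ψ = rows ((1ℤ ∷ 0ℤ ∷ 0ℤ ∷ 0ℤ ∷ []) ∷ (-1ℤ ∷ 1ℤ ∷ 0ℤ ∷ 0ℤ ∷ []) ∷ (0ℤ ∷ -1ℤ ∷ 1ℤ ∷ 0ℤ ∷ []) ∷ (0ℤ ∷ 0ℤ ∷ -1ℤ ∷ 1ℤ ∷ []) ∷ [])
  expand : ∀ y → form A₄ y y ≡ Σ₄² (mv ψ y) + y #3 * y #3
  expand y = solve 4 (λ a b c d → :form (λ i j → con (A₄ i j)) (vec a b c d) (vec a b c d) :=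
      :Σ₄² (λ i → :dot (ψ i) (vec a b c d)) :+ d :* d) refl (y #0) (y #1) (y #2) (y #3)
  sum : Vector 5 → ℤ
  sum w = w #0 + w #1 + w #2 + w #3 + w #4
  -- Beyond the four squares the form is `25 w₄² - 5 σ²` with `σ = sum w`. This is the norm of
  -- `5 w₄ + σ √5`, where `√5 = 2 φ - 1`.
  expandF : ∀ w → form A₄ (mv F w) (mv F w) ≡ + 25 * Σ₄² (first₄ w) + N 1ℤ 1ℤ (+ 5 * w #4 - sum w) (+ 2 * sum w)
  expandF w = solve 5 (λ a b c d e → let s = a :+ b :+ c :+ d :+ e in
      :form (λ i j → con (A₄ i j)) (λ i → :dot (F i) (vec₅ a b c d e)) (λ i → :dot (F i) (vec₅ a b c d e)) :=
      con (+ 25) :* (a :* a :+ b :* b :+ c :* c :+ d :* d) :+ :N :1 :1 (:5 :* e :- s) (:2 :* s))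
    refl (w #0) (w #1) (w #2) (w #3) (w #4)
  go : _ → PrimesEvenPower Is±2mod5 c
  go (w , y , Z , w₄≢0 , similar , w-norm , ψ-norm) = norm⇒even-φ c ∣ n ∣ {{it}} {{∣x∣-nonZero n≢0}} (y₃ * r) (y₃ * s) (absolute c n cn²≡)
    where
    y₃ = y #3
    r = + 5 * w #4 - sum w
    s = + 2 * sum w
    n = N 1ℤ 1ℤ r s
    n≢0 : n ≢ 0ℤ
    n≢0 n≡0 = w₄≢0 (case ℤ.i*j≡0⇒i≡0∨j≡0 (+ 10) (by₂ (+ 2) 1ℤ (proj₁ (N-φ-anisotropic r s n≡0)) (proj₂ (N-φ-anisotropic r s n≡0))
      (solve 2 (λ p σ → con (+ 10) :* p :- :0 := :2 :* (:5 :* p :- σ :- :0) :+ :1 :* (:2 :* σ :- :0)) refl (w #4) (sum w))) of λ where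
        (inj₂ w₄≡0) → w₄≡0)
    -- Here the norm `n` appears beside `c` and the other side is a plain square. Multiplying by `n`
    -- gives `N (y₃ (r + s φ)) = c n²`, with `n` nonzero by anisotropy.
    y₃²≡ : y₃ * y₃ ≡ + c * n
    y₃²≡ = by₃ 1ℤ (+ 25 * + c) -1ℤ (trans (sym (expand y)) (trans similar (cong (+ c *_) (expandF w)))) w-norm ψ-norm
      (solve 6 (λ n c W Z Y q → q :- c :* n := :1 :* (Y :+ q :- c :* (con (+ 25) :* W :+ n)) :+ con (+ 25) :* c :* (W :- c :* Z)
        :+ con -1ℤ :* (Y :- :5 :* c :* (:5 :* c) :* Z)) refl n (+ c) (Σ₄² (first₄ w)) Z (Σ₄² (mv ψ y)) (y₃ * y₃))
    cn²≡ : N 1ℤ 1ℤ (y₃ * r) (y₃ * s) ≡ + c * (n * n)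
    cn²≡ = by₁ n y₃²≡ (solve 4 (λ y r s c → :N :1 :1 (y :* r) (y :* s) :- c :* (:N :1 :1 r s :* :N :1 :1 r s)
      := :N :1 :1 r s :* (y :* y :- c :* :N :1 :1 r s)) refl y₃ r s (+ c))

-- Translation to the stated quadratic forms, and the theorem

⇔rep : ∀ u v (f : ℤ → ℤ → ℤ) → (∀ r s → N u v r s ≡ f r s) → ∀ c → (∃[ r ] ∃[ s ] + c ≡ f r s) ⇔ Rep u v c
⇔rep u v f eq c = mk⇔ (λ (r , s , h) → r , s , trans (eq r s) (sym h)) (λ (r , s , h) → r , s , trans (sym h) (eq r s))

sumOfTwoSquares⇔rep : ∀ c → SumOfTwoSquares c ⇔ Rep 0ℤ -1ℤ c
sumOfTwoSquares⇔rep = ⇔rep 0ℤ -1ℤ (λ r s → r * r + s * s) (solve 2 (λ r s → :N :0 (con -1ℤ) r s := r :* r :+ s :* s) refl)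

isR²-RS+S²⇔rep : ∀ c → IsR²-RS+S² c ⇔ Rep -1ℤ -1ℤ c
isR²-RS+S²⇔rep = ⇔rep -1ℤ -1ℤ (λ r s → r * r - r * s + s * s) (solve 2 (λ r s → :N (con -1ℤ) (con -1ℤ) r s := r :* r :- r :* s :+ s :* s) refl)

isR²+RS-S²⇔rep : ∀ c → IsR²+RS-S² c ⇔ Rep 1ℤ 1ℤ c
isR²+RS-S²⇔rep = ⇔rep 1ℤ 1ℤ (λ r s → r * r + r * s - s * s) (solve 2 (λ r s → :N :1 :1 r s := r :* r :+ r :* s :- s :* s) refl)

rep⇒norm : ∀ c {n} → n ≡ + c → n ≡ + c * 1ℤ * 1ℤ
rep⇒norm c h = trans h (sym (trans (ℤ.*-identityʳ _) (ℤ.*-identityʳ _)))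

rep⇒even-i : ∀ c .{{_ : ℕ.NonZero c}} → Rep 0ℤ -1ℤ c → PrimesEvenPower Is3mod4 c
rep⇒even-i c (r , s , h) = norm⇒even-i c 1 r s (rep⇒norm c h)

rep⇒even-ω : ∀ c .{{_ : ℕ.NonZero c}} → Rep -1ℤ -1ℤ c → PrimesEvenPower Is2mod3 c
rep⇒even-ω c (r , s , h) = norm⇒even-ω c 1 r s (rep⇒norm c h)

rep⇒even-φ : ∀ c .{{_ : ℕ.NonZero c}} → Rep 1ℤ 1ℤ c → PrimesEvenPower Is±2mod5 c
rep⇒even-φ c (r , s , h) = norm⇒even-φ c 1 r s (rep⇒norm c h)

theorem2 : (c : ℕ) → c > 0 →
    ((HasMultiplier (ℤⁿ 2) c ⇔ SumOfTwoSquares c) ×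
    (HasMultiplier (ℤⁿ 6) c ⇔ SumOfTwoSquares c) ×
    (SumOfTwoSquares c ⇔ PrimesEvenPower Is3mod4 c)) ×
    ((HasMultiplier A₂ c ⇔ IsR²-RS+S² c) ×
    (HasMultiplier E₆ c ⇔ IsR²-RS+S² c) ×
    (IsR²-RS+S² c ⇔ PrimesEvenPower Is2mod3 c)) ×
    ((HasMultiplier A₄ c ⇔ IsR²+RS-S² c) ×
    (IsR²+RS-S² c ⇔ PrimesEvenPower Is±2mod5 c))
theorem2 c c>0 =
  ( mk⇔ (λ m → I.from (ℤ²⇒rep c m)) (λ h → rep⇒ℤ² c (I.to h))
  , mk⇔ (λ m → I.from (even⇒rep-i c (ℤ⁶⇒even c m))) (λ h → rep⇒ℤ⁶ c (I.to h))
  , mk⇔ (λ h → rep⇒even-i c (I.to h)) (λ e → I.from (even⇒rep-i c e)) ) ,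
  ( mk⇔ (λ m → W.from (A₂⇒rep c m)) (λ h → rep⇒A₂ c (W.to h))
  , mk⇔ (λ m → W.from (even⇒rep-ω c (E₆⇒even c m))) (λ h → rep⇒E₆ c (W.to h))
  , mk⇔ (λ h → rep⇒even-ω c (W.to h)) (λ e → W.from (even⇒rep-ω c e)) ) ,
  ( mk⇔ (λ m → F.from (even⇒rep-φ c (A₄⇒even c m))) (λ h → even⇒A₄-multiplier c (rep⇒even-φ c (F.to h)))
  , mk⇔ (λ h → rep⇒even-φ c (F.to h)) (λ e → F.from (even⇒rep-φ c e)) )
  where
  instance
    c-nonZero : ℕ.NonZero c
    c-nonZero = ℕ.>-nonZero c>0
  module I = Equivalence (sumOfTwoSquares⇔rep c)
  module W = Equivalence (isR²-RS+S²⇔rep c)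
  module F = Equivalence (isR²+RS-S²⇔rep c)
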